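{- For any partition $\mu$, $$\prod_{i,\,j\geqslant 1}\frac{1-a_{i-\mu_i}\,y_j}{1-x_i\,y_j}\;s_\mu(x\|a)=\sum_{\nu}s_\nu(x\|a)\,\widehat s_{\nu/\mu}(y\|a),$$ summed over partitions $\nu$ containing $\mu$, where $\widehat s_{\nu/\mu}(y\|a)$ is the skew dual Schur function defined by the tableau formula in the context. In particular, for any partition (normal, i.e. nonskew, diagram) $\lambda$ the dual Schur function $\widehat s_\lambda(x\|a)$ (defined as a ratio of determinants) admits the tableau presentation $$\widehat s_{\lambda}(x\|a)=\sum_{T}\prod_{\alpha\in\lambda}X_{T(\alpha)}(a_{ -c(\alpha)+1},a_{ -c(\alpha)}),$$ summed over the reverse $\lambda$-tableaux $T$.
   Context: Let $a=(a_i)_{i\in\mathbb Z}$ be a sequence of commuting indeterminates and $\mathbb Q[a]$ the polynomial ring in the $a_i$. The ring $\Lambda(x\|a)$: its elements are sequences $P=(P_0,P_1,P_2,\dots)$, where $P_n$ is a symmetric polynomial in $x_1,\dots,x_n$ with coefficients in $\mathbb Q[a]$, the total degrees of the $P_n$ in the $x_i$ are bounded, and $P_n(x_1,\dots,x_{n-1},a_n)=P_{n-1}(x_1,\dots,x_{n-1})$ for all $n\geqslant 1$; multiplication is componentwise. Double Schur functions: for a partition $\lambda$ with length $\ell(\lambda)\leqslant n$, $$s_\lambda(x_1,\dots,x_n\|a)=\frac{\det\big[(x_i\|a)^{\lambda_j+n-j}\big]_{i,j=1}^n}{\prod_{1\leqslant i<j\leqslant n}(x_i-x_j)},\qquad (x_i\|a)^r=(x_i-a_n)(x_i-a_{n-1})\cdots(x_i-a_{n-r+1}),\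 (x_i\|a)^0=1,$$ and $s_\lambda(x_1,\dots,x_n\|a)=0$ if $\ell(\lambda)>n$. This sequence (over $n$) is $s_\lambda(x\|a)\in\Lambda(x\|a)$. Dual Schur functions (determinantal definition): let $\widehat\Lambda(x\|a)$ be the ring of formal (possibly infinite) sums $\sum_{\lambda}c_\lambda(a)s_\lambda(x)$, $c_\lambda(a)\in\mathbb Q[a]$, with $s_\lambda(x)$ the ordinary Schur functions. Let $d$ be the number of boxes on the main diagonal of $\lambda$. For $n\geqslant\ell(\lambda)$, $$\widehat s_\lambda(x_1,\dots,x_n\|a)=\frac{\det[A_{ij}]_{i,j=1}^n}{\prod_{1\leqslant i<j\leqslant n}(x_i-x_j)},$$ where $A_{ij}=\dfrac{x_i^{\lambda_j+n-j}}{(1-a_0x_i)(1-a_{ -1}x_i)\cdots(1-a_{j-\lambda_j}x_i)}$ for $1\leqslant j\leqslant d$ and $A_{ij}=x_i^{\lambda_j+n-j}(1-a_1x_i)(1-a_2x_i)\cdots(1-a_{j-\lambda_j-1}x_i)$ for $d<j\leqslant n$; it is $0$ if $\ell(\lambda)>n$. These are compatible with setting $x_n=0$ and define $\widehat s_\lambda(x\|a)\in\widehat\Lambda(x\|a)$. Tableaux: for a (skew) diagram $\theta$, a reverse $\theta$-tableau is a filling $T$ of the boxes of $\theta$ with positive integers weakly decreasing along the rows and strictly decreasing down the columns; the content of the box $\alpha=(i,j)$ (row $i$, column $j$) is $c(\alpha)=j-i$. Put $$X_i(g,h)=\frac{x_i(1-g\,x_{i-1})\cdots(1-g\,x_1)}{(1-h\,x_i)\cdots(1-h\,x_1)}.$$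 The skew dual Schur function is the formal series $\widehat s_\theta(x\|a)=\sum_T\prod_{\alpha\in\theta}X_{T(\alpha)}(a_{ -c(\alpha)+1},a_{ -c(\alpha)})$ over the reverse $\theta$-tableaux $T$; $\widehat s_\theta(y\|a)$ is the same with $y$ in place of $x$. Meaning of the identity: for each $n\geqslant\ell(\mu)$ replace $x$ by $(x_1,\dots,x_n)$, with $i$ in the product running over $1,\dots,n$; this is an identity of formal power series in $y=(y_1,y_2,\dots)$. -}

module Defs where

open import Algebra.Bundles using (CommutativeRing)
import Algebra.Properties.CommutativeSemigroup as CommutativeSemigroupProperties
import Algebra.Properties.CommutativeMonoid.Sum as FiniteSum
import Algebra.Properties.Ring as RingProperties
import Algebra.Properties.Semiring.Exp as Exponentiation
open import Data.Fin.Base as Fin using (Fin; toℕ; punchIn)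
open import Data.Integer.Base as ℤ using (ℤ; +_)
open import Data.List.Base using
  (List; []; _∷_; map; foldr; filter; concatMap; replicate; upTo; length; cartesianProductWith)
open import Data.List.Membership.Propositional using (_∉_)
open import Data.List.Relation.Unary.All as All using (All)
import Data.List.Relation.Unary.All.Properties as AllProperties
open import Data.List.Relation.Unary.Linked using (Linked; [])
open import Data.List.Relation.Unary.Unique.Propositional using (Unique)
open import Data.Nat.Base using (ℕ; zero; suc; _+_; _∸_; _≤_; _<_; _≥_; z≤n; s≤s; s≤s⁻¹)
open import Data.Nat.Properties using (_≟_; _≤?_; _<?_; ≤∧≢⇒<; <⇒≢; ≤-trans; 1+n≰n)
open import Data.Product.Base using (_×_; _,_; proj₁; proj₂; Σ-syntax)
open import Data.Rational.Base as ℚ using (ℚ; 0ℚ; 1ℚ)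
open import Data.Vec.Base using (Vec; []; _∷_)
open import Function.Base using (_∘_)
open import Level using (Level; _⊔_; 0ℓ)
open import Relation.Binary.PropositionalEquality.Core as ≡ using (_≡_)
open import Relation.Nullary using (Dec; yes; no; contradiction)
open import Relation.Nullary.Decidable using (_×-dec_; _→-dec_)
import Relation.Binary.Reasoning.Setoid as SetoidReasoning

private
  variable
    c ℓ i p : Level

-- Unlike if does … then …, this reduces after with-abstraction of the
-- decision.
ifDec_then_else_ : ∀ {P : Set p} {A : Set ℓ} → Dec P → A → A → A
ifDec yes _ then x else y = x
ifDec no  _ then x else y = y

------------------------------------------------------------------------
-- The polynomial ring ℚ[a] in the indeterminates a_k, k ∈ ℤ, presented
-- as the free commutative ℚ-algebra on ℤ: terms modulo the congruence
-- generated by the axioms of a commutative ring and by the requirement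
-- that κ : ℚ → ℚ[a] be a ring homomorphism.

module Polynomial where

  infixl 6 _⊕_
  infixl 7 _⊗_
  infix  8 ⊖_
  infix  4 _≋_

  data Term : Set where
    κ       : ℚ → Term
    𝕒       : ℤ → Term
    _⊕_ _⊗_ : Term → Term → Term
    ⊖_      : Term → Term

  data _≋_ : Term → Term → Set where
    ≋-refl  : ∀ {s} → s ≋ s
    ≋-sym   : ∀ {s t} → s ≋ t → t ≋ s
    ≋-trans : ∀ {s t u} → s ≋ t → t ≋ u → s ≋ u

    ⊕-cong  : ∀ {s s′ t t′} → s ≋ s′ → t ≋ t′ → s ⊕ t ≋ s′ ⊕ t′
    ⊗-cong  : ∀ {s s′ t t′} → s ≋ s′ → t ≋ t′ → s ⊗ t ≋ s′ ⊗ t′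
    ⊖-cong  : ∀ {s t} → s ≋ t → ⊖ s ≋ ⊖ t

    ⊕-assoc : ∀ s t u → (s ⊕ t) ⊕ u ≋ s ⊕ (t ⊕ u)
    ⊕-comm  : ∀ s t → s ⊕ t ≋ t ⊕ s
    ⊕-idˡ   : ∀ s → κ 0ℚ ⊕ s ≋ s
    ⊕-invˡ  : ∀ s → (⊖ s) ⊕ s ≋ κ 0ℚ
    ⊗-assoc : ∀ s t u → (s ⊗ t) ⊗ u ≋ s ⊗ (t ⊗ u)
    ⊗-comm  : ∀ s t → s ⊗ t ≋ t ⊗ s
    ⊗-idˡ   : ∀ s → κ 1ℚ ⊗ s ≋ s
    distˡ   : ∀ s t u → s ⊗ (t ⊕ u) ≋ (s ⊗ t) ⊕ (s ⊗ u)

    κ-⊕     : ∀ q r → κ (q ℚ.+ r) ≋ κ q ⊕ κ r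
    κ-⊗     : ∀ q r → κ (q ℚ.* r) ≋ κ q ⊗ κ r

open Polynomial using (𝕒) public

ℚ[a] : CommutativeRing 0ℓ 0ℓ
ℚ[a] = record
  { Carrier = Term ; _≈_ = _≋_ ; _+_ = _⊕_ ; _*_ = _⊗_ ; -_ = ⊖_ ; 0# = κ 0ℚ ; 1# = κ 1ℚ
  ; isCommutativeRing = record
    { isRing = record
      { +-isAbelianGroup = record
        { isGroup = record
          { isMonoid = record
            { isSemigroup = record
              { isMagma = record
                { isEquivalence = record { refl = ≋-refl ; sym = ≋-sym ; trans = ≋-trans }
                ; ∙-cong = ⊕-cong }
              ; assoc = ⊕-assoc }
            ; identity = ⊕-idˡ , λ s → ≋-trans (⊕-comm _ _) (⊕-idˡ s) }
          ; inverse = ⊕-invˡ , λ s → ≋-trans (⊕-comm _ _) (⊕-invˡ s)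
          ; ⁻¹-cong = ⊖-cong }
        ; comm = ⊕-comm }
      ; *-cong = ⊗-cong
      ; *-assoc = ⊗-assoc
      ; *-identity = ⊗-idˡ , λ s → ≋-trans (⊗-comm _ _) (⊗-idˡ s)
      ; distrib = distˡ , λ s t u → ≋-trans (⊗-comm _ _)
          (≋-trans (distˡ s t u) (⊕-cong (⊗-comm _ _) (⊗-comm _ _))) }
    ; *-comm = ⊗-comm } }
  where open Polynomial

------------------------------------------------------------------------
-- Formal power series in one variable; f : ℕ → R stands for Σₖ f(k) Xᵏ.

module PowerSeriesIn (R : CommutativeRing c ℓ) where

  open CommutativeRing R
    renaming (_+_ to _+ᴿ_; _*_ to _*ᴿ_; -_ to -ᴿ_; Carrier to A; _≈_ to _≈ᴿ_)
  open CommutativeSemigroupProperties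
    (CommutativeRing.+-commutativeSemigroup R) using (interchange)
  open Exponentiation semiring using () renaming (_^_ to _^ᴿ_)
  open SetoidReasoning setoid

  tail : (ℕ → A) → ℕ → A
  tail f k = f (suc k)

  convolve : (ℕ → A) → (ℕ → A) → ℕ → A
  convolve f g zero    = f 0 *ᴿ g 0
  convolve f g (suc k) = f 0 *ᴿ g (suc k) +ᴿ convolve (tail f) g k

  constant : A → ℕ → A
  constant u zero    = u
  constant u (suc _) = 0#

  indeterminate : ℕ → A
  indeterminate 1 = 1#
  indeterminate _ = 0#

  private
    conv-cong : ∀ {f f′ g g′} → (∀ k → f k ≈ᴿ f′ k) → (∀ k → g k ≈ᴿ g′ k) →
                ∀ k → convolve f g k ≈ᴿ convolve f′ g′ k
    conv-cong p q zero    = *-cong (p 0) (q 0)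
    conv-cong p q (suc k) =
      +-cong (*-cong (p 0) (q (suc k))) (conv-cong (λ j → p (suc j)) q k)

    conv-distribʳ : ∀ h f g k → convolve (λ j → f j +ᴿ g j) h k ≈ᴿ convolve f h k +ᴿ convolve g h k
    conv-distribʳ h f g zero    = distribʳ _ _ _
    conv-distribʳ h f g (suc k) =
      trans (+-cong (distribʳ _ _ _) (conv-distribʳ h (tail f) (tail g) k)) (interchange _ _ _ _)

    conv-last : ∀ f g k → convolve f g (suc k) ≈ᴿ convolve f (tail g) k +ᴿ f (suc k) *ᴿ g 0
    conv-last f g zero    = refl
    conv-last f g (suc k) =
      trans (+-congˡ (conv-last (tail f) g k)) (sym (+-assoc _ _ _))

    conv-comm : ∀ f g k → convolve f g k ≈ᴿ convolve g f k
    conv-comm f g zero    = *-comm _ _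
    conv-comm f g (suc k) = begin
      f 0 *ᴿ g (suc k) +ᴿ convolve (tail f) g k  ≈⟨ +-cong (*-comm _ _) (conv-comm (tail f) g k) ⟩
      g (suc k) *ᴿ f 0 +ᴿ convolve g (tail f) k  ≈⟨ +-comm _ _ ⟩
      convolve g (tail f) k +ᴿ g (suc k) *ᴿ f 0  ≈⟨ conv-last g f k ⟨
      convolve g f (suc k)                       ∎

    conv-scale : ∀ u f g k → convolve (λ j → u *ᴿ f j) g k ≈ᴿ u *ᴿ convolve f g k
    conv-scale u f g zero    = *-assoc _ _ _
    conv-scale u f g (suc k) =
      trans (+-cong (*-assoc _ _ _) (conv-scale u (tail f) g k)) (sym (distribˡ _ _ _))

    conv-assoc : ∀ f g h k → convolve (convolve f g) h k ≈ᴿ convolve f (convolve g h) k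
    conv-assoc f g h zero    = *-assoc _ _ _
    conv-assoc f g h (suc k) = begin
      (f 0 *ᴿ g 0) *ᴿ h (suc k) +ᴿ convolve (λ j → f 0 *ᴿ g (suc j) +ᴿ convolve (tail f) g j) h k
        ≈⟨ +-cong (*-assoc _ _ _) (trans (conv-distribʳ h _ _ k)
             (+-cong (conv-scale (f 0) (tail g) h k) (conv-assoc (tail f) g h k))) ⟩
      f 0 *ᴿ (g 0 *ᴿ h (suc k)) +ᴿ (f 0 *ᴿ convolve (tail g) h k +ᴿ convolve (tail f) (convolve g h) k)
        ≈⟨ trans (sym (+-assoc _ _ _)) (+-congʳ (sym (distribˡ _ _ _))) ⟩
      convolve f (convolve g h) (suc k) ∎

    conv-zero : ∀ g k → convolve (λ _ → 0#) g k ≈ᴿ 0#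
    conv-zero g zero    = zeroˡ _
    conv-zero g (suc k) = trans (+-cong (zeroˡ _) (conv-zero g k)) (+-identityˡ _)

  constant-* : ∀ u g k → convolve (constant u) g k ≈ᴿ u *ᴿ g k
  constant-* u g zero    = refl
  constant-* u g (suc k) = trans (+-congˡ (conv-zero g k)) (+-identityʳ _)

  indeterminate-*₀ : ∀ g → convolve indeterminate g 0 ≈ᴿ 0#
  indeterminate-*₀ g = zeroˡ _

  indeterminate-* : ∀ g k → convolve indeterminate g (suc k) ≈ᴿ g k
  indeterminate-* g k = begin
    0# *ᴿ g (suc k) +ᴿ convolve (tail indeterminate) g k
      ≈⟨ +-cong (zeroˡ _) (conv-cong tail≈1 (λ _ → refl) k) ⟩
    0# +ᴿ convolve (constant 1#) g k  ≈⟨ +-identityˡ _ ⟩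
    convolve (constant 1#) g k        ≈⟨ constant-* 1# g k ⟩
    1# *ᴿ g k                         ≈⟨ *-identityˡ _ ⟩
    g k                               ∎
    where
    tail≈1 : ∀ j → tail indeterminate j ≈ᴿ constant 1# j
    tail≈1 zero    = refl
    tail≈1 (suc j) = refl

  PowerSeries : CommutativeRing c ℓ
  PowerSeries = record
    { Carrier = ℕ → A
    ; _≈_ = λ f g → ∀ k → f k ≈ᴿ g k
    ; _+_ = λ f g k → f k +ᴿ g k
    ; _*_ = convolve
    ; -_  = λ f k → -ᴿ f k
    ; 0#  = λ _ → 0#
    ; 1#  = constant 1#
    ; isCommutativeRing = record
      { isRing = record
        { +-isAbelianGroup = record
          { isGroup = record
            { isMonoid = record
              { isSemigroup = record
                { isMagma = record
                  { isEquivalence = record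
                    { refl  = λ _ → refl
                    ; sym   = λ e k → sym (e k)
                    ; trans = λ e e′ k → trans (e k) (e′ k) }
                  ; ∙-cong = λ e e′ k → +-cong (e k) (e′ k) }
                ; assoc = λ _ _ _ _ → +-assoc _ _ _ }
              ; identity = (λ _ _ → +-identityˡ _) , (λ _ _ → +-identityʳ _) }
            ; inverse = (λ _ _ → -‿inverseˡ _) , (λ _ _ → -‿inverseʳ _)
            ; ⁻¹-cong = λ e k → -‿cong (e k) }
          ; comm = λ _ _ _ → +-comm _ _ }
        ; *-cong = conv-cong
        ; *-assoc = conv-assoc
        ; *-identity =
            (λ g k → trans (constant-* 1# g k) (*-identityˡ _)) ,
            (λ g k → trans (conv-comm g _ k) (trans (constant-* 1# g k) (*-identityˡ _)))
        ; distrib =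
            (λ h f g k → trans (conv-comm h _ k) (trans (conv-distribʳ h f g k)
              (+-cong (conv-comm f h k) (conv-comm g h k)))) ,
            conv-distribʳ }
      ; *-comm = conv-comm } }

  constant-cong : ∀ {u v} → u ≈ᴿ v → ∀ k → constant u k ≈ᴿ constant v k
  constant-cong e zero    = e
  constant-cong e (suc _) = refl

  constant-hom : ∀ u v k → convolve (constant u) (constant v) k ≈ᴿ constant (u *ᴿ v) k
  constant-hom u v k = trans (constant-* u (constant v) k) (lemma k)
    where
    lemma : ∀ k → u *ᴿ constant v k ≈ᴿ constant (u *ᴿ v) k
    lemma zero    = refl
    lemma (suc _) = zeroʳ u

  geometric-* : ∀ u k → convolve (λ p → constant 1# p +ᴿ -ᴿ convolve (constant u) indeterminate p)
                                 (u ^ᴿ_) k ≈ᴿ constant 1# k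
  geometric-* u k = begin
    convolve (λ p → constant 1# p +ᴿ -ᴿ convolve (constant u) indeterminate p) G k
      ≈⟨ conv-distribʳ G (constant 1#) _ k ⟩
    convolve (constant 1#) G k +ᴿ convolve (λ p → -ᴿ convolve (constant u) indeterminate p) G k
      ≈⟨ +-cong (trans (constant-* 1# G k) (*-identityˡ _))
           (trans (conv-cong (λ p → minus p) (λ _ → refl) k)
             (trans (conv-scale (-ᴿ 1#) _ G k) (*-congˡ (trans (conv-assoc _ indeterminate G k)
               (constant-* u (convolve indeterminate G) k))))) ⟩
    G k +ᴿ (-ᴿ 1#) *ᴿ (u *ᴿ convolve indeterminate G k)
      ≈⟨ +-congˡ (sym (minus′ _)) ⟩
    G k +ᴿ -ᴿ (u *ᴿ convolve indeterminate G k)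
      ≈⟨ telescope k ⟩
    constant 1# k ∎
    where
    open RingProperties ring using (-1*x≈-x; -0#≈0#)
    G : ℕ → A
    G = u ^ᴿ_
    minus′ : ∀ v → -ᴿ v ≈ᴿ (-ᴿ 1#) *ᴿ v
    minus′ v = sym (-1*x≈-x v)
    minus : ∀ p → -ᴿ convolve (constant u) indeterminate p ≈ᴿ
                  (-ᴿ 1#) *ᴿ convolve (constant u) indeterminate p
    minus p = minus′ _
    telescope : ∀ k → G k +ᴿ -ᴿ (u *ᴿ convolve indeterminate G k) ≈ᴿ constant 1# k
    telescope zero    =
      trans (+-congˡ (trans (-‿cong (trans (*-congˡ (indeterminate-*₀ G)) (zeroʳ u))) -0#≈0#))
            (+-identityʳ _)
    telescope (suc k) =
      trans (+-congˡ (-‿cong (*-congˡ (indeterminate-* G k)))) (-‿inverseʳ _)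

open PowerSeriesIn using (PowerSeries) public

------------------------------------------------------------------------
-- R[[x₁,…,xₙ]] as R[[x₁,…,xₙ₋₁]][[xₙ]].

Series : CommutativeRing c ℓ → ℕ → CommutativeRing c ℓ
Series R zero    = R
Series R (suc n) = PowerSeries (Series R n)

oneTo : ℕ → List ℕ
oneTo n = map suc (upTo n)

module BigOperators (R : CommutativeRing c ℓ) where

  open CommutativeRing R renaming (_+_ to _+ᴿ_)

  ∑ : List Carrier → Carrier
  ∑ = foldr _+ᴿ_ 0#

  ∏ : List Carrier → Carrier
  ∏ = foldr _*_ 1#

  -- ∏[ n ] f = f(1) f(2) ⋯ f(n)
  ∏[_]_ : ℕ → (ℕ → Carrier) → Carrier
  ∏[ zero  ] f = 1#
  ∏[ suc n ] f = (∏[ n ] f) * f (suc n)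

module Determinant (R : CommutativeRing c ℓ) where

  open CommutativeRing R using (Carrier; _*_; -_; 1#; semiring; +-commutativeMonoid)
  open FiniteSum +-commutativeMonoid using (sum)
  open Exponentiation semiring using (_^_)

  -- Expansion along the first row.
  det : ∀ n → (Fin n → Fin n → Carrier) → Carrier
  det zero    M = 1#
  det (suc n) M =
    sum λ j → (- 1#) ^ toℕ j * (M Fin.zero j * det n λ k l → M (Fin.suc k) (punchIn j l))

module Variables (R : CommutativeRing c ℓ) where

  open CommutativeRing using (Carrier)
  module Ser n = CommutativeRing (Series R n)

  const : ∀ n → Carrier R → Ser.Carrier n
  const zero    u = u
  const (suc n) u = PowerSeriesIn.constant (Series R n) (const n u)

  -- In R[[x₁,…,xₙ]] the variable x_k, and 1/(1 - u x_k) for u ∈ R (see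
  -- geometric-inverse). For k > n they are 0 and 1, their images under
  -- setting x_k = 0.

  var : ∀ n → ℕ → Ser.Carrier n
  var zero    k = Ser.0# zero
  var (suc n) k =
    ifDec (k ≟ suc n) then PowerSeriesIn.indeterminate (Series R n)
                        else PowerSeriesIn.constant (Series R n) (var n k)

  geometric : ∀ n → Carrier R → ℕ → Ser.Carrier n
  geometric zero    u k = Ser.1# zero
  geometric (suc n) u k =
    ifDec (k ≟ suc n) then (λ p → const n u ^ p)
                        else PowerSeriesIn.constant (Series R n) (geometric n u k)
    where open Exponentiation (Ser.semiring n) using (_^_)

  -- 1 - u x_k
  oneMinus : ∀ n → Carrier R → ℕ → Ser.Carrier n
  oneMinus n u k = Ser._-_ n (Ser.1# n) (Ser._*_ n (const n u) (var n k))

  -- The coefficient of x₁^e₁ ⋯ xₙ^eₙ, where the exponents are listed as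
  -- eₙ ∷ … ∷ e₁ ∷ [].
  coeff : ∀ {n} → Vec ℕ n → Ser.Carrier n → Carrier R
  coeff []      f = f
  coeff (k ∷ e) f = coeff e (f k)

  -- Sums of (possibly infinite) families of series, indexed by the
  -- elements of I satisfying P: for each monomial all but finitely many
  -- members have coefficient zero, and the others add up to that of F.

  IsSum : ∀ n {I : Set i} (P : I → Set p) (f : I → Ser.Carrier n) (F : Ser.Carrier n) →
          Set (ℓ ⊔ i ⊔ p)
  IsSum {i = i} n {I} P f F =
    ∀ (e : Vec ℕ n) → Σ[ L ∈ List I ]
      Unique L × All P L ×
      (∀ k → P k → k ∉ L → coeff e (f k) ≈ 0#) ×
      (∑ (map (λ k → coeff e (f k)) L) ≈ coeff e F)
    where
    open CommutativeRing R using (_≈_; 0#)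
    open BigOperators R using (∑)

  -- Exact division by x_k: a monomial x_k^e… goes to x_k^(e-1)…, or to 0
  -- if e = 0.
  divVar : ∀ n → ℕ → Ser.Carrier n → Ser.Carrier n
  divVar zero    k f = f
  divVar (suc n) k f =
    ifDec (k ≟ suc n) then (λ p → f (suc p)) else (λ p → divVar n k (f p))

  -- Exact division by x_k - x_l for 1 ≤ k < l ≤ n. In R[[x₁,…,x_l]], if
  -- (x_k - x_l) Σ g_p x_l^p = Σ f_p x_l^p, then x_k g_0 = f_0 and
  -- x_k g_(p+1) = f_(p+1) + g_p.
  divDiff : ∀ n → ℕ → ℕ → Ser.Carrier n → Ser.Carrier n
  divDiff zero    k l f = f
  divDiff (suc n) k l f = ifDec (l ≟ suc n) then quotient else λ p → divDiff n k l (f p)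
    where
    quotient : ℕ → Ser.Carrier n
    quotient zero    = divVar n k (f zero)
    quotient (suc p) = divVar n k (Ser._+_ n (f (suc p)) (quotient p))

  -- The pairs k < l with l ≤ n.
  pairs : ℕ → List (ℕ × ℕ)
  pairs n = concatMap (λ l → map (λ k → k , l) (oneTo (l ∸ 1))) (oneTo n)

  vandermonde : ∀ n → Ser.Carrier n
  vandermonde n = ∏ (map (λ (k , l) → Ser._-_ n (var n k) (var n l)) (pairs n))
    where open BigOperators (Series R n) using (∏)

  -- The quotient by ∏_{k<l} (x_k - x_l); see divVandermonde-unique.
  divVandermonde : ∀ n → Ser.Carrier n → Ser.Carrier n
  divVandermonde n f = foldr (λ (k , l) → divDiff n k l) f (pairs n)

  geometric-inverse : ∀ n u k → let open Ser n in oneMinus n u k * geometric n u k ≈ 1#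
  geometric-inverse zero u k = trans (*-identityʳ _) (trans (+-congˡ (trans (-‿cong (zeroʳ u)) -0#≈0#))
                                                            (+-identityʳ _))
    where
    open Ser zero
    open RingProperties ring using (-0#≈0#)
  geometric-inverse (suc n) u k with k ≟ suc n
  ... | yes _ = PowerSeriesIn.geometric-* (Series R n) (const n u)
  ... | no  _ = S.trans (S.*-congʳ {constant (geometric n u k)} lift)
                  (S.trans (constant-hom _ _) (constant-cong (geometric-inverse n u k)))
    where
    open PowerSeriesIn (Series R n)
    module S = Ser (suc n)
    open Ser n
    open RingProperties ring using (-0#≈0#)
    lift : ∀ p → constant 1# p - convolve (constant (const n u)) (constant (var n k)) p
               ≈ constant (oneMinus n u k) p
    lift p = trans (+-congˡ (-‿cong (constant-hom (const n u) (var n k) p))) (lemma p)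
      where
      lemma : ∀ p → constant 1# p - constant (const n u * var n k) p ≈ constant (oneMinus n u k) p
      lemma zero    = refl
      lemma (suc _) = trans (+-congˡ -0#≈0#) (+-identityʳ _)

  divVar-cong : ∀ n k {f g} → Ser._≈_ n f g → Ser._≈_ n (divVar n k f) (divVar n k g)
  divVar-cong zero    k e = e
  divVar-cong (suc n) k e with k ≟ suc n
  ... | yes _ = λ p → e (suc p)
  ... | no  _ = λ p → divVar-cong n k (e p)

  divVar-unique : ∀ n {k} g → 1 ≤ k → k ≤ n → Ser._≈_ n (divVar n k (Ser._*_ n (var n k) g)) g
  divVar-unique zero    {suc _} g _ ()
  divVar-unique (suc n) {k} g 1≤k k≤n with k ≟ suc n
  ... | yes _ = PowerSeriesIn.indeterminate-* (Series R n) g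
  ... | no k≢ = λ p → Ser.trans n
    (divVar-cong n k (PowerSeriesIn.constant-* (Series R n) (var n k) g p))
    (divVar-unique n (g p) 1≤k (s≤s⁻¹ (≤∧≢⇒< k≤n k≢)))

  divDiff-cong : ∀ n k l {f g} → Ser._≈_ n f g → Ser._≈_ n (divDiff n k l f) (divDiff n k l g)
  divDiff-cong zero    k l e = e
  divDiff-cong (suc n) k l {f} {g} e with l ≟ suc n
  ... | no  _ = λ p → divDiff-cong n k l (e p)
  ... | yes _ = go
    where
    go : ∀ p → Ser._≈_ n _ _
    go zero    = divVar-cong n k (e 0)
    go (suc p) = divVar-cong n k (Ser.+-cong n (e (suc p)) (go p))

  divDiff-unique : ∀ n {k l} g → 1 ≤ k → k < l → l ≤ n →
    let open Ser n in divDiff n k l ((var n k - var n l) * g) ≈ g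
  divDiff-unique zero    {l = suc _} g _ _ ()
  divDiff-unique (suc n) {k} {l} g 1≤k k<l l≤n with l ≟ suc n | k ≟ suc n
  ... | yes ≡.refl | yes ≡.refl = contradiction ≡.refl (<⇒≢ k<l)
  ... | no  _      | yes ≡.refl = contradiction (≤-trans k<l l≤n) 1+n≰n
  ... | yes ≡.refl | no  _ = go
    where
    open PowerSeriesIn (Series R n)
    module S = Ser (suc n)
    open Ser n
    open RingProperties ring using (-0#≈0#)
    xₖ = var n k
    k≤n = s≤s⁻¹ k<l
    expand : ∀ p → convolve (λ q → constant xₖ q - indeterminate q) g p
                 ≈ xₖ * g p - convolve indeterminate g p
    expand p = trans (S.distribʳ g (constant xₖ) (S.- indeterminate) p)
      (+-cong (constant-* xₖ g p)
              (sym (RingProperties.-‿distribˡ-* S.ring indeterminate g p)))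
    go : ∀ p → _ ≈ g p
    go zero    = trans
      (divVar-cong n k (trans (expand 0)
        (trans (+-congˡ (trans (-‿cong (indeterminate-*₀ g)) -0#≈0#)) (+-identityʳ _))))
      (divVar-unique n (g 0) 1≤k k≤n)
    go (suc p) = trans
      (divVar-cong n k (trans (+-cong (expand (suc p)) (go p))
        (trans (+-congʳ (+-congˡ (-‿cong (indeterminate-* g p))))
          (trans (+-assoc _ _ _) (trans (+-congˡ (-‿inverseˡ _)) (+-identityʳ _))))))
      (divVar-unique n (g (suc p)) 1≤k k≤n)
  ... | no  l≢     | no  _ = λ p → trans
      (divDiff-cong n k l (trans (S.*-congʳ {g} lift p) (constant-* _ g p)))
      (divDiff-unique n (g p) 1≤k k<l (s≤s⁻¹ (≤∧≢⇒< l≤n l≢)))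
    where
    open PowerSeriesIn (Series R n)
    module S = Ser (suc n)
    open Ser n
    open RingProperties ring using (-0#≈0#)
    lift : ∀ p → constant (var n k) p - constant (var n l) p ≈ constant (var n k - var n l) p
    lift zero    = refl
    lift (suc _) = trans (+-congˡ -0#≈0#) (+-identityʳ _)

  pairs-bounds : ∀ n → All (λ (k , l) → 1 ≤ k × k < l × l ≤ n) (pairs n)
  pairs-bounds n = AllProperties.concat⁺ (AllProperties.map⁺ (AllProperties.map⁺ (AllProperties.applyUpTo⁺₁ _ n λ {l} l<n →
    AllProperties.map⁺ (AllProperties.map⁺ (AllProperties.applyUpTo⁺₁ _ l λ k<l → s≤s z≤n , s≤s k<l , l<n)))))

  divVandermonde-unique : ∀ n g {f} → let open Ser n in
    f ≈ vandermonde n * g → divVandermonde n f ≈ g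
  divVandermonde-unique n g f≈ = go (pairs n) (pairs-bounds n) g f≈
    where
    open Ser n
    open BigOperators (Series R n) using (∏)
    go : ∀ ps → All (λ (k , l) → 1 ≤ k × k < l × l ≤ n) ps → ∀ g {f} →
      f ≈ ∏ (map (λ (k , l) → var n k - var n l) ps) * g →
      foldr (λ (k , l) → divDiff n k l) f ps ≈ g
    go []             _                          g e = trans e (*-identityˡ g)
    go ((k , l) ∷ ps) ((1≤k , k<l , l≤n) All.∷ bs) g e = trans
      (divDiff-cong n k l (go ps bs ((var n k - var n l) * g)
        (trans e (trans (*-congʳ (*-comm _ _)) (*-assoc _ _ _)))))
      (divDiff-unique n g 1≤k k<l l≤n)

------------------------------------------------------------------------

record Partition : Set where
  field
    parts      : List ℕ
    decreasing : Linked _≥_ parts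
    positive   : All (1 ≤_) parts

open Partition public

∅ : Partition
∅ = record { parts = [] ; decreasing = [] ; positive = All.[] }

-- The k-th element, counting from 1, with a default value.
nth : ∀ {A : Set} → A → List A → ℕ → A
nth d _        zero          = d
nth d []       (suc _)       = d
nth d (x ∷ _)  (suc zero)    = x
nth d (_ ∷ xs) (suc (suc k)) = nth d xs (suc k)

part : Partition → ℕ → ℕ
part μ = nth 0 (parts μ)

len : Partition → ℕ
len μ = length (parts μ)

infix 4 _⊆_

_⊆_ : Partition → Partition → Set
μ ⊆ ν = ∀ k → part μ k ≤ part ν k

-- The number of boxes on the main diagonal.
diagonal : Partition → ℕ
diagonal μ = length (filter (λ k → k ≤? part μ k) (oneTo (len μ)))

------------------------------------------------------------------------
-- Reverse tableaux of shape ν/μ, where μ ⊆ ν. Boxes are (row, column).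

Box : Set
Box = ℕ × ℕ

InShape : Partition → Partition → Box → Set
InShape ν μ (k , l) = part μ k < l × l ≤ part ν k

boxes : Partition → Partition → List Box
boxes ν μ =
  concatMap (λ k → map (λ l → k , part μ k + l) (oneTo (part ν k ∸ part μ k))) (oneTo (len ν))

content : Box → ℤ
content (k , l) = + l ℤ.- + k

-- A filling of ν/μ lists, for k = 1,…,ℓ(ν), the entries of row k in the
-- columns μ_k + 1,…,ν_k.
Filling : Set
Filling = List (List ℕ)

entry : Partition → Filling → Box → ℕ
entry μ T (k , l) = nth 0 (nth [] T k) (l ∸ part μ k)

IsReverse : Partition → Partition → Filling → Set
IsReverse ν μ T = All (λ (k , l) →
  (InShape ν μ (k , suc l) → entry μ T (k , suc l) ≤ entry μ T (k , l)) ×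
  (InShape ν μ (suc k , l) → entry μ T (suc k , l) < entry μ T (k , l))) (boxes ν μ)

isReverse? : ∀ ν μ T → Dec (IsReverse ν μ T)
isReverse? ν μ T = All.all? (λ (k , l) →
  (inShape? (k , suc l) →-dec (entry μ T (k , suc l) ≤? entry μ T (k , l))) ×-dec
  (inShape? (suc k , l) →-dec (entry μ T (suc k , l) <? entry μ T (k , l)))) (boxes ν μ)
  where
  inShape? : ∀ α → Dec (InShape ν μ α)
  inShape? (k , l) = (part μ k <? l) ×-dec (l ≤? part ν k)

choices : ∀ {A : Set} → List (List A) → List (List A)
choices []         = [] ∷ []
choices (xs ∷ xss) = cartesianProductWith _∷_ xs (choices xss)

fillings : ℕ → Partition → Partition → List Filling
fillings n ν μ =
  choices (map (λ k → choices (replicate (part ν k ∸ part μ k) (oneTo n))) (oneTo (len ν)))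

-- The reverse ν/μ-tableaux with entries in {1,…,n}.
reverseTableaux : ℕ → Partition → Partition → List Filling
reverseTableaux n ν μ = filter (isReverse? ν μ) (fillings n ν μ)

------------------------------------------------------------------------
-- Everything is defined over any commutative ring R with a sequence a, so
-- that it applies both over ℚ[a] and over ℚ[a][[x₁,…,xₙ]].
-- A polynomial in x₁,…,xₙ is regarded as an element of R[[x₁,…,xₙ]]. A
-- series in infinitely many variables is given by the sequence of its
-- images in R[[x₁,…,xₙ]] under setting x_k = 0 for k > n.

module Schur (R : CommutativeRing c ℓ) (a : ℤ → CommutativeRing.Carrier R) where

  open Variables R public
  private module Exp n = Exponentiation (Ser.semiring n)

  -- (x_k‖a)^r in n variables
  shiftedPower : ∀ n → ℕ → ℕ → Ser.Carrier n
  shiftedPower n k r = ∏[ r ] λ p → var n k - const n (a (+ suc n ℤ.- + p))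
    where
    open CommutativeRing (Series R n) using (_-_)
    open BigOperators (Series R n)

  -- det [M_kl] / ∏_{k<l} (x_k - x_l), where 1 ≤ k, l ≤ n
  detRatio : ∀ n → (ℕ → ℕ → Ser.Carrier n) → Ser.Carrier n
  detRatio n M = divVandermonde n (det n λ k l → M (suc (toℕ k)) (suc (toℕ l)))
    where open Determinant (Series R n)

  doubleSchur : ∀ n → Partition → Ser.Carrier n
  doubleSchur n μ =
    ifDec (len μ ≤? n)
    then detRatio n (λ k l → shiftedPower n k (part μ l + (n ∸ l)))
    else Ser.0# n

  dualSchur : ∀ n → Partition → Ser.Carrier n
  dualSchur n μ = ifDec (len μ ≤? n) then detRatio n A else Ser.0# n
    where
    open CommutativeRing (Series R n) using (_*_)
    open BigOperators (Series R n)
    open Exp n using (_^_)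
    A : ℕ → ℕ → Ser.Carrier n
    A k l = var n k ^ (part μ l + (n ∸ l)) *
      (ifDec (l ≤? diagonal μ)
       then ∏[ suc (part μ l) ∸ l ] (λ p → geometric n (a (ℤ.1ℤ ℤ.- + p)) k)
       else ∏[ l ∸ part μ l ∸ 1 ] (λ p → oneMinus n (a (+ p)) k))

  -- X_k(g,h) in n variables; it vanishes for k > n.
  X : ∀ n → ℕ → CommutativeRing.Carrier R → CommutativeRing.Carrier R → Ser.Carrier n
  X n k g h = var n k * (∏[ k ∸ 1 ] λ p → oneMinus n g p) * (∏[ k ] λ p → geometric n h p)
    where
    open CommutativeRing (Series R n) using (_*_)
    open BigOperators (Series R n)

  weight : ∀ n → Partition → Partition → Filling → Ser.Carrier n
  weight n ν μ T =
    ∏ (map (λ α → X n (entry μ T α) (a (ℤ.- content α ℤ.+ ℤ.1ℤ)) (a (ℤ.- content α))) (boxes ν μ))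
    where open BigOperators (Series R n)

  -- In n variables the reverse tableaux with an entry k > n contribute 0,
  -- since X_k is a multiple of x_k.
  skewDualSchur : ∀ n → Partition → Partition → Ser.Carrier n
  skewDualSchur n ν μ = ∑ (map (weight n ν μ) (reverseTableaux n ν μ))
    where open BigOperators (Series R n)

------------------------------------------------------------------------
-- The identities, over R[[x₁,…,xₙ]][[y₁,…,yₘ]]

module Cauchy (R : CommutativeRing c ℓ) (a : ℤ → CommutativeRing.Carrier R) (n m : ℕ) where

  module x = Schur R a
  module y = Schur (Series R n) (λ k → x.const n (a k))

  open CommutativeRing (Series (Series R n) m) public using (Carrier; _*_)
  open BigOperators (Series (Series R n) m)

  -- ∏_{i,j} (1 - a_{i-μᵢ} y_j) / (1 - x_i y_j); the factors with j > m
  -- become 1 when y_j = 0.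
  kernel : Partition → Carrier
  kernel μ = ∏[ n ] λ i → ∏[ m ] λ j →
    y.oneMinus m (x.const n (a (+ i ℤ.- + part μ i))) j * y.geometric m (x.var n i) j

{-# OPTIONS --safe #-}
-- The expansion of (1 - b y)/(1 - x y) (x‖a)^β in the shifted powers (x‖a)^γ,
-- where b is the next shift, has multiplicative coefficients. Subtracting
-- multiples of the previous row from each row of an alternant therefore
-- leaves only the terms with μ_k ≤ ρ_k ≤ μ_{k-1}: for a single variable y,
-- the kernel times an alternant is a sum over horizontal strips ρ/μ. When
-- the variables y are treated one at a time, the quotient of the kernels of
-- μ and ρ telescopes along the rows of ρ/μ to the remaining factors of X.
-- This is the recursion of the tableau sum that removes the largest
-- entries. Modulo the series of order greater than D in y all sums are
-- finite.
--
-- For the second identity, divided differences at x₁ reduce the alternant of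
-- a dual Schur function in x₁,…,xₙ to alternants in x₂,…,xₙ indexed by
-- interlacing partitions. This is the recursion of the tableau sum that
-- removes the smallest entries. The same reduction shows that the
-- alternants of double Schur functions are divisible by the Vandermonde
-- product.
module Submission where

open import Defs
open import Algebra.Bundles using (CommutativeRing)
import Algebra.Properties.CommutativeMonoid.Sum as FiniteSum
import Algebra.Properties.CommutativeSemigroup as CommutativeSemigroupProperties
import Algebra.Properties.Ring as RingProperties
import Algebra.Properties.Semiring.Exp as Exponentiation
import Algebra.Solver.Ring.NaturalCoefficients.Default as SemiringSolver
open import Data.Fin.Base as Fin using (Fin; toℕ; punchIn)
open import Data.Integer.Base as ℤ using (ℤ; +_; _⊖_)
import Data.Integer.Properties as ℤₚ
open import Data.List.Base using (List; []; _∷_; _++_; applyUpTo; concatMap; drop; filter; length; map; replicate; tabulate; take; upTo)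
open import Data.List.Membership.Propositional using (_∈_; _∉_)
open import Data.List.Membership.Propositional.Properties
  using (∈-cartesianProductWith⁺; ∈-concat⁺′; ∈-filter⁺; ∈-map⁺; ∈-map⁻; ∈-upTo⁺; ∈-upTo⁻)
import Data.List.Properties as Listₚ
open import Data.List.Relation.Binary.Pointwise as Pointwise using (Pointwise; []; _∷_)
open import Data.List.Relation.Unary.All as All using (All; []; _∷_)
import Data.List.Relation.Unary.All.Properties as AllProperties
open import Data.List.Relation.Unary.AllPairs using ([]; _∷_)
open import Data.List.Relation.Unary.Any using (here)
open import Data.List.Relation.Unary.Linked as Linked using (Linked; []; [-]; _∷_)
import Data.List.Relation.Unary.Linked.Properties as LinkedProperties
open import Data.List.Relation.Unary.Unique.Propositional using (Unique)
import Data.List.Relation.Unary.Unique.Propositional.Properties as UniqueProperties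
open import Data.Nat.Base as ℕ using (ℕ; zero; suc; _∸_; _≤_; _<_; _≥_; z≤n; s≤s; s≤s⁻¹)
import Data.Nat.Properties as ℕₚ
open import Data.Product.Base using (_×_; _,_; proj₁; proj₂; ∃)
open import Data.Sum.Base using (_⊎_; inj₁; inj₂)
open import Data.Unit.Base using (⊤; tt)
open import Data.Vec.Base as Vec using (Vec; []; _∷_)
open import Function.Base using (_∘_; id)
open import Level using (Level; Lift; lift; _⊔_)
import Relation.Binary.PropositionalEquality as ≡
open ≡ using (_≡_; _≢_)
import Relation.Binary.Reasoning.Setoid as SetoidReasoning
open import Relation.Nullary using (¬_; Dec; yes; no; contradiction)
open import Relation.Nullary.Decidable using (_×-dec_)
open import Relation.Unary using (Decidable)

-- The argument works with alternants, and the Vandermonde product is cancelled only at the end: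
-- exact division by it is a left inverse of multiplication, so it can be cancelled over every
-- commutative ring. The obstacle is the first row of an alternant, which has no previous row to
-- subtract. Its expansion in shifted powers never ends, and stopping at length N leaves a remainder
-- with N - μ₁ + 1 factors y. Hence the first identity is proved modulo an ideal, with a multiplier
-- z that records the order in y already supplied by earlier strips; N = μ₁ + D is enough for order
-- D. Shapes are zero-padded tuples of fixed length. Inequalities between rows become ring factors 0
-- or 1, so sums over strips, chains and tableaux are rearranged by distributivity alone. Weights
-- are indexed by a row k and a column l, with a_{k-l} in place of integer contents; shifting both
-- indices by n - k carries row k to the exponents in the alternant. The two identities read a chain
-- of strips from opposite ends, and each has its own gauge factor: one for all variables below the
-- largest, one for the smallest variable in the weights of the other entries.

private
  variable
    c ℓ c′ ℓ′ p q : Level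
    A B : Set p

-- Finite sums, products and 0/1 indicators in a commutative ring.

tuples : ℕ → ℕ → List (List ℕ)
tuples K n = choices (replicate n (upTo K))

choices-All : ∀ {P : List A → Set p} {Q : List A → Set q} (xs : List A) xss →
  (∀ {x r} → x ∈ xs → Q r → P (x ∷ r)) → All Q (choices xss) → All P (choices (xs ∷ xss))
choices-All {A = A} xs xss f qs =
  AllProperties.cartesianProductWith⁺ (≡.setoid A) (≡.setoid (List A)) _∷_ xs (choices xss)
    (λ x∈ r∈ → f x∈ (All.lookup qs r∈))

tuples-length : ∀ K n → All (λ r → length r ≡ n) (tuples K n)
tuples-length K zero    = ≡.refl ∷ []
tuples-length K (suc n) = choices-All (upTo K) (replicate n (upTo K)) (λ _ → ≡.cong suc) (tuples-length K n)

module ListSums (R : CommutativeRing c ℓ) where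

  open CommutativeRing R hiding (zero)
  open BigOperators R public
  open CommutativeSemigroupProperties +-commutativeSemigroup public
    using () renaming (interchange to +-interchange)
  open CommutativeSemigroupProperties *-commutativeSemigroup public
    using () renaming (interchange to *-interchange; x∙yz≈y∙xz to *-exchange; xy∙z≈xz∙y to *-exchangeʳ)
  open RingProperties ring public using (-0#≈0#; -‿distribˡ-*; -‿distribʳ-*; -‿involutive; -‿+-comm; x[y-z]≈xy-xz; -1*x≈-x)
  open SetoidReasoning setoid

  Σ[_] : List A → (A → Carrier) → Carrier
  Σ[ xs ] f = ∑ (map f xs)

  Π[_] : List A → (A → Carrier) → Carrier
  Π[ xs ] f = ∏ (map f xs)

  Σ-cong-All : ∀ {f g : A → Carrier} {xs} → All (λ x → f x ≈ g x) xs → Σ[ xs ] f ≈ Σ[ xs ] g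
  Σ-cong-All []       = refl
  Σ-cong-All (e ∷ es) = +-cong e (Σ-cong-All es)

  Σ-cong : ∀ {f g : A → Carrier} → (∀ x → f x ≈ g x) → ∀ xs → Σ[ xs ] f ≈ Σ[ xs ] g
  Σ-cong e []       = refl
  Σ-cong e (x ∷ xs) = +-cong (e x) (Σ-cong e xs)

  Σ-zero : ∀ (xs : List A) → Σ[ xs ] (λ _ → 0#) ≈ 0#
  Σ-zero []       = refl
  Σ-zero (x ∷ xs) = trans (+-identityˡ _) (Σ-zero xs)

  Σ-+ : ∀ (f g : A → Carrier) xs → Σ[ xs ] (λ x → f x + g x) ≈ Σ[ xs ] f + Σ[ xs ] g
  Σ-+ f g []       = sym (+-identityˡ _)
  Σ-+ f g (x ∷ xs) = trans (+-congˡ (Σ-+ f g xs)) (+-interchange _ _ _ _)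

  Σ-*ˡ : ∀ u (f : A → Carrier) xs → u * Σ[ xs ] f ≈ Σ[ xs ] (λ x → u * f x)
  Σ-*ˡ u f []       = zeroʳ u
  Σ-*ˡ u f (x ∷ xs) = trans (distribˡ _ _ _) (+-congˡ (Σ-*ˡ u f xs))

  Σ-*ʳ : ∀ u (f : A → Carrier) xs → Σ[ xs ] f * u ≈ Σ[ xs ] (λ x → f x * u)
  Σ-*ʳ u f []       = zeroˡ u
  Σ-*ʳ u f (x ∷ xs) = trans (distribʳ _ _ _) (+-congˡ (Σ-*ʳ u f xs))

  Σ-* : ∀ (f : A → Carrier) xs (g : B → Carrier) ys →
        Σ[ xs ] f * Σ[ ys ] g ≈ Σ[ xs ] (λ x → Σ[ ys ] (λ y → f x * g y))
  Σ-* f xs g ys = trans (Σ-*ʳ _ f xs) (Σ-cong (λ x → Σ-*ˡ (f x) g ys) xs)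

  Σ-++ : ∀ (f : A → Carrier) xs ys → Σ[ xs ++ ys ] f ≈ Σ[ xs ] f + Σ[ ys ] f
  Σ-++ f []       ys = sym (+-identityˡ _)
  Σ-++ f (x ∷ xs) ys = trans (+-congˡ (Σ-++ f xs ys)) (sym (+-assoc _ _ _))

  Σ-map : ∀ (f : B → Carrier) (g : A → B) xs → Σ[ map g xs ] f ≈ Σ[ xs ] (f ∘ g)
  Σ-map f g []       = refl
  Σ-map f g (x ∷ xs) = +-congˡ (Σ-map f g xs)

  Σ-swap : ∀ (f : A → B → Carrier) xs ys →
           Σ[ xs ] (λ x → Σ[ ys ] (f x)) ≈ Σ[ ys ] (λ y → Σ[ xs ] (λ x → f x y))
  Σ-swap f []       ys = sym (Σ-zero ys)
  Σ-swap f (x ∷ xs) ys = trans (+-congˡ (Σ-swap f xs ys)) (sym (Σ-+ (f x) _ ys))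

  Σ-choices : ∀ (f : List A → Carrier) xs xss →
              Σ[ choices (xs ∷ xss) ] f ≈ Σ[ xs ] (λ x → Σ[ choices xss ] (λ r → f (x ∷ r)))
  Σ-choices f []       xss = refl
  Σ-choices f (x ∷ xs) xss =
    trans (Σ-++ f (map (x ∷_) (choices xss)) _)
      (+-cong (Σ-map f (x ∷_) (choices xss)) (Σ-choices f xs xss))

  Σ-tuples-suc : ∀ K n (f : List ℕ → Carrier) →
    Σ[ tuples K (suc n) ] f ≈ Σ[ upTo K ] (λ k → Σ[ tuples K n ] (λ r → f (k ∷ r)))
  Σ-tuples-suc K n f = Σ-choices f (upTo K) (replicate n (upTo K))

  Σ-tuples-zero : ∀ K (f : List ℕ → Carrier) → Σ[ tuples K 0 ] f ≈ f []
  Σ-tuples-zero K f = +-identityʳ _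

  Σ-applyUpTo : ∀ (f : A → Carrier) (g : ℕ → A) n → Σ[ applyUpTo g n ] f ≈ Σ[ upTo n ] (f ∘ g)
  Σ-applyUpTo f g n = go g id n
    where
    go : ∀ (g : ℕ → _) (i : ℕ → ℕ) n → Σ[ applyUpTo (g ∘ i) n ] f ≈ Σ[ applyUpTo i n ] (f ∘ g)
    go g i zero    = refl
    go g i (suc n) = +-congˡ (go g (i ∘ suc) n)

  Σ-upTo-suc : ∀ n (f : ℕ → Carrier) → Σ[ upTo (suc n) ] f ≈ f 0 + Σ[ upTo n ] (f ∘ suc)
  Σ-upTo-suc n f = +-congˡ (Σ-applyUpTo f suc n)

  Σ-upTo-last : ∀ n (f : ℕ → Carrier) → Σ[ upTo (suc n) ] f ≈ Σ[ upTo n ] f + f n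
  Σ-upTo-last zero    f = trans (+-identityʳ _) (sym (+-identityˡ _))
  Σ-upTo-last (suc n) f = begin
    Σ[ upTo (suc (suc n)) ] f                ≈⟨ Σ-upTo-suc (suc n) f ⟩
    f 0 + Σ[ upTo (suc n) ] (f ∘ suc)        ≈⟨ +-congˡ (Σ-upTo-last n (f ∘ suc)) ⟩
    f 0 + (Σ[ upTo n ] (f ∘ suc) + f (suc n)) ≈⟨ +-assoc _ _ _ ⟨
    f 0 + Σ[ upTo n ] (f ∘ suc) + f (suc n)  ≈⟨ +-congʳ (Σ-upTo-suc n f) ⟨
    Σ[ upTo (suc n) ] f + f (suc n)          ∎

  Π-cong : ∀ {f g : A → Carrier} → (∀ x → f x ≈ g x) → ∀ xs → Π[ xs ] f ≈ Π[ xs ] g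
  Π-cong e []       = refl
  Π-cong e (x ∷ xs) = *-cong (e x) (Π-cong e xs)

  Π-++ : ∀ (f : A → Carrier) xs ys → Π[ xs ++ ys ] f ≈ Π[ xs ] f * Π[ ys ] f
  Π-++ f []       ys = sym (*-identityˡ _)
  Π-++ f (x ∷ xs) ys = trans (*-congˡ (Π-++ f xs ys)) (sym (*-assoc _ _ _))

  Π-map : ∀ (f : B → Carrier) (g : A → B) xs → Π[ map g xs ] f ≈ Π[ xs ] (f ∘ g)
  Π-map f g []       = refl
  Π-map f g (x ∷ xs) = *-congˡ (Π-map f g xs)

  ∏-cong : ∀ {f g : ℕ → Carrier} → (∀ k → f k ≈ g k) → ∀ n → ∏[ n ] f ≈ ∏[ n ] g
  ∏-cong e zero    = refl
  ∏-cong e (suc n) = *-cong (∏-cong e n) (e (suc n))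

  ∏-* : ∀ (f g : ℕ → Carrier) n → ∏[ n ] (λ k → f k * g k) ≈ ∏[ n ] f * ∏[ n ] g
  ∏-* f g zero    = sym (*-identityˡ _)
  ∏-* f g (suc n) = trans (*-congʳ (∏-* f g n)) (*-interchange _ _ _ _)

  ∏-one : ∀ n → ∏[ n ] (λ _ → 1#) ≈ 1#
  ∏-one zero    = refl
  ∏-one (suc n) = trans (*-identityʳ _) (∏-one n)

  ∏-swap : ∀ (f : ℕ → ℕ → Carrier) m n →
           ∏[ m ] (λ i → ∏[ n ] (f i)) ≈ ∏[ n ] (λ j → ∏[ m ] (λ i → f i j))
  ∏-swap f zero    n = sym (∏-one n)
  ∏-swap f (suc m) n = trans (*-congʳ (∏-swap f m n)) (sym (∏-* _ _ n))

  ∏-first : ∀ (f : ℕ → Carrier) n → ∏[ suc n ] f ≈ f 1 * ∏[ n ] (f ∘ suc)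
  ∏-first f zero    = *-comm _ _
  ∏-first f (suc n) = trans (*-congʳ (∏-first f n)) (*-assoc _ _ _)

  -- Defined by recursion instead of by a decision, so that it reduces when successors are stripped
  -- from both sides, as the induction in `Σ-interval` needs.
  ⟦_≤_⟧ : ℕ → ℕ → Carrier
  ⟦ zero  ≤ _     ⟧ = 1#
  ⟦ suc _ ≤ zero  ⟧ = 0#
  ⟦ suc m ≤ suc n ⟧ = ⟦ m ≤ n ⟧

  ⟦≤⟧-one : ∀ {m n} → m ≤ n → ⟦ m ≤ n ⟧ ≈ 1#
  ⟦≤⟧-one z≤n     = refl
  ⟦≤⟧-one (s≤s l) = ⟦≤⟧-one l

  ⟦≤⟧-zero : ∀ {m n} → n < m → ⟦ m ≤ n ⟧ ≈ 0#
  ⟦≤⟧-zero {suc m} {zero}  _       = refl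
  ⟦≤⟧-zero {suc m} {suc n} (s≤s l) = ⟦≤⟧-zero l

  ⟦≤⟧-split : ∀ m n → (m ≤ n × ⟦ m ≤ n ⟧ ≈ 1#) ⊎ (n < m × ⟦ m ≤ n ⟧ ≈ 0#)
  ⟦≤⟧-split m n with m ℕₚ.≤? n
  ... | yes l = inj₁ (l , ⟦≤⟧-one l)
  ... | no l  = inj₂ (ℕₚ.≰⇒> l , ⟦≤⟧-zero (ℕₚ.≰⇒> l))

  zero-* : ∀ {u} v → u ≈ 0# → u * v ≈ 0#
  zero-* v e = trans (*-congʳ e) (zeroˡ v)

  *-zero : ∀ u {v} → v ≈ 0# → u * v ≈ 0#
  *-zero u e = trans (*-congˡ e) (zeroʳ u)

  one-* : ∀ {u} v → u ≈ 1# → u * v ≈ v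
  one-* v e = trans (*-congʳ e) (*-identityˡ v)

  -- Σ_{p ≤ k ≤ q} as a sum over k < K, for q < K.
  Σ-interval : ∀ {p q} K (f : ℕ → Carrier) → q < K →
    Σ[ upTo K ] (λ k → (⟦ p ≤ k ⟧ * ⟦ k ≤ q ⟧) * f k) ≈
    ⟦ p ≤ q ⟧ * Σ[ upTo (suc (q ∸ p)) ] (λ d → f (p ℕ.+ d))
  Σ-interval {zero} {zero} (suc K) f _ = begin
    Σ[ upTo (suc K) ] (λ k → (1# * ⟦ k ≤ 0 ⟧) * f k)
      ≈⟨ Σ-upTo-suc K _ ⟩
    (1# * 1#) * f 0 + Σ[ upTo K ] (λ k → (1# * 0#) * f (suc k))
      ≈⟨ +-cong (*-congʳ (*-identityˡ _))
           (trans (Σ-cong (λ k → zero-* _ (zeroʳ _)) (upTo K)) (Σ-zero (upTo K))) ⟩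
    1# * f 0 + 0#   ≈⟨ trans (+-identityʳ _) (*-congˡ (sym (+-identityʳ _))) ⟩
    1# * (f 0 + 0#) ∎
  Σ-interval {zero} {suc q} (suc K) f (s≤s l) = begin
    Σ[ upTo (suc K) ] (λ k → (1# * ⟦ k ≤ suc q ⟧) * f k)
      ≈⟨ Σ-upTo-suc K _ ⟩
    (1# * 1#) * f 0 + Σ[ upTo K ] (λ k → (1# * ⟦ k ≤ q ⟧) * f (suc k))
      ≈⟨ +-cong (trans (*-congʳ (*-identityˡ _)) (*-identityˡ _))
           (trans (Σ-interval {zero} {q} K (f ∘ suc) l) (*-identityˡ _)) ⟩
    f 0 + Σ[ upTo (suc q) ] (f ∘ suc)  ≈⟨ Σ-upTo-suc (suc q) f ⟨
    Σ[ upTo (suc (suc q)) ] f          ≈⟨ *-identityˡ _ ⟨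
    1# * Σ[ upTo (suc (suc q)) ] f     ∎
  Σ-interval {suc p} {zero} (suc K) f _ = trans
    (trans (Σ-upTo-suc K _) (+-cong (zero-* _ (zeroˡ _))
      (trans (Σ-cong (λ k → zero-* _ (zeroʳ _)) (upTo K)) (Σ-zero (upTo K)))))
    (trans (+-identityʳ _) (sym (zeroˡ _)))
  Σ-interval {suc p} {suc q} (suc K) f (s≤s l) = trans (Σ-upTo-suc K _)
    (trans (+-congʳ (zero-* _ (zeroˡ _)))
      (trans (+-identityˡ _) (Σ-interval {p} {q} K (f ∘ suc) l)))

  -- In strip weights, `p` is the first column of a horizontal segment of a row and `d` its number
  -- of boxes.
  run : (ℕ → Carrier) → ℕ → ℕ → Carrier
  run g p zero    = 1#
  run g p (suc d) = g p * run g (suc p) d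

  run-cong : ∀ {g g′} → (∀ k → g k ≈ g′ k) → ∀ p d → run g p d ≈ run g′ p d
  run-cong e p zero    = refl
  run-cong e p (suc d) = *-cong (e p) (run-cong e (suc p) d)

  run-shift : ∀ {g g′} t → (∀ k → g k ≈ g′ (k ℕ.+ t)) → ∀ p d → run g p d ≈ run g′ (p ℕ.+ t) d
  run-shift t e p zero    = refl
  run-shift t e p (suc d) = *-cong (e p) (run-shift t e (suc p) d)

  run-+ : ∀ g p d e → run g p (d ℕ.+ e) ≈ run g p d * run g (p ℕ.+ d) e
  run-+ g p zero    e rewrite ℕₚ.+-identityʳ p = sym (*-identityˡ _)
  run-+ g p (suc d) e rewrite ℕₚ.+-suc p d =
    trans (*-congˡ (run-+ g (suc p) d e)) (sym (*-assoc _ _ _))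

  run-last : ∀ g p d → run g p (suc d) ≈ run g p d * g (p ℕ.+ d)
  run-last g p zero    rewrite ℕₚ.+-identityʳ p = *-comm _ _
  run-last g p (suc d) rewrite ℕₚ.+-suc p d =
    trans (*-congˡ (run-last g (suc p) d)) (sym (*-assoc _ _ _))

  run-* : ∀ f g p d → run (λ k → f k * g k) p d ≈ run f p d * run g p d
  run-* f g p zero    = sym (*-identityˡ _)
  run-* f g p (suc d) = trans (*-congˡ (run-* f g (suc p) d)) (*-interchange _ _ _ _)

  δ : List ℕ → List ℕ → Carrier
  δ []       []       = 1#
  δ []       (_ ∷ _)  = 0#
  δ (_ ∷ _)  []       = 0#
  δ (m ∷ ms) (n ∷ ns) = (⟦ m ≤ n ⟧ * ⟦ n ≤ m ⟧) * δ ms ns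

  Σ-point : ∀ {m} K (f : ℕ → Carrier) → m < K →
    Σ[ upTo K ] (λ k → (⟦ m ≤ k ⟧ * ⟦ k ≤ m ⟧) * f k) ≈ f m
  Σ-point {m} K f l = begin
    Σ[ upTo K ] (λ k → (⟦ m ≤ k ⟧ * ⟦ k ≤ m ⟧) * f k)
      ≈⟨ Σ-interval K f l ⟩
    ⟦ m ≤ m ⟧ * Σ[ upTo (suc (m ∸ m)) ] (λ d → f (m ℕ.+ d))
      ≈⟨ one-* _ (⟦≤⟧-one {m} ℕₚ.≤-refl) ⟩
    Σ[ upTo (suc (m ∸ m)) ] (λ d → f (m ℕ.+ d))
      ≡⟨ ≡.cong (λ d → Σ[ upTo (suc d) ] (λ d → f (m ℕ.+ d))) (ℕₚ.n∸n≡0 m) ⟩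
    f (m ℕ.+ 0) + 0#  ≈⟨ +-identityʳ _ ⟩
    f (m ℕ.+ 0)       ≡⟨ ≡.cong f (ℕₚ.+-identityʳ m) ⟩
    f m               ∎

  δ-sym : ∀ ms ns → δ ms ns ≈ δ ns ms
  δ-sym []       []       = refl
  δ-sym []       (_ ∷ _)  = refl
  δ-sym (_ ∷ _)  []       = refl
  δ-sym (m ∷ ms) (n ∷ ns) = *-cong (*-comm _ _) (δ-sym ms ns)

  Σ-δ : ∀ {K n ms} (f : List ℕ → Carrier) → All (_< K) ms → length ms ≡ n →
        Σ[ tuples K n ] (λ r → δ ms r * f r) ≈ f ms
  Σ-δ {K} {n} {[]} f [] ≡.refl = trans (Σ-tuples-zero K (λ r → δ [] r * f r)) (*-identityˡ _)
  Σ-δ {K} {n} {m ∷ ms} f (l ∷ ls) ≡.refl = begin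
    Σ[ tuples K (suc (length ms)) ] (λ r → δ (m ∷ ms) r * f r)
      ≈⟨ Σ-tuples-suc K (length ms) _ ⟩
    Σ[ upTo K ] (λ k → Σ[ tuples K (length ms) ] (λ r → (⟦ m ≤ k ⟧ * ⟦ k ≤ m ⟧ * δ ms r) * f (k ∷ r)))
      ≈⟨ Σ-cong (λ k → trans (Σ-cong (λ r → *-assoc _ _ _) (tuples K (length ms)))
           (trans (sym (Σ-*ˡ _ _ (tuples K (length ms)))) (*-congˡ (Σ-δ (λ r → f (k ∷ r)) ls ≡.refl)))) (upTo K) ⟩
    Σ[ upTo K ] (λ k → (⟦ m ≤ k ⟧ * ⟦ k ≤ m ⟧) * f (k ∷ ms))
      ≈⟨ Σ-point K (λ k → f (k ∷ ms)) l ⟩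
    f (m ∷ ms) ∎

 

-- Determinants as alternating sums over lists of columns.

module Alternants (R : CommutativeRing c ℓ) where

  open CommutativeRing R hiding (zero)
  open ListSums R public
  open SetoidReasoning setoid

  neg-cong₂ : ∀ {u u′ v v′} → u ≈ u′ → v ≈ v′ → u - v ≈ u′ - v′
  neg-cong₂ e e′ = +-cong e (-‿cong e′)

  -- Σⱼ (-1)ʲ h(cⱼ, c₀ ⋯ ĉⱼ ⋯)
  pick : (A → List A → Carrier) → List A → Carrier
  pick h []       = 0#
  pick h (c ∷ cs) = h c cs - pick (λ c′ r → h c′ (c ∷ r)) cs

  pick-cong : ∀ {h h′ : A → List A → Carrier} → (∀ c r → h c r ≈ h′ c r) →
              ∀ cs → pick h cs ≈ pick h′ cs
  pick-cong e []       = refl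
  pick-cong e (c ∷ cs) = neg-cong₂ (e c cs) (pick-cong (λ c′ r → e c′ (c ∷ r)) cs)

  pick-zero : ∀ (cs : List A) → pick (λ _ _ → 0#) cs ≈ 0#
  pick-zero []       = refl
  pick-zero (c ∷ cs) = trans (neg-cong₂ refl (pick-zero cs)) (-‿inverseʳ 0#)

  pick-+ : ∀ (g h : A → List A → Carrier) cs →
           pick (λ c r → g c r + h c r) cs ≈ pick g cs + pick h cs
  pick-+ g h []       = sym (+-identityˡ 0#)
  pick-+ g h (c ∷ cs) = begin
    g c cs + h c cs - pick (λ c′ r → g c′ (c ∷ r) + h c′ (c ∷ r)) cs
      ≈⟨ +-congˡ (trans (-‿cong (pick-+ _ _ cs)) (sym (-‿+-comm _ _))) ⟩
    g c cs + h c cs + (- pick (λ c′ r → g c′ (c ∷ r)) cs - pick (λ c′ r → h c′ (c ∷ r)) cs)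
      ≈⟨ +-interchange _ _ _ _ ⟩
    pick g (c ∷ cs) + pick h (c ∷ cs) ∎

  pick-*ˡ : ∀ u (h : A → List A → Carrier) cs → pick (λ c r → u * h c r) cs ≈ u * pick h cs
  pick-*ˡ u h []       = sym (zeroʳ u)
  pick-*ˡ u h (c ∷ cs) = trans (neg-cong₂ refl (pick-*ˡ u _ cs)) (sym (x[y-z]≈xy-xz _ _ _))

  pick-neg : ∀ (h : A → List A → Carrier) cs → pick (λ c r → - h c r) cs ≈ - pick h cs
  pick-neg h []       = sym -0#≈0#
  pick-neg h (c ∷ cs) = trans (+-congˡ (-‿cong (pick-neg _ cs))) (-‿+-comm _ _)

  pick-- : ∀ (g h : A → List A → Carrier) cs →
           pick (λ c r → g c r - h c r) cs ≈ pick g cs - pick h cs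
  pick-- g h cs = trans (pick-+ g (λ c r → - h c r) cs) (+-congˡ (pick-neg h cs))

  pick-Σ : ∀ (h : B → A → List A → Carrier) xs cs →
           pick (λ c r → Σ[ xs ] (λ x → h x c r)) cs ≈ Σ[ xs ] (λ x → pick (h x) cs)
  pick-Σ h []       cs = pick-zero cs
  pick-Σ h (x ∷ xs) cs = trans (pick-+ (h x) _ cs) (+-congˡ (pick-Σ h xs cs))

  pick-swap : ∀ (h : A → List A → B → List B → Carrier) as bs →
              pick (λ a r → pick (h a r) bs) as ≈ pick (λ b s → pick (λ a r → h a r b s) as) bs
  pick-swap h []       bs = sym (pick-zero bs)
  pick-swap h (a ∷ as) bs =
    trans (+-congˡ (-‿cong (pick-swap _ as bs))) (sym (pick-- (h a as) _ bs))

  -- The terms in which (c, c′) and (c′, c) are removed have opposite signs;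
  -- pairing them gives zero also in characteristic 2.
  pick²-sym : ∀ (g : A → A → List A → Carrier) → (∀ c c′ r → g c c′ r ≈ g c′ c r) →
              ∀ cs → pick (λ c → pick (g c)) cs ≈ 0#
  pick²-sym g e []       = refl
  pick²-sym g e (c ∷ cs) = begin
    pick (g c) cs - pick (λ c′ r → g c′ c r - pick (λ c″ s → g c′ c″ (c ∷ s)) r) cs
      ≈⟨ +-congˡ (-‿cong (pick-- _ _ cs)) ⟩
    pick (g c) cs - (pick (λ c′ → g c′ c) cs - pick (λ c′ → pick (λ c″ s → g c′ c″ (c ∷ s))) cs)
      ≈⟨ neg-cong₂ (pick-cong (λ c′ r → e c c′ r) cs)
           (trans (+-congˡ (trans (-‿cong (pick²-sym _ (λ x y r → e x y (c ∷ r)) cs)) -0#≈0#))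
                  (+-identityʳ _)) ⟩
    pick (λ c′ → g c′ c) cs - pick (λ c′ → g c′ c) cs
      ≈⟨ -‿inverseʳ _ ⟩
    0# ∎

  -- The determinant [f c] with rows f and columns c.
  E : List (A → Carrier) → List A → Carrier
  E []       []      = 1#
  E []       (_ ∷ _) = 0#
  E (f ∷ fs) cs      = pick (λ c r → f c * E fs r) cs

  infix 4 _≗_
  data _≗_ {A : Set p} : List (A → Carrier) → List (A → Carrier) → Set (p ⊔ c ⊔ ℓ) where
    []  : [] ≗ []
    _∷_ : ∀ {f g fs gs} → (∀ a → f a ≈ g a) → fs ≗ gs → (f ∷ fs) ≗ (g ∷ gs)

  E-cong : ∀ {fs gs : List (A → Carrier)} → fs ≗ gs → ∀ cs → E fs cs ≈ E gs cs
  E-cong []       []      = refl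
  E-cong []       (_ ∷ _) = refl
  E-cong (e ∷ es) cs      = pick-cong (λ c r → *-cong (e c) (E-cong es r)) cs

  E-head : ∀ f {fs gs : List (A → Carrier)} → (∀ cs → E fs cs ≈ E gs cs) → ∀ cs → E (f ∷ fs) cs ≈ E (f ∷ gs) cs
  E-head f e cs = pick-cong (λ c r → *-congˡ (e r)) cs

  -- If the top row picks a column other than `c`, then `c` stays in front of the remaining columns,
  -- so the induction hypothesis applies to the minor; the two alternating sums are then exchanged.
  E-column : ∀ (fs : List (A → Carrier)) c cs → E fs (c ∷ cs) ≈ pick (λ f s → f c * E s cs) fs
  E-column []       c cs = refl
  E-column (f ∷ fs) c cs = +-congˡ (-‿cong (begin
    pick (λ c′ r → f c′ * E fs (c ∷ r)) cs
      ≈⟨ pick-cong (λ c′ r → trans (*-congˡ (E-column fs c r)) (sym (pick-*ˡ _ _ fs))) cs ⟩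
    pick (λ c′ r → pick (λ g s → f c′ * (g c * E s r)) fs) cs
      ≈⟨ pick-swap (λ c′ r g s → f c′ * (g c * E s r)) cs fs ⟩
    pick (λ g s → pick (λ c′ r → f c′ * (g c * E s r)) cs) fs
      ≈⟨ pick-cong (λ g s → trans (pick-cong (λ c′ r → *-exchange _ _ _) cs) (pick-*ˡ _ _ cs)) fs ⟩
    pick (λ g s → g c * E (f ∷ s) cs) fs ∎))

  -- Evaluation at a column is itself a function on the list of row functions, so the transposed
  -- determinant is again an `E`, and expansion along the first column becomes expansion along the
  -- first row.
  E-transpose : ∀ (fs : List (A → Carrier)) cs → E fs cs ≈ E (map (λ c f → f c) cs) fs
  E-transpose []       []       = refl
  E-transpose (f ∷ fs) []       = refl
  E-transpose fs       (c ∷ cs) =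
    trans (E-column fs c cs) (pick-cong (λ f s → *-congˡ (E-transpose s cs)) fs)

  pick-map : ∀ (h : B → List B → Carrier) (g : A → B) as →
             pick h (map g as) ≈ pick (λ a r → h (g a) (map g r)) as
  pick-map h g []       = refl
  pick-map h g (a ∷ as) = +-congˡ (-‿cong (pick-map _ g as))

  E-map : ∀ (fs : List (B → Carrier)) (g : A → B) as → E fs (map g as) ≈ E (map (_∘ g) fs) as
  E-map []       g []      = refl
  E-map []       g (_ ∷ _) = refl
  E-map (f ∷ fs) g as      =
    trans (pick-map _ g as) (pick-cong (λ a r → *-congˡ (E-map fs g r)) as)

  pick-scale : ∀ (s : A → Carrier) (h : A → List A → Carrier) cs →
    pick (λ c r → (s c * Π[ r ] s) * h c r) cs ≈ Π[ cs ] s * pick h cs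
  pick-scale s h []       = sym (zeroʳ _)
  pick-scale s h (c ∷ cs) = begin
    (s c * Π[ cs ] s) * h c cs - pick (λ c′ r → (s c′ * (s c * Π[ r ] s)) * h c′ (c ∷ r)) cs
      ≈⟨ +-congˡ (-‿cong (trans (pick-cong (λ c′ r → trans (*-congʳ (*-exchange _ _ _)) (*-assoc _ _ _)) cs)
           (trans (pick-*ˡ _ _ cs) (*-congˡ (pick-scale s _ cs))))) ⟩
    (s c * Π[ cs ] s) * h c cs - s c * (Π[ cs ] s * pick (λ c′ r → h c′ (c ∷ r)) cs)
      ≈⟨ +-congˡ (-‿cong (sym (*-assoc _ _ _))) ⟩
    (s c * Π[ cs ] s) * h c cs - (s c * Π[ cs ] s) * pick (λ c′ r → h c′ (c ∷ r)) cs
      ≈⟨ x[y-z]≈xy-xz _ _ _ ⟨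
    Π[ c ∷ cs ] s * pick h (c ∷ cs) ∎

  E-scaleColumns : ∀ (s : A → Carrier) fs cs →
    E (map (λ f a → s a * f a) fs) cs ≈ Π[ cs ] s * E fs cs
  E-scaleColumns s []       []      = sym (*-identityˡ _)
  E-scaleColumns s []       (_ ∷ _) = sym (zeroʳ _)
  E-scaleColumns s (f ∷ fs) cs      =
    trans (pick-cong (λ c r → trans (*-congˡ (E-scaleColumns s fs r)) (*-interchange _ _ _ _)) cs)
          (pick-scale s _ cs)

  -- Expanding along both copies gives a double alternating sum that is symmetric in the two chosen
  -- columns.
  E-equal : ∀ (f : A → Carrier) fs cs → E (f ∷ f ∷ fs) cs ≈ 0#
  E-equal f fs cs =
    trans (pick-cong (λ c r → sym (pick-*ˡ _ _ r)) cs)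
          (pick²-sym (λ c c′ r → f c * (f c′ * E fs r)) (λ _ _ _ → *-exchange _ _ _) cs)

  E-row-- : ∀ (f g : A → Carrier) u fs cs →
    E ((λ a → f a - u * g a) ∷ fs) cs ≈ E (f ∷ fs) cs - u * E (g ∷ fs) cs
  E-row-- f g u fs cs = begin
    pick (λ c r → (f c - u * g c) * E fs r) cs
      ≈⟨ pick-cong (λ c r → trans (distribʳ _ _ _)
           (+-congˡ (trans (sym (-‿distribˡ-* _ _)) (-‿cong (*-assoc _ _ _))))) cs ⟩
    pick (λ c r → f c * E fs r - u * (g c * E fs r)) cs
      ≈⟨ trans (pick-- _ _ cs) (+-congˡ (-‿cong (pick-*ˡ u _ cs))) ⟩
    E (f ∷ fs) cs - u * E (g ∷ fs) cs ∎

  minus-zero : ∀ u {v} → v ≈ 0# → u - v ≈ u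
  minus-zero u e = trans (+-congˡ (trans (-‿cong e) -0#≈0#)) (+-identityʳ u)

  E-subtractNext : ∀ (f g : A → Carrier) u fs cs →
    E ((λ a → f a - u * g a) ∷ g ∷ fs) cs ≈ E (f ∷ g ∷ fs) cs
  E-subtractNext f g u fs cs =
    trans (E-row-- f g u (g ∷ fs) cs) (minus-zero _ (*-zero u (E-equal g fs cs)))

  E-subtractPrevious : ∀ (f g : A → Carrier) u fs cs →
    E (g ∷ (λ a → f a - u * g a) ∷ fs) cs ≈ E (g ∷ f ∷ fs) cs
  E-subtractPrevious f g u fs cs = begin
    pick (λ c r → g c * E ((λ a → f a - u * g a) ∷ fs) r) cs
      ≈⟨ pick-cong (λ c r → trans (*-congˡ (E-row-- f g u fs r)) (trans (x[y-z]≈xy-xz _ _ _)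
           (+-congˡ (-‿cong (*-exchange _ _ _))))) cs ⟩
    pick (λ c r → g c * E (f ∷ fs) r - u * (g c * E (g ∷ fs) r)) cs
      ≈⟨ trans (pick-- _ _ cs) (+-congˡ (-‿cong (pick-*ˡ u _ cs))) ⟩
    E (g ∷ f ∷ fs) cs - u * E (g ∷ g ∷ fs) cs
      ≈⟨ minus-zero _ (*-zero u (E-equal g fs cs)) ⟩
    E (g ∷ f ∷ fs) cs ∎

  -- Only the last row meets the column `c`. Moving it to the top passes every other row once, and
  -- the resulting sign is distributed by negating each of those rows.
  E-++-last : ∀ {fs : List (A → Carrier)} (u : A → Carrier) c cs → All (λ f → f c ≈ 0#) fs →
    E (fs ++ u ∷ []) (c ∷ cs) ≈ u c * E (map (λ f a → - f a) fs) cs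
  E-++-last {fs = []} u c cs [] = begin
    u c * E [] cs - pick (λ c′ r → u c′ * 0#) cs
      ≈⟨ minus-zero _ (trans (pick-cong (λ _ _ → zeroʳ _) cs) (pick-zero cs)) ⟩
    u c * E [] cs ∎
  E-++-last {fs = f ∷ fs} u c cs (e ∷ es) = begin
    f c * E (fs ++ u ∷ []) cs - pick (λ c′ r → f c′ * E (fs ++ u ∷ []) (c ∷ r)) cs
      ≈⟨ trans (+-congʳ (zero-* _ e)) (+-identityˡ _) ⟩
    - pick (λ c′ r → f c′ * E (fs ++ u ∷ []) (c ∷ r)) cs
      ≈⟨ pick-neg _ cs ⟨
    pick (λ c′ r → - (f c′ * E (fs ++ u ∷ []) (c ∷ r))) cs
      ≈⟨ pick-cong (λ c′ r → trans (-‿distribˡ-* _ _)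
           (trans (*-congˡ (E-++-last u c r es)) (*-exchange _ _ _))) cs ⟩
    pick (λ c′ r → u c * (- f c′ * E (map (λ f a → - f a) fs) r)) cs
      ≈⟨ pick-*ˡ _ _ cs ⟩
    u c * E (map (λ f a → - f a) (f ∷ fs)) cs ∎

  -- For b(j) = a_{n-j} this is the shifted power (x‖a)^β in n variables.
  newton : (A → Carrier) → (ℕ → Carrier) → ℕ → A → Carrier
  newton x b zero    a = 1#
  newton x b (suc β) a = newton x b β a * (x a - b β)

  vandermondeOn : (A → Carrier) → List A → Carrier
  vandermondeOn x []       = 1#
  vandermondeOn x (c ∷ cs) = Π[ cs ] (λ c′ → x c - x c′) * vandermondeOn x cs

  vandermondeOn-snoc : ∀ (x : A → Carrier) cs z →
    vandermondeOn x (cs ++ z ∷ []) ≈ vandermondeOn x cs * Π[ cs ] (λ c → x c - x z)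
  vandermondeOn-snoc x []       z = refl
  vandermondeOn-snoc x (c ∷ cs) z = begin
    Π[ cs ++ z ∷ [] ] (λ c′ → x c - x c′) * vandermondeOn x (cs ++ z ∷ [])
      ≈⟨ *-cong (trans (Π-++ _ cs _) (*-congˡ (*-identityʳ _))) (vandermondeOn-snoc x cs z) ⟩
    (Π[ cs ] (λ c′ → x c - x c′) * (x c - x z)) * (vandermondeOn x cs * Π[ cs ] (λ c → x c - x z))
      ≈⟨ *-interchange _ _ _ _ ⟩
    vandermondeOn x (c ∷ cs) * Π[ c ∷ cs ] (λ c → x c - x z) ∎

  open Determinant R using (det)
  open FiniteSum +-commutativeMonoid using (sum; sum-cong-≋)
  open Exponentiation semiring using (_^_)

  pick-tabulate : ∀ {n} (h : A → List A → Carrier) (g : Fin (suc n) → A) →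
    pick h (tabulate g) ≈ sum (λ j → (- 1#) ^ toℕ j * h (g j) (tabulate (g ∘ punchIn j)))
  pick-tabulate {n = zero}  h g = +-cong (sym (*-identityˡ _)) -0#≈0#
  pick-tabulate {n = suc n} h g = +-cong (sym (*-identityˡ _)) (begin
    - pick (λ c r → h c (g Fin.zero ∷ r)) (tabulate (g ∘ Fin.suc))
      ≈⟨ pick-neg (λ c r → h c (g Fin.zero ∷ r)) (tabulate (g ∘ Fin.suc)) ⟨
    pick (λ c r → - h c (g Fin.zero ∷ r)) (tabulate (g ∘ Fin.suc))
      ≈⟨ pick-tabulate (λ c r → - h c (g Fin.zero ∷ r)) (g ∘ Fin.suc) ⟩
    sum (λ j → (- 1#) ^ toℕ j * - h (g (Fin.suc j)) (g Fin.zero ∷ tabulate (g ∘ Fin.suc ∘ punchIn j)))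
      ≈⟨ sum-cong-≋ {suc n} (λ j → sign ((- 1#) ^ toℕ j) (h (g (Fin.suc j)) (tabulate (g ∘ punchIn (Fin.suc j))))) ⟩
    sum (λ j → (- 1#) ^ suc (toℕ j) * h (g (Fin.suc j)) (tabulate (g ∘ punchIn (Fin.suc j)))) ∎)
    where
    sign : ∀ u v → u * - v ≈ (- 1# * u) * v
    sign u v = trans (sym (-‿distribʳ-* u v)) (trans (-‿distribˡ-* u v) (*-congʳ (sym (-1*x≈-x u))))

  det-E : ∀ n (F : Fin n → A → Carrier) (g : Fin n → A) →
    det n (λ k l → F k (g l)) ≈ E (tabulate F) (tabulate g)
  det-E zero    F g = refl
  det-E (suc n) F g = sym (begin
    pick (λ c r → F Fin.zero c * E (tabulate (F ∘ Fin.suc)) r) (tabulate g)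
      ≈⟨ pick-tabulate (λ c r → F Fin.zero c * E (tabulate (F ∘ Fin.suc)) r) g ⟩
    sum (λ j → (- 1#) ^ toℕ j * (F Fin.zero (g j) * E (tabulate (F ∘ Fin.suc)) (tabulate (g ∘ punchIn j))))
      ≈⟨ sum-cong-≋ {suc n} (λ j → *-congˡ {(- 1#) ^ toℕ j} (*-congˡ {F Fin.zero (g j)} (sym (det-E n (F ∘ Fin.suc) (g ∘ punchIn j))))) ⟩
    det (suc n) (λ k l → F k (g l)) ∎)

-- Partitions with at most n rows, padded by zeros to length n. The bound `b` plays the part of the
-- row above, so an induction over the rows passes each row on as the next bound.
data Shape : ℕ → ℕ → List ℕ → Set where
  []  : ∀ {b} → Shape b 0 []
  _∷_ : ∀ {b n l ls} → l ≤ b → Shape l n ls → Shape b (suc n) (l ∷ ls)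

Shape-weaken : ∀ {b b′ n ls} → b ≤ b′ → Shape b n ls → Shape b′ n ls
Shape-weaken b≤ []       = []
Shape-weaken b≤ (l ∷ ls) = ℕₚ.≤-trans l b≤ ∷ ls

Shape-All : ∀ {b K n ls} → b < K → Shape b n ls → All (_< K) ls
Shape-All b<K []       = []
Shape-All b<K (l ∷ ls) = ℕₚ.≤-<-trans l b<K ∷ Shape-All (ℕₚ.≤-<-trans l b<K) ls

Shape-length : ∀ {b n ls} → Shape b n ls → length ls ≡ n
Shape-length []       = ≡.refl
Shape-length (_ ∷ ls) = ≡.cong suc (Shape-length ls)

lastPart : List ℕ → ℕ
lastPart []            = 0
lastPart (l ∷ [])      = l
lastPart (_ ∷ l ∷ ls)  = lastPart (l ∷ ls)

-- Branching of alternants by divided differences.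

module Rows (R : CommutativeRing c ℓ) where

  open CommutativeRing R hiding (zero)
  open Alternants R public

  -- The functions g(lₖ + n - k), k = 1,…,n.
  rows : (ℕ → A → Carrier) → ℕ → List ℕ → List (A → Carrier)
  rows g zero    _        = []
  rows g (suc t) []       = []
  rows g (suc t) (l ∷ ls) = g (l ℕ.+ t) ∷ rows g t ls

-- The index n is the number of points. The shifted powers satisfy this with e = 1 and the same
-- functions at every level. For the functions `dual` the level drops because a factor 1/(1 - a x)
-- is absorbed.
DividedDifferences : ∀ (R : CommutativeRing c ℓ) {A : Set p} → let open CommutativeRing R in
  (A → Carrier) → (f q e : ℕ → ℕ → A → Carrier) → Set _
DividedDifferences R x f q e = ∀ n β z i →
  f (suc n) (suc β) i ≈ q n β z * f (suc n) β i + (x i - x z) * (e n β z * f n β i)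
  where open CommutativeRing R

-- Newton's divided differences: row k minus a multiple of row k+1 is
-- x - x(z) times a combination of the functions of the next lower level,
-- so an alternant in the points z, z₁, …, zₙ reduces to alternants in
-- z₁, …, zₙ.
module Branching (R : CommutativeRing c ℓ) {A : Set p} (x : A → CommutativeRing.Carrier R)
  (f q e : ℕ → ℕ → A → CommutativeRing.Carrier R) (f-step : DividedDifferences R x f q e)
  (K : ℕ) where

  open CommutativeRing R hiding (zero)
  open Rows R
  open SetoidReasoning setoid
  open SemiringSolver commutativeSemiring using (solve; _:+_; _:*_; _:=_)

  -- Row k in the expansion, for row lengths r of ρ and l of λ.
  term : ℕ → A → ℕ → ℕ → ℕ → Carrier
  term n z t l r = e n (r ℕ.+ t) z * run (λ s → q n s z) (suc (r ℕ.+ t)) (l ∸ r)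

  -- The indicators express interlacing: the shorter list `rs` has its k-th row between the rows k +
  -- 1 and k of `ls`, one layer of a Gelfand-Tsetlin pattern.
  coef : ℕ → A → ℕ → List ℕ → List ℕ → Carrier
  coef n z zero    _             _        = 1#
  coef n z (suc t) (l ∷ l′ ∷ ls) (r ∷ rs) =
    ((⟦ l′ ≤ r ⟧ * ⟦ r ≤ l ⟧) * term n z t l r) * coef n z t (l′ ∷ ls) rs
  coef n z (suc t) _             _        = 0#

  -- The quotient of the alternant by the Vandermonde product, built without division as a sum over
  -- Gelfand-Tsetlin patterns. Having it explicitly proves divisibility over any commutative ring.
  D : ℕ → (ℕ → A) → List ℕ → Carrier
  D zero    ι _  = 1#
  D (suc n) ι ls = f (suc n) (lastPart ls) (ι 0) *
    Σ[ tuples K n ] (λ rs → coef n (ι 0) n ls rs * D n (ι ∘ suc) rs)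

  private
    -- The relation `f-step` is iterated d times, and each application leaves one multiple of x(i) -
    -- x(z).
    difference : ∀ n z i b d → f (suc n) (b ℕ.+ d) i ≈
      run (λ s → q n s z) b d * f (suc n) b i +
      (x i - x z) * Σ[ upTo d ] (λ j → (e n (b ℕ.+ j) z * run (λ s → q n s z) (suc (b ℕ.+ j)) (d ∸ suc j)) * f n (b ℕ.+ j) i)
    difference n z i b zero rewrite ℕₚ.+-identityʳ b =
      sym (trans (+-cong (*-identityˡ _) (zeroʳ _)) (+-identityʳ _))
    difference n z i b (suc d) = begin
      f (suc n) (b ℕ.+ suc d) i
        ≡⟨ ≡.cong (λ s → f (suc n) s i) (ℕₚ.+-suc b d) ⟩
      f (suc n) (suc b ℕ.+ d) i
        ≈⟨ difference n z i (suc b) d ⟩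
      Q * f (suc n) (suc b) i + w * S
        ≈⟨ +-congʳ (*-congˡ (f-step n b z i)) ⟩
      Q * (q n b z * f (suc n) b i + w * (e n b z * f n b i)) + w * S
        ≈⟨ solve 7 (λ a b c d f g h → a :* (b :* c :+ d :* (f :* g)) :+ d :* h :=
                    (b :* a) :* c :+ d :* ((f :* a) :* g :+ h))
             refl Q (q n b z) (f (suc n) b i) w (e n b z) (f n b i) S ⟩
      (q n b z * Q) * f (suc n) b i + w * ((e n b z * Q) * f n b i + S)
        ≈⟨ +-congˡ (*-congˡ (begin
             (e n b z * Q) * f n b i + S
               ≈⟨ +-cong (reflexive (≡.cong g (≡.sym (ℕₚ.+-identityʳ b))))
                    (Σ-cong (λ j → reflexive (≡.cong (h j) (≡.sym (ℕₚ.+-suc b j)))) (upTo d)) ⟩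
             g (b ℕ.+ 0) + Σ[ upTo d ] (λ j → h j (b ℕ.+ suc j))
               ≈⟨ Σ-upTo-suc d (λ j → (e n (b ℕ.+ j) z * run (λ s → q n s z) (suc (b ℕ.+ j)) (suc d ∸ suc j)) * f n (b ℕ.+ j) i) ⟨
             Σ[ upTo (suc d) ] (λ j → (e n (b ℕ.+ j) z * run (λ s → q n s z) (suc (b ℕ.+ j)) (d ∸ j)) * f n (b ℕ.+ j) i) ∎)) ⟩
      _ ∎
      where
      w = x i - x z
      Q = run (λ s → q n s z) (suc b) d
      g : ℕ → Carrier
      g s = (e n s z * run (λ s → q n s z) (suc s) d) * f n s i
      h : ℕ → ℕ → Carrier
      h j s = (e n s z * run (λ s → q n s z) (suc s) (d ∸ suc j)) * f n s i
      S = Σ[ upTo d ] (λ j → h j (suc b ℕ.+ j))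

    sumRow : ℕ → A → ℕ → ℕ → ℕ → A → Carrier
    sumRow n z t l l′ i = Σ[ upTo K ] (λ r → (⟦ l′ ≤ r ⟧ * ⟦ r ≤ l ⟧) * (term n z t l r * f n (r ℕ.+ t) i))

    differenceRow : ℕ → A → ℕ → ℕ → ℕ → A → Carrier
    differenceRow n z t l l′ i =
      f (suc n) (l ℕ.+ suc t) i - run (λ s → q n s z) (l′ ℕ.+ t) (suc (l ∸ l′)) * f (suc n) (l′ ℕ.+ t) i

    -- The exponents l + t + 1 and l′ + t of consecutive rows differ by l - l′ + 1, so the steps of
    -- `difference` are indexed by the r with l′ ≤ r ≤ l. This is the origin of the interlacing
    -- condition.
    differenceRow-sum : ∀ n z t {l l′} → l′ ≤ l → l < K → ∀ i →
      differenceRow n z t l l′ i ≈ (x i - x z) * sumRow n z t l l′ i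
    differenceRow-sum n z t {l} {l′} l′≤l l<K i = begin
      f (suc n) (l ℕ.+ suc t) i - Q
        ≡⟨ ≡.cong (λ s → f (suc n) s i - Q) index ⟩
      f (suc n) (l′ ℕ.+ t ℕ.+ suc (l ∸ l′)) i - Q
        ≈⟨ +-congʳ (difference n z i (l′ ℕ.+ t) (suc (l ∸ l′))) ⟩
      (Q + (x i - x z) * S) - Q
        ≈⟨ trans (+-congʳ (+-comm _ _)) (trans (+-assoc _ _ _) (trans (+-congˡ (-‿inverseʳ Q)) (+-identityʳ _))) ⟩
      (x i - x z) * S
        ≈⟨ *-congˡ (begin
             S ≈⟨ Σ-cong (λ j → reflexive (≡.cong₂ (λ s d → (e n s z * run (λ s → q n s z) (suc s) d) * f n s i)
                    (shift j) (ℕₚ.∸-+-assoc l l′ j))) (upTo (suc (l ∸ l′))) ⟩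
             Σ[ upTo (suc (l ∸ l′)) ] (λ j → term n z t l (l′ ℕ.+ j) * f n (l′ ℕ.+ j ℕ.+ t) i)
               ≈⟨ one-* _ (⟦≤⟧-one l′≤l) ⟨
             ⟦ l′ ≤ l ⟧ * Σ[ upTo (suc (l ∸ l′)) ] (λ j → term n z t l (l′ ℕ.+ j) * f n (l′ ℕ.+ j ℕ.+ t) i)
               ≈⟨ Σ-interval K (λ r → term n z t l r * f n (r ℕ.+ t) i) l<K ⟨
             sumRow n z t l l′ i ∎) ⟩
      (x i - x z) * sumRow n z t l l′ i ∎
      where
      Q = run (λ s → q n s z) (l′ ℕ.+ t) (suc (l ∸ l′)) * f (suc n) (l′ ℕ.+ t) i
      S = Σ[ upTo (suc (l ∸ l′)) ] (λ j → (e n (l′ ℕ.+ t ℕ.+ j) z *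
            run (λ s → q n s z) (suc (l′ ℕ.+ t ℕ.+ j)) (l ∸ l′ ∸ j)) * f n (l′ ℕ.+ t ℕ.+ j) i)
      shift : ∀ j → l′ ℕ.+ t ℕ.+ j ≡ l′ ℕ.+ j ℕ.+ t
      shift j = ≡.trans (ℕₚ.+-assoc l′ t j) (≡.trans (≡.cong (l′ ℕ.+_) (ℕₚ.+-comm t j)) (≡.sym (ℕₚ.+-assoc l′ j t)))
      index : l ℕ.+ suc t ≡ l′ ℕ.+ t ℕ.+ suc (l ∸ l′)
      index = ≡.trans (≡.cong (ℕ._+ suc t) (≡.sym (ℕₚ.m+[n∸m]≡n l′≤l)))
        (≡.trans (ℕₚ.+-suc (l′ ℕ.+ (l ∸ l′)) t) (≡.trans (≡.cong suc (≡.sym (shift (l ∸ l′))))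
          (≡.sym (ℕₚ.+-suc (l′ ℕ.+ t) (l ∸ l′)))))

    differenceRows : ℕ → A → ℕ → List ℕ → List (A → Carrier)
    differenceRows n z (suc t) (l ∷ l′ ∷ ls) = differenceRow n z t l l′ ∷ differenceRows n z t (l′ ∷ ls)
    differenceRows n z _       _             = []

    sumRows : ℕ → A → ℕ → List ℕ → List (A → Carrier)
    sumRows n z (suc t) (l ∷ l′ ∷ ls) = sumRow n z t l l′ ∷ sumRows n z t (l′ ∷ ls)
    sumRows n z _       _             = []

    -- Rows are corrected from the top downwards, so the row that is subtracted is still in its
    -- original form.
    E-differenceRows : ∀ {b} n z t {ls} → Shape b (suc t) ls → ∀ cs →
      E (rows (f (suc n)) (suc t) ls) cs ≈ E (differenceRows n z t ls ++ f (suc n) (lastPart ls) ∷ []) cs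
    E-differenceRows n z zero {l ∷ []} (_ ∷ []) cs rewrite ℕₚ.+-identityʳ l = refl
    E-differenceRows n z (suc t) {l ∷ l′ ∷ ls} (_ ∷ ls↓) cs = begin
      E (f (suc n) (l ℕ.+ suc t) ∷ rows (f (suc n)) (suc t) (l′ ∷ ls)) cs
        ≈⟨ E-subtractNext _ _ _ (rows (f (suc n)) t ls) cs ⟨
      E (differenceRow n z t l l′ ∷ rows (f (suc n)) (suc t) (l′ ∷ ls)) cs
        ≈⟨ E-head (differenceRow n z t l l′) {rows (f (suc n)) (suc t) (l′ ∷ ls)}
             {differenceRows n z t (l′ ∷ ls) ++ f (suc n) (lastPart (l′ ∷ ls)) ∷ []} (E-differenceRows n z t ls↓) cs ⟩
      E (differenceRows n z (suc t) (l ∷ l′ ∷ ls) ++ f (suc n) (lastPart (l ∷ l′ ∷ ls)) ∷ []) cs ∎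

    -- The negations left by `E-++-last` turn x(i) - x(z) into x(z) - x(i), the orientation of the
    -- factors of `vandermondeOn`.
    negated-rows : ∀ {b} n z t {ls} → b < K → Shape b (suc t) ls →
      map (λ g i → - g i) (differenceRows n z t ls) ≗ map (λ g i → (x z - x i) * g i) (sumRows n z t ls)
    negated-rows n z zero    b<K _ = []
    negated-rows n z (suc t) {l ∷ l′ ∷ ls} b<K (l≤b ∷ ls↓@(l′≤l ∷ _)) =
      (λ i → trans (-‿cong (differenceRow-sum n z t l′≤l (ℕₚ.≤-<-trans l≤b b<K) i))
        (trans (-‿distribˡ-* _ _) (*-congʳ (trans (sym (-‿+-comm _ _))
          (trans (+-congˡ (-‿involutive _)) (+-comm _ _))))))
      ∷ negated-rows n z t (ℕₚ.≤-<-trans l≤b b<K) ls↓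

    differenceRows-vanish : ∀ {b} n z t {ls} → b < K → Shape b (suc t) ls →
      All (λ g → g z ≈ 0#) (differenceRows n z t ls)
    differenceRows-vanish n z zero    b<K _ = []
    differenceRows-vanish n z (suc t) {l ∷ l′ ∷ ls} b<K (l≤b ∷ ls↓@(l′≤l ∷ _)) =
      trans (differenceRow-sum n z t l′≤l (ℕₚ.≤-<-trans l≤b b<K) z) (zero-* _ (-‿inverseʳ _))
      ∷ differenceRows-vanish n z t (ℕₚ.≤-<-trans l≤b b<K) ls↓

    E-sumRows : ∀ {b} n z t {ls} → Shape b (suc t) ls → ∀ cs →
      E (sumRows n z t ls) cs ≈ Σ[ tuples K t ] (λ rs → coef n z t ls rs * E (rows (f n) t rs) cs)
    E-sumRows n z zero _ cs = sym (trans (Σ-tuples-zero K (λ rs → 1# * E [] cs)) (*-identityˡ _))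
    E-sumRows n z (suc t) {l ∷ l′ ∷ ls} (_ ∷ ls↓) cs = begin
      pick (λ c r → sumRow n z t l l′ c * E (sumRows n z t (l′ ∷ ls)) r) cs
        ≈⟨ pick-cong (λ c r → *-congˡ (E-sumRows n z t ls↓ r)) cs ⟩
      pick (λ c r → sumRow n z t l l′ c * Σ[ tuples K t ] (λ rs → coef n z t (l′ ∷ ls) rs * E (rows (f n) t rs) r)) cs
        ≈⟨ pick-cong (λ c r → Σ-* _ (upTo K) _ (tuples K t)) cs ⟩
      pick (λ c r → Σ[ upTo K ] (λ k → Σ[ tuples K t ] (λ rs → F k rs c r))) cs
        ≈⟨ trans (pick-Σ _ (upTo K) cs) (Σ-cong (λ k → trans (pick-Σ _ (tuples K t) cs)
             (Σ-cong (λ rs → trans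
               (pick-cong (λ c r → solve 5 (λ a b c d e → (a :* (b :* c)) :* (d :* e) := ((a :* b) :* d) :* (c :* e))
                  refl (⟦ l′ ≤ k ⟧ * ⟦ k ≤ l ⟧) (term n z t l k) (f n (k ℕ.+ t) c)
                       (coef n z t (l′ ∷ ls) rs) (E (rows (f n) t rs) r)) cs)
               (pick-*ˡ _ _ cs)) (tuples K t))) (upTo K)) ⟩
      Σ[ upTo K ] (λ k → Σ[ tuples K t ] (λ rs → coef n z (suc t) (l ∷ l′ ∷ ls) (k ∷ rs) * E (rows (f n) (suc t) (k ∷ rs)) cs))
        ≈⟨ Σ-tuples-suc K t (λ rs → coef n z (suc t) (l ∷ l′ ∷ ls) rs * E (rows (f n) (suc t) rs) cs) ⟨
      _ ∎
      where
      F : ℕ → List ℕ → A → List A → Carrier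
      F k rs c r = ((⟦ l′ ≤ k ⟧ * ⟦ k ≤ l ⟧) * (term n z t l k * f n (k ℕ.+ t) c)) *
                   (coef n z t (l′ ∷ ls) rs * E (rows (f n) t rs) r)

  coef-support : ∀ n z t {l ls} → Shape l t ls → ∀ rs → length rs ≡ t →
    coef n z t (l ∷ ls) rs ≈ 0# ⊎ Shape l t rs
  coef-support n z zero    _ []      _ = inj₂ []
  coef-support n z (suc t) {l} {l′ ∷ ls} (_ ∷ ls↓) (r ∷ rs) eq
    with ⟦≤⟧-split l′ r | ⟦≤⟧-split r l | coef-support n z t ls↓ rs (ℕₚ.suc-injective eq)
  ... | inj₂ (_ , z₁)   | _              | _        = inj₁ (zero-* _ (zero-* _ (zero-* _ z₁)))
  ... | inj₁ _          | inj₂ (_ , z₁)  | _        = inj₁ (zero-* _ (zero-* _ (*-zero _ z₁)))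
  ... | inj₁ _          | inj₁ _         | inj₁ z₁  = inj₁ (*-zero _ z₁)
  ... | inj₁ (l′≤r , _) | inj₁ (r≤l , _) | inj₂ rs↓ = inj₂ (r≤l ∷ Shape-weaken l′≤r rs↓)

  -- After the row differences the column of z = ι 0 vanishes above its last entry. Expansion along
  -- it leaves a determinant of size n whose columns carry the factors x(z) - x(i), which are the
  -- Vandermonde factors involving z.
  vandermonde-D : ∀ {b} n ι {ls} → b < K → Shape b n ls →
    vandermondeOn x (applyUpTo ι n) * D n ι ls ≈ E (rows (f n) n ls) (applyUpTo ι n)
  vandermonde-D zero    ι b<K [] = *-identityˡ _
  vandermonde-D {b} (suc n) ι {ls@(l ∷ _)} b<K ls↓@(l≤b ∷ ls↓′) = begin
    (P * V) * (f (suc n) (lastPart ls) z * Σ[ tuples K n ] (λ rs → coef n z n ls rs * D n (ι ∘ suc) rs))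
      ≈⟨ solve 4 (λ a b c d → (a :* b) :* (c :* d) := c :* (a :* (b :* d))) refl P V (f (suc n) (lastPart ls) z) _ ⟩
    f (suc n) (lastPart ls) z * (P * (V * Σ[ tuples K n ] (λ rs → coef n z n ls rs * D n (ι ∘ suc) rs)))
      ≈⟨ *-congˡ (*-congˡ (trans (Σ-*ˡ V _ (tuples K n)) (trans (Σ-cong-All (All.map step (tuples-length K n))) (sym (E-sumRows n z n ls↓ zs))))) ⟩
    f (suc n) (lastPart ls) z * (P * E (sumRows n z n ls) zs)
      ≈⟨ *-congˡ (E-scaleColumns (λ i → x z - x i) (sumRows n z n ls) zs) ⟨
    f (suc n) (lastPart ls) z * E (map (λ g i → (x z - x i) * g i) (sumRows n z n ls)) zs
      ≈⟨ *-congˡ (E-cong (negated-rows n z n b<K ls↓) zs) ⟨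
    f (suc n) (lastPart ls) z * E (map (λ g i → - g i) (differenceRows n z n ls)) zs
      ≈⟨ E-++-last (f (suc n) (lastPart ls)) z zs (differenceRows-vanish n z n b<K ls↓) ⟨
    E (differenceRows n z n ls ++ f (suc n) (lastPart ls) ∷ []) (z ∷ zs)
      ≈⟨ E-differenceRows n z n ls↓ (z ∷ zs) ⟨
    E (rows (f (suc n)) (suc n) ls) (z ∷ zs) ∎
    where
    z = ι 0
    zs = applyUpTo (ι ∘ suc) n
    V = vandermondeOn x zs
    P = Π[ zs ] (λ i → x z - x i)
    step : ∀ {rs} → length rs ≡ n → V * (coef n z n ls rs * D n (ι ∘ suc) rs) ≈ coef n z n ls rs * E (rows (f n) n rs) zs
    step {rs} eq with coef-support n z n ls↓′ rs eq
    ... | inj₁ z₁  = trans (*-zero _ (zero-* _ z₁)) (sym (zero-* _ z₁))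
    ... | inj₂ rs↓ = trans (*-exchange _ _ _) (*-congˡ (vandermonde-D n (ι ∘ suc) (ℕₚ.≤-<-trans l≤b b<K) rs↓))

-- Horizontal strips and chains of strips.

tuples-All : ∀ K n → All (All (_< K)) (tuples K n)
tuples-All K zero    = [] ∷ []
tuples-All K (suc n) = choices-All (upTo K) (replicate n (upTo K)) (λ x∈ xs< → ∈-upTo⁻ x∈ ∷ xs<) (tuples-All K n)

-- The recursion asks whether the first entry is the largest admissible value, so that the initial
-- segment of largest entries can be split off a row of a tableau.
weaklyDecreasing : ℕ → ℕ → List (List ℕ)
weaklyDecreasing m       zero    = [] ∷ []
weaklyDecreasing zero    (suc n) = []
weaklyDecreasing (suc m) (suc n) = map (suc m ∷_) (weaklyDecreasing (suc m) n) ++ weaklyDecreasing m (suc n)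

weaklyDecreasing-All : ∀ m n → All (λ r → length r ≡ n × All (_≤ m) r) (weaklyDecreasing m n)
weaklyDecreasing-All m       zero    = (≡.refl , []) ∷ []
weaklyDecreasing-All zero    (suc n) = []
weaklyDecreasing-All (suc m) (suc n) = AllProperties.++⁺
  (AllProperties.map⁺ (All.map (λ (eq , r≤) → ≡.cong suc eq , ℕₚ.≤-refl ∷ r≤) (weaklyDecreasing-All (suc m) n)))
  (All.map (λ (eq , r≤) → eq , All.map ℕₚ.m≤n⇒m≤1+n r≤) (weaklyDecreasing-All m (suc n)))

drop-replicate-++ : ∀ {x : A} {m n} xs → n ≤ m → drop m (replicate n x ++ xs) ≡ drop (m ∸ n) xs
drop-replicate-++ xs z≤n       = ≡.refl
drop-replicate-++ xs (s≤s n≤m) = drop-replicate-++ xs n≤m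

module Strips (R : CommutativeRing c ℓ) where

  open CommutativeRing R hiding (zero)
  open Rows R public
  open SetoidReasoning setoid
  open SemiringSolver commutativeSemiring using (solve; _:+_; _:*_; _:=_)

  Σ-cong-upTo : ∀ {f g : ℕ → Carrier} n → (∀ k → k < n → f k ≈ g k) → Σ[ upTo n ] f ≈ Σ[ upTo n ] g
  Σ-cong-upTo n e = Σ-cong-All (All.tabulate (λ k∈ → e _ (∈-upTo⁻ k∈)))

  Σ-weaklyDecreasing-suc : ∀ m n (f : List ℕ → Carrier) →
    Σ[ weaklyDecreasing (suc m) n ] f ≈
    Σ[ upTo (suc n) ] (λ d → Σ[ weaklyDecreasing m (n ∸ d) ] (λ r → f (replicate d (suc m) ++ r)))
  Σ-weaklyDecreasing-suc m zero    f = sym (+-identityʳ _)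
  Σ-weaklyDecreasing-suc m (suc n) f = begin
    Σ[ map (suc m ∷_) (weaklyDecreasing (suc m) n) ++ weaklyDecreasing m (suc n) ] f
      ≈⟨ trans (Σ-++ f (map (suc m ∷_) (weaklyDecreasing (suc m) n)) _) (+-congʳ (Σ-map f (suc m ∷_) (weaklyDecreasing (suc m) n))) ⟩
    Σ[ weaklyDecreasing (suc m) n ] (f ∘ (suc m ∷_)) + Σ[ weaklyDecreasing m (suc n) ] f
      ≈⟨ trans (+-congʳ (Σ-weaklyDecreasing-suc m n (f ∘ (suc m ∷_)))) (+-comm _ _) ⟩
    Σ[ weaklyDecreasing m (suc n) ] f +
      Σ[ upTo (suc n) ] (λ d → Σ[ weaklyDecreasing m (n ∸ d) ] (λ r → f (suc m ∷ replicate d (suc m) ++ r)))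
      ≈⟨ Σ-upTo-suc (suc n) (λ d → Σ[ weaklyDecreasing m (suc n ∸ d) ] (λ r → f (replicate d (suc m) ++ r))) ⟨
    _ ∎

  -- For weights W of the rows, k being the index of the first row, the
  -- weight of the horizontal strip ρ/μ with ρ₁ ≤ b.
  strip : (ℕ → ℕ → ℕ → Carrier) → ℕ → ℕ → List ℕ → List ℕ → Carrier
  strip W k b []       []       = 1#
  strip W k b []       (_ ∷ _)  = 0#
  strip W k b (_ ∷ _)  []       = 0#
  strip W k b (m ∷ ms) (r ∷ rs) = ((⟦ m ≤ r ⟧ * ⟦ r ≤ b ⟧) * W k m r) * strip W (suc k) m ms rs

  strip-support : ∀ W k {b n μs} → Shape b n μs → ∀ ρs → length ρs ≡ n →
    strip W k b μs ρs ≈ 0# ⊎ Shape b n ρs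
  strip-support W k []                 []       _  = inj₂ []
  strip-support W k {b} (_∷_ {l = m} m≤b μs↓) (r ∷ rs) eq
    with ⟦≤⟧-split m r | ⟦≤⟧-split r b | strip-support W (suc k) μs↓ rs (ℕₚ.suc-injective eq)
  ... | inj₂ (_ , z₁)  | _              | _        = inj₁ (zero-* _ (zero-* _ (zero-* _ z₁)))
  ... | inj₁ _         | inj₂ (_ , z₁)  | _        = inj₁ (zero-* _ (zero-* _ (*-zero _ z₁)))
  ... | inj₁ _         | inj₁ _         | inj₁ z₁  = inj₁ (*-zero _ z₁)
  ... | inj₁ (m≤r , _) | inj₁ (r≤b , _) | inj₂ rs↓ = inj₂ (r≤b ∷ Shape-weaken m≤r rs↓)

  Πrows : (ℕ → ℕ → Carrier) → ℕ → List ℕ → Carrier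
  Πrows α k []       = 1#
  Πrows α k (m ∷ ms) = α k m * Πrows α (suc k) ms

  -- Each row trades its factor of the outer shape for one of the inner shape. The relation is
  -- assumed only for m ≤ r, since the indicator kills the other rows, and it is multiplicative so
  -- that nothing has to be divided.
  strip-gauge : ∀ {W W′} (α : ℕ → ℕ → Carrier) →
    (∀ k m r → m ≤ r → W k m r * α k r ≈ α k m * W′ k m r) →
    ∀ k b μs ρs → strip W k b μs ρs * Πrows α k ρs ≈ Πrows α k μs * strip W′ k b μs ρs
  strip-gauge α e k b []       []       = refl
  strip-gauge α e k b []       (_ ∷ _)  = trans (zeroˡ _) (sym (zeroʳ _))
  strip-gauge α e k b (_ ∷ _)  []       = trans (zeroˡ _) (sym (zeroʳ _))
  strip-gauge {W} {W′} α e k b (m ∷ ms) (r ∷ rs) = begin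
    ((I * W k m r) * N) * (α k r * P)
      ≈⟨ solve 5 (λ i w n a p → ((i :* w) :* n) :* (a :* p) := (i :* (w :* a)) :* (n :* p)) refl I (W k m r) N (α k r) P ⟩
    (I * (W k m r * α k r)) * (N * P)
      ≈⟨ *-cong inner (strip-gauge α e (suc k) m ms rs) ⟩
    (I * (α k m * W′ k m r)) * (Πrows α (suc k) ms * strip W′ (suc k) m ms rs)
      ≈⟨ solve 5 (λ i w n a p → (i :* (a :* w)) :* (p :* n) := (a :* p) :* ((i :* w) :* n)) refl
           I (W′ k m r) (strip W′ (suc k) m ms rs) (α k m) (Πrows α (suc k) ms) ⟩
    Πrows α k (m ∷ ms) * strip W′ k b (m ∷ ms) (r ∷ rs) ∎
    where
    I = ⟦ m ≤ r ⟧ * ⟦ r ≤ b ⟧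
    N = strip W (suc k) m ms rs
    P = Πrows α (suc k) rs
    inner : I * (W k m r * α k r) ≈ I * (α k m * W′ k m r)
    inner with ⟦≤⟧-split m r
    ... | inj₁ (m≤r , _) = *-congˡ (e k m r m≤r)
    ... | inj₂ (_ , z₁)  = trans (zero-* _ (zero-* _ z₁)) (sym (zero-* _ (zero-* _ z₁)))

  -- Σ over μ = ρ⁽ᵐ⁾ ⊆ ⋯ ⊆ ρ⁽⁰⁾ = ν of the product of the weights Wᵢ of
  -- the horizontal strips ρ⁽ⁱ⁻¹⁾/ρ⁽ⁱ⁾, for ν₁ ≤ N.
  chains : (ℕ → ℕ → ℕ → ℕ → Carrier) → ℕ → ℕ → ℕ → List ℕ → List ℕ → Carrier
  chains W N n zero    μs νs = δ μs νs
  chains W N n (suc m) μs νs = Σ[ tuples (suc N) n ] (λ ρs → strip (W (suc m)) 1 N μs ρs * chains W N n m ρs νs)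

  Σ-δʳ : ∀ {K n ms} (f : List ℕ → Carrier) → All (_< K) ms → length ms ≡ n →
        Σ[ tuples K n ] (λ r → f r * δ r ms) ≈ f ms
  Σ-δʳ {K} {n} {ms} f l eq =
    trans (Σ-cong (λ r → trans (*-comm _ _) (*-congʳ (δ-sym r ms))) (tuples K n)) (Σ-δ f l eq)

  -- By definition `chains` removes the strip of the largest entries, next to μ. Reassociating the
  -- nested sums removes instead the strip of the entries 1, next to ν.
  chains-suc : ∀ W N n m {μs νs} → All (_< suc N) μs → length μs ≡ n → All (_< suc N) νs → length νs ≡ n →
    chains W N n (suc m) μs νs ≈
    Σ[ tuples (suc N) n ] (λ ρs → chains (W ∘ suc) N n m μs ρs * strip (W 1) 1 N ρs νs)
  chains-suc W N n zero    {μs} {νs} μs< eq νs< eq′ =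
    trans (Σ-δʳ (strip (W 1) 1 N μs) νs< eq′) (sym (Σ-δ (λ ρs → strip (W 1) 1 N ρs νs) μs< eq))
  chains-suc W N n (suc m) {μs} {νs} μs< eq νs< eq′ = begin
    Σ[ T ] (λ ρs → strip (W (suc (suc m))) 1 N μs ρs * chains W N n (suc m) ρs νs)
      ≈⟨ Σ-cong-All (All.zipWith (λ (l , l′) → *-congˡ (chains-suc W N n m l l′ νs< eq′))
           (tuples-All (suc N) n , tuples-length (suc N) n)) ⟩
    Σ[ T ] (λ ρs → strip (W (suc (suc m))) 1 N μs ρs * Σ[ T ] (λ σs → chains (W ∘ suc) N n m ρs σs * strip (W 1) 1 N σs νs))
      ≈⟨ Σ-cong (λ ρs → trans (Σ-*ˡ _ _ T) (Σ-cong (λ σs → sym (*-assoc _ _ _)) T)) T ⟩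
    Σ[ T ] (λ ρs → Σ[ T ] (λ σs → (strip (W (suc (suc m))) 1 N μs ρs * chains (W ∘ suc) N n m ρs σs) * strip (W 1) 1 N σs νs))
      ≈⟨ Σ-swap _ T T ⟩
    Σ[ T ] (λ σs → Σ[ T ] (λ ρs → (strip (W (suc (suc m))) 1 N μs ρs * chains (W ∘ suc) N n m ρs σs) * strip (W 1) 1 N σs νs))
      ≈⟨ Σ-cong (λ σs → Σ-*ʳ _ _ T) T ⟨
    Σ[ T ] (λ σs → chains (W ∘ suc) N n (suc m) μs σs * strip (W 1) 1 N σs νs) ∎
    where T = tuples (suc N) n

-- Tableau sums and their recursion in the largest entry.

module TableauSum (R : CommutativeRing c ℓ) (X : ℕ → ℕ → ℕ → CommutativeRing.Carrier R) where

  open CommutativeRing R hiding (zero)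
  open Strips R
  open SetoidReasoning setoid
  open SemiringSolver commutativeSemiring using (solve; _:+_; _:*_; _:=_)

  above : List ℕ → List ℕ → Carrier
  above []       _        = 1#
  above (_ ∷ _)  []       = 1#
  above (i ∷ is) (j ∷ js) = ⟦ suc j ≤ i ⟧ * above is js

  rowWeight : ℕ → ℕ → List ℕ → Carrier
  rowWeight k l []       = 1#
  rowWeight k l (i ∷ is) = X i k (suc l) * rowWeight k (suc l) is

  -- The sum over the tableaux of shape ν/μ with entries in {1,…,m} whose
  -- first row, of index k, fits below a row with entries is in the columns
  -- b + 1, b + 2, ….
  tableauSum : ℕ → ℕ → ℕ → List ℕ → List ℕ → List ℕ → Carrier
  tableauSum m k b is []       []       = 1#
  tableauSum m k b is []       (_ ∷ _)  = 0#
  tableauSum m k b is (_ ∷ _)  []       = 0#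
  tableauSum m k b is (μ ∷ μs) (ν ∷ νs) = Σ[ weaklyDecreasing m (ν ∸ μ) ] (λ js →
    (⟦ μ ≤ ν ⟧ * above is (drop (b ∸ μ) js)) * (rowWeight k μ js * tableauSum m (suc k) μ js μs νs))

  runWeight : ℕ → ℕ → ℕ → ℕ → Carrier
  runWeight i k μ ρ = run (X i k) (suc μ) (ρ ∸ μ)

  private
    rowWeight-replicate : ∀ i k l d is →
      rowWeight k l (replicate d i ++ is) ≈ run (X i k) (suc l) d * rowWeight k (l ℕ.+ d) is
    rowWeight-replicate i k l zero    is rewrite ℕₚ.+-identityʳ l = sym (*-identityˡ _)
    rowWeight-replicate i k l (suc d) is rewrite ℕₚ.+-suc l d =
      trans (*-congˡ (rowWeight-replicate i k (suc l) d is)) (sym (*-assoc _ _ _))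

    above-[] : ∀ is → above is [] ≈ 1#
    above-[] []      = refl
    above-[] (_ ∷ _) = refl

    above-replicate : ∀ {m} d is {js} → All (_≤ m) js → above (replicate d (suc m) ++ is) js ≈ above is (drop d js)
    above-replicate zero    is js≤           = refl
    above-replicate (suc d) is []            = sym (above-[] is)
    above-replicate (suc d) is (j≤ ∷ js≤)    = trans (one-* _ (⟦≤⟧-one (s≤s j≤))) (above-replicate d is js≤)

    above-max : ∀ {m} {is} → 0 < length is → All (_≤ m) is → ∀ js → above is (m ∷ js) ≈ 0#
    above-max l (i≤ ∷ _) js = zero-* _ (⟦≤⟧-zero (s≤s i≤))

    -- An entry m + 1 cannot stand below an entry of the previous row, all of which are at most m +
    -- 1. So the d entries m + 1 must end by column b, which is the horizontal strip condition. The
    -- last hypothesis provides an entry in column b + 1 that is violated otherwise.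
    above-split : ∀ {m b d₀ μ d is js} → μ ≤ b → All (_≤ m) is → All (_≤ m) js →
      (b < μ ℕ.+ d → 0 < d₀ ℕ.+ length is) →
      above (replicate d₀ (suc m) ++ is) (drop (b ∸ μ) (replicate d (suc m) ++ js)) ≈
      ⟦ μ ℕ.+ d ≤ b ⟧ * above is (drop (b ℕ.+ d₀ ∸ (μ ℕ.+ d)) js)
    above-split {m} {b} {d₀} {μ} {d} {is} {js} μ≤b is≤ js≤ ne with ⟦≤⟧-split (μ ℕ.+ d) b
    ... | inj₁ (l , e) = trans (begin
      above (replicate d₀ (suc m) ++ is) (drop (b ∸ μ) (replicate d (suc m) ++ js))
        ≡⟨ ≡.cong (above (replicate d₀ (suc m) ++ is)) (drop-replicate-++ js d≤) ⟩
      above (replicate d₀ (suc m) ++ is) (drop (b ∸ μ ∸ d) js)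
        ≈⟨ above-replicate d₀ is (AllProperties.drop⁺ (b ∸ μ ∸ d) js≤) ⟩
      above is (drop d₀ (drop (b ∸ μ ∸ d) js))
        ≡⟨ ≡.cong (above is) (≡.trans (Listₚ.drop-drop (b ∸ μ ∸ d) d₀ js) (≡.cong (λ s → drop s js) index)) ⟩
      above is (drop (b ℕ.+ d₀ ∸ (μ ℕ.+ d)) js) ∎) (sym (one-* _ e))
      where
      d≤ : d ≤ b ∸ μ
      d≤ = ≡.subst (_≤ b ∸ μ) (ℕₚ.m+n∸m≡n μ d) (ℕₚ.∸-monoˡ-≤ μ l)
      index : b ∸ μ ∸ d ℕ.+ d₀ ≡ b ℕ.+ d₀ ∸ (μ ℕ.+ d)
      index = ≡.trans (≡.cong (ℕ._+ d₀) (ℕₚ.∸-+-assoc b μ d)) (≡.sym (ℕₚ.+-∸-comm d₀ l))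
    ... | inj₂ (l , e) = trans (begin
      above (replicate d₀ (suc m) ++ is) (drop (b ∸ μ) (replicate d (suc m) ++ js))
        ≡⟨ ≡.cong (λ s → above (replicate d₀ (suc m) ++ is) (drop (b ∸ μ) (replicate s (suc m) ++ js))) split ⟩
      above (replicate d₀ (suc m) ++ is) (drop (b ∸ μ) (replicate (b ∸ μ ℕ.+ suc (d ∸ suc (b ∸ μ))) (suc m) ++ js))
        ≡⟨ ≡.cong (above (replicate d₀ (suc m) ++ is)) (drop-front (b ∸ μ) _) ⟩
      above (replicate d₀ (suc m) ++ is) (suc m ∷ replicate (d ∸ suc (b ∸ μ)) (suc m) ++ js)
        ≈⟨ above-max (≡.subst (0 <_) (≡.sym len≡) (ne l))
             (AllProperties.++⁺ (AllProperties.replicate⁺ d₀ ℕₚ.≤-refl) (All.map ℕₚ.m≤n⇒m≤1+n is≤)) _ ⟩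
      0# ∎) (sym (zero-* _ e))
      where
      len≡ : length (replicate d₀ (suc m) ++ is) ≡ d₀ ℕ.+ length is
      len≡ = ≡.trans (Listₚ.length-++ (replicate d₀ (suc m))) (≡.cong (ℕ._+ length is) (Listₚ.length-replicate d₀))
      gap : suc (b ∸ μ) ≤ d
      gap = ℕₚ.+-cancelˡ-< μ (b ∸ μ) d (≡.subst (_< μ ℕ.+ d) (≡.sym (ℕₚ.m+[n∸m]≡n μ≤b)) l)
      split : d ≡ b ∸ μ ℕ.+ suc (d ∸ suc (b ∸ μ))
      split = ≡.sym (≡.trans (ℕₚ.+-suc (b ∸ μ) _) (ℕₚ.m+[n∸m]≡n gap))
      drop-front : ∀ n k → drop n (replicate (n ℕ.+ k) (suc m) ++ js) ≡ replicate k (suc m) ++ js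
      drop-front zero    k = ≡.refl
      drop-front (suc n) k = drop-front n k

  -- The entries m + 1 of each row form its initial segment.
  tableauSum-suc : ∀ {K n} m k {b v d₀ is μs νs} → v < K → v ≤ b ℕ.+ (d₀ ℕ.+ length is) → All (_≤ m) is →
    Shape b n μs → Shape v n νs →
    tableauSum (suc m) k b (replicate d₀ (suc m) ++ is) μs νs ≈
    Σ[ tuples K n ] (λ ρs → strip (runWeight (suc m)) k b μs ρs * tableauSum m k (b ℕ.+ d₀) is ρs νs)
  tableauSum-suc {K} m k v<K v≤ is≤ [] [] = sym (trans (+-identityʳ _) (*-identityˡ _))
  tableauSum-suc {K} {suc n} m k {b} {v} {d₀} {is} {μ ∷ μs} {ν ∷ νs} v<K v≤ is≤ (μ≤b ∷ μs↓) (ν≤v ∷ νs↓) = begin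
    Σ[ weaklyDecreasing (suc m) (ν ∸ μ) ] G
      ≈⟨ Σ-weaklyDecreasing-suc m (ν ∸ μ) G ⟩
    Σ[ upTo (suc (ν ∸ μ)) ] (λ d → Σ[ weaklyDecreasing m (ν ∸ μ ∸ d) ] (λ r → G (replicate d (suc m) ++ r)))
      ≈⟨ Σ-cong-upTo (suc (ν ∸ μ)) (λ d d< →
           trans (Σ-cong-All (All.map (λ {r} (eq , r≤) → entry-step d (s≤s⁻¹ d<) r eq r≤) (weaklyDecreasing-All m (ν ∸ μ ∸ d))))
             (trans (sym (Σ-*ˡ _ _ (weaklyDecreasing m (ν ∸ μ ∸ d))))
               (*-congˡ (reflexive (≡.cong (λ s → Σ[ weaklyDecreasing m s ] (H (μ ℕ.+ d))) (ℕₚ.∸-+-assoc ν μ d)))))) ⟩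
    Σ[ upTo (suc (ν ∸ μ)) ] (λ d → ⟦ μ ≤ ν ⟧ * ΣH (μ ℕ.+ d))
      ≈⟨ Σ-*ˡ _ _ (upTo (suc (ν ∸ μ))) ⟨
    ⟦ μ ≤ ν ⟧ * Σ[ upTo (suc (ν ∸ μ)) ] (λ d → ΣH (μ ℕ.+ d))
      -- The number d of entries m + 1 is replaced by ρ = μ + d, the length of this row in the
      -- intermediate shape.
      ≈⟨ Σ-interval {μ} {ν} K ΣH (ℕₚ.≤-<-trans ν≤v v<K) ⟨
    Σ[ upTo K ] (λ ρ → (⟦ μ ≤ ρ ⟧ * ⟦ ρ ≤ ν ⟧) * ΣH ρ)
      ≈⟨ Σ-cong (λ ρ → trans (Σ-*ˡ _ _ (weaklyDecreasing m (ν ∸ ρ))) (trans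
           (Σ-cong (λ r → trans (solve 7 (λ a b c d e f g → (a :* b) :* ((c :* d) :* ((e :* f) :* g)) :=
                 (((a :* c) :* e) :* ((b :* d) :* f)) :* g) refl
               ⟦ μ ≤ ρ ⟧ ⟦ ρ ≤ ν ⟧ ⟦ ρ ≤ b ⟧ (above is (drop (b ℕ.+ d₀ ∸ ρ) r))
               (runWeight (suc m) k μ ρ) (rowWeight k ρ r) _)
             (Σ-*ˡ _ _ (tuples K n))) (weaklyDecreasing m (ν ∸ ρ)))
           (trans (Σ-swap _ (weaklyDecreasing m (ν ∸ ρ)) (tuples K n))
             (Σ-cong (λ ρs → trans (Σ-cong (λ r →
                 solve 6 (λ a b c d e f → (a :* ((b :* c) :* d)) :* (e :* f) := (a :* e) :* ((b :* c) :* (d :* f))) refl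
                   ((⟦ μ ≤ ρ ⟧ * ⟦ ρ ≤ b ⟧) * runWeight (suc m) k μ ρ) ⟦ ρ ≤ ν ⟧ (above is (drop (b ℕ.+ d₀ ∸ ρ) r))
                   (rowWeight k ρ r) (strip (runWeight (suc m)) (suc k) μ μs ρs) (tableauSum m (suc k) ρ r ρs νs))
                 (weaklyDecreasing m (ν ∸ ρ)))
               (sym (Σ-*ˡ _ _ (weaklyDecreasing m (ν ∸ ρ))))) (tuples K n))))) (upTo K) ⟩
    Σ[ upTo K ] (λ ρ → Σ[ tuples K n ] (λ ρs → strip (runWeight (suc m)) k b (μ ∷ μs) (ρ ∷ ρs) *
      tableauSum m k (b ℕ.+ d₀) is (ρ ∷ ρs) (ν ∷ νs)))
      ≈⟨ Σ-tuples-suc K n (λ ρs → strip (runWeight (suc m)) k b (μ ∷ μs) ρs * tableauSum m k (b ℕ.+ d₀) is ρs (ν ∷ νs)) ⟨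
    _ ∎
    where
    G : List ℕ → Carrier
    G js = (⟦ μ ≤ ν ⟧ * above (replicate d₀ (suc m) ++ is) (drop (b ∸ μ) js)) *
           (rowWeight k μ js * tableauSum (suc m) (suc k) μ js μs νs)
    H : ℕ → List ℕ → Carrier
    H ρ r = (⟦ ρ ≤ b ⟧ * above is (drop (b ℕ.+ d₀ ∸ ρ) r)) * ((runWeight (suc m) k μ ρ * rowWeight k ρ r) *
      Σ[ tuples K n ] (λ ρs → strip (runWeight (suc m)) (suc k) μ μs ρs * tableauSum m (suc k) ρ r ρs νs))
    ΣH : ℕ → Carrier
    ΣH ρ = Σ[ weaklyDecreasing m (ν ∸ ρ) ] (H ρ)
    -- A row reaching past column b has length at most v ≤ b + d₀ + `length is`, which forces an
    -- entry in the row above.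
    nonempty : ∀ {d} → d ≤ ν ∸ μ → b < μ ℕ.+ d → 0 < d₀ ℕ.+ length is
    nonempty {d} d≤ b< with ℕₚ.≤-total μ ν
    ... | inj₁ μ≤ν = ℕₚ.+-cancelˡ-< b 0 _ (≡.subst (_< b ℕ.+ (d₀ ℕ.+ length is)) (≡.sym (ℕₚ.+-identityʳ b))
      (ℕₚ.<-≤-trans b< (ℕₚ.≤-trans (ℕₚ.+-monoʳ-≤ μ d≤) (ℕₚ.≤-trans (ℕₚ.≤-reflexive (ℕₚ.m+[n∸m]≡n μ≤ν)) (ℕₚ.≤-trans ν≤v v≤)))))
    ... | inj₂ ν≤μ = contradiction (ℕₚ.<-≤-trans b< (ℕₚ.≤-trans (ℕₚ.+-monoʳ-≤ μ d≤)
      (ℕₚ.≤-reflexive (≡.trans (≡.cong (μ ℕ.+_) (ℕₚ.m≤n⇒m∸n≡0 ν≤μ)) (ℕₚ.+-identityʳ μ))))) (ℕₚ.≤⇒≯ μ≤b)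
    entry-step : ∀ d → d ≤ ν ∸ μ → ∀ r → length r ≡ ν ∸ μ ∸ d → All (_≤ m) r →
      G (replicate d (suc m) ++ r) ≈ ⟦ μ ≤ ν ⟧ * H (μ ℕ.+ d) r
    entry-step d d≤ r eq r≤ = trans (*-cong
        (*-congˡ (above-split {m} {b} {d₀} {μ} {d} μ≤b is≤ r≤ (nonempty d≤)))
        (*-cong (trans (rowWeight-replicate (suc m) k μ d r)
                       (*-congʳ (reflexive (≡.cong (run (X (suc m) k) (suc μ)) (≡.sym (ℕₚ.m+n∸m≡n μ d))))))
                (tableauSum-suc m (suc k) (ℕₚ.≤-<-trans ν≤v v<K)
                  (≡.subst (λ s → ν ≤ μ ℕ.+ (d ℕ.+ s)) (≡.sym eq)
                    (ℕₚ.≤-trans (ℕₚ.m≤n+m∸n ν μ) (ℕₚ.+-monoʳ-≤ μ (ℕₚ.m≤n+m∸n (ν ∸ μ) d)))) r≤ μs↓ νs↓)))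
      (*-assoc _ _ _)

  tableauSum-zero : ∀ k b μs νs → tableauSum 0 k b [] μs νs ≈ δ μs νs
  tableauSum-zero k b []       []       = refl
  tableauSum-zero k b []       (_ ∷ _)  = refl
  tableauSum-zero k b (_ ∷ _)  []       = refl
  tableauSum-zero k b (μ ∷ μs) (ν ∷ νs) with ν ∸ μ in eq
  ... | zero  = trans (+-identityʳ _) (*-cong (*-congˡ (sym (⟦≤⟧-one {ν} {μ} (ℕₚ.m∸n≡0⇒m≤n eq))))
                  (trans (*-identityˡ _) (tableauSum-zero (suc k) μ μs νs)))
  ... | suc _ = sym (zero-* _ (*-zero _ (⟦≤⟧-zero {ν} {μ} (ℕₚ.m∸n≢0⇒n<m {ν} {μ} (λ e → ℕₚ.1+n≢0 (≡.trans (≡.sym eq) e))))))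

  tableauSum-chains : ∀ {N n} m {μs νs} → Shape N n μs → Shape N n νs →
    tableauSum m 1 N [] μs νs ≈ chains runWeight N n m μs νs
  tableauSum-chains zero    {μs} {νs} μs↓ νs↓ = tableauSum-zero 1 _ μs νs
  tableauSum-chains {N} {n} (suc m) {μs} {νs} μs↓ νs↓ = begin
    tableauSum (suc m) 1 N [] μs νs
      ≈⟨ tableauSum-suc {suc N} m 1 {d₀ = 0} ℕₚ.≤-refl (ℕₚ.m≤m+n N 0) [] μs↓ νs↓ ⟩
    Σ[ tuples (suc N) n ] (λ ρs → strip (runWeight (suc m)) 1 N μs ρs * tableauSum m 1 (N ℕ.+ 0) [] ρs νs)
      ≈⟨ Σ-cong-All (All.map (λ {ρs} → each {ρs}) (tuples-length (suc N) n)) ⟩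
    chains runWeight N n (suc m) μs νs ∎
    where
    each : ∀ {ρs} → length ρs ≡ n → strip (runWeight (suc m)) 1 N μs ρs * tableauSum m 1 (N ℕ.+ 0) [] ρs νs ≈
           strip (runWeight (suc m)) 1 N μs ρs * chains runWeight N n m ρs νs
    each {ρs} eq rewrite ℕₚ.+-identityʳ N with strip-support (runWeight (suc m)) 1 μs↓ ρs eq
    ... | inj₁ z₁  = trans (zero-* _ z₁) (sym (zero-* _ z₁))
    ... | inj₂ ρs↓ = *-congˡ (tableauSum-chains m ρs↓ νs↓)

-- The Cauchy kernel acting on alternants of shifted powers.

firstPart : List ℕ → ℕ
firstPart []      = 0
firstPart (l ∷ _) = l

-- Expresses dependence on k - l alone while both indices remain natural numbers.
Diagonal : (R : CommutativeRing c ℓ) → (ℕ → ℕ → CommutativeRing.Carrier R) → Set _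
Diagonal R h = ∀ k l → h (suc k) (suc l) ≈ h k l
  where open CommutativeRing R

Inverse : (R : CommutativeRing c ℓ) → let open CommutativeRing R in
  (ℕ → Carrier) → (ℕ → ℕ → Carrier) → (ℕ → ℕ → ℕ → Carrier) → Set _
Inverse R y h γ = ∀ i k l → (1# - h k l * y i) * γ i k l ≈ 1#
  where open CommutativeRing R

-- h k l stands for a_{k-l} and γ i k l for 1/(1 - a_{k-l} yᵢ).
module Weights (R : CommutativeRing c ℓ) (y : ℕ → CommutativeRing.Carrier R)
  (h : ℕ → ℕ → CommutativeRing.Carrier R)
  (h-diagonal : Diagonal R h)
  (γ : ℕ → ℕ → ℕ → CommutativeRing.Carrier R)
  (γ-inverse : Inverse R y h γ) where

  open CommutativeRing R hiding (zero)
  open Strips R public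
  open SetoidReasoning setoid
  open SemiringSolver commutativeSemiring using (solve; _:+_; _:*_; _:=_)

  α : ℕ → ℕ → ℕ → Carrier
  α i k l = 1# - h k l * y i

  X : ℕ → ℕ → ℕ → Carrier
  X i k l = y i * ((∏[ i ∸ 1 ] λ j → α j k (l ∸ 1)) * (∏[ i ] λ j → γ j k l))

  open TableauSum R X public using (runWeight)

  q₁ : ℕ → ℕ → ℕ → Carrier
  q₁ i k l = y i * γ i k l

  -- The weight of a row of a horizontal strip when y_i is the only variable. The factors of `X`
  -- containing smaller variables are restored by the gauge `αs`.
  Q : ℕ → ℕ → ℕ → ℕ → Carrier
  Q i k m r = run (q₁ i k) (suc m) (r ∸ m)

  αs : ℕ → ℕ → ℕ → Carrier
  αs m k l = ∏[ m ] λ j → α j k l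

  ∏-inverse : ∀ m k l → (∏[ m ] λ j → γ j k l) * αs m k l ≈ 1#
  ∏-inverse m k l = trans (sym (∏-* _ _ m))
    (trans (∏-cong (λ j → trans (*-comm _ _) (γ-inverse j k l)) m) (∏-one m))

  -- The denominators at column l and the numerators at column l + 1 contain the same a_{k-l}, so
  -- along a row only the numerators of the first box and the denominators of the last one survive.
  runWeight-gauge : ∀ i k m r → m ≤ r → runWeight (suc i) k m r * αs i k r ≈ αs i k m * Q (suc i) k m r
  runWeight-gauge i k m r m≤r = begin
    run (X (suc i) k) (suc m) (r ∸ m) * αs i k r
      ≡⟨ ≡.cong (λ s → run (X (suc i) k) (suc m) (r ∸ m) * αs i k s) (≡.sym (ℕₚ.m+[n∸m]≡n m≤r)) ⟩
    run (X (suc i) k) (suc m) (r ∸ m) * αs i k (m ℕ.+ (r ∸ m))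
      ≈⟨ telescope m (r ∸ m) ⟩
    αs i k m * Q (suc i) k m r ∎
    where
    telescope : ∀ m d → run (X (suc i) k) (suc m) d * αs i k (m ℕ.+ d) ≈ αs i k m * run (q₁ (suc i) k) (suc m) d
    telescope m zero rewrite ℕₚ.+-identityʳ m = *-comm _ _
    telescope m (suc d) rewrite ℕₚ.+-suc m d = begin
      (y′ * (αs i k m * (G * g))) * T * αs i k (suc (m ℕ.+ d))
        ≈⟨ trans (*-assoc _ _ _) (*-congˡ (telescope (suc m) d)) ⟩
      (y′ * (αs i k m * (G * g))) * (αs i k (suc m) * S)
        ≈⟨ solve 6 (λ y a G g b s → (y :* (a :* (G :* g))) :* (b :* s) := (G :* b) :* (a :* ((y :* g) :* s)))
             refl y′ (αs i k m) G g (αs i k (suc m)) S ⟩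
      (G * αs i k (suc m)) * (αs i k m * ((y′ * g) * S))
        ≈⟨ one-* _ (∏-inverse i k (suc m)) ⟩
      αs i k m * ((y′ * g) * S) ∎
      where
      y′ = y (suc i)
      G  = ∏[ i ] λ j → γ j k (suc m)
      g  = γ (suc i) k (suc m)
      T  = run (X (suc i) k) (suc (suc m)) d
      S  = run (q₁ (suc i) k) (suc (suc m)) d

  h-shift : ∀ k t l → h k l ≈ h (k ℕ.+ t) (l ℕ.+ t)
  h-shift k zero    l rewrite ℕₚ.+-identityʳ k | ℕₚ.+-identityʳ l = refl
  h-shift k (suc t) l rewrite ℕₚ.+-suc k t | ℕₚ.+-suc l t = trans (h-shift k t l) (sym (h-diagonal _ _))

  -- `γ` is known only as an inverse, and inverses of equal elements are equal.
  γ-diagonal : ∀ i k l → γ i (suc k) (suc l) ≈ γ i k l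
  γ-diagonal i k l = begin
    γ i (suc k) (suc l)                         ≈⟨ *-identityʳ _ ⟨
    γ i (suc k) (suc l) * 1#                    ≈⟨ *-congˡ (γ-inverse i k l) ⟨
    γ i (suc k) (suc l) * (α i k l * γ i k l)   ≈⟨ *-assoc _ _ _ ⟨
    (γ i (suc k) (suc l) * α i k l) * γ i k l
      ≈⟨ one-* _ (trans (*-congˡ (+-congˡ (-‿cong (*-congʳ (sym (h-diagonal k l))))))
           (trans (*-comm _ _) (γ-inverse i (suc k) (suc l)))) ⟩
    γ i k l                                     ∎

  γ-shift : ∀ i k l t → γ i (k ℕ.+ t) (l ℕ.+ t) ≈ γ i k l
  γ-shift i k l zero    rewrite ℕₚ.+-identityʳ k | ℕₚ.+-identityʳ l = refl
  γ-shift i k l (suc t) rewrite ℕₚ.+-suc k t | ℕₚ.+-suc l t = trans (γ-diagonal i _ _) (γ-shift i k l t)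

  Πrows-* : ∀ (f g : ℕ → ℕ → Carrier) k ms → Πrows (λ k m → f k m * g k m) k ms ≈ Πrows f k ms * Πrows g k ms
  Πrows-* f g k []       = sym (*-identityˡ _)
  Πrows-* f g k (m ∷ ms) = trans (*-congˡ (Πrows-* f g (suc k) ms)) (*-interchange _ _ _ _)

  Πrows-one : ∀ k ms → Πrows (λ _ _ → 1#) k ms ≈ 1#
  Πrows-one k []       = refl
  Πrows-one k (m ∷ ms) = trans (*-identityˡ _) (Πrows-one (suc k) ms)

  -- g i a stands for 1/(1 - x(a) yᵢ).
  module Kernel {A : Set p} (x : A → Carrier) (g : ℕ → A → Carrier)
    (g-inverse : ∀ i a → (1# - x a * y i) * g i a ≈ 1#) (cs : List A) (n N : ℕ)
    {i} (I : Carrier → Set i) (I-cong : ∀ {u v} → u ≈ v → I u → I v) (I-0 : I 0#)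
    (I-+ : ∀ {u v} → I u → I v → I (u + v)) (I-* : ∀ {u} v → I u → I (u * v)) where

    infix 4 _~_
    -- Congruence modulo the ideal `I`, to be taken as the series of order greater than D in y.
    _~_ : Carrier → Carrier → Set _
    u ~ v = ∃ λ w → I w × u ≈ v + w

    ≈⇒~ : ∀ {u v} → u ≈ v → u ~ v
    ≈⇒~ e = 0# , I-0 , trans e (sym (+-identityʳ _))

    ~-trans : ∀ {u v w} → u ~ v → v ~ w → u ~ w
    ~-trans (r , i , e) (s , j , f) = s + r , I-+ j i , trans e (trans (+-congʳ f) (+-assoc _ _ _))

    ~-*ˡ : ∀ z {u v} → u ~ v → z * u ~ z * v
    ~-*ˡ z (w , i , e) = w * z , I-* z i , trans (*-congˡ e) (trans (distribˡ _ _ _) (+-congˡ (*-comm _ _)))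

    ~-Σ : ∀ {f g : List ℕ → Carrier} {xs} → All (λ x → f x ~ g x) xs → ListSums.Σ[_] R xs f ~ ListSums.Σ[_] R xs g
    ~-Σ []                 = ≈⇒~ refl
    ~-Σ ((v , i , e) ∷ es) with ~-Σ es
    ... | w , j , f = v + w , I-+ i j , trans (+-cong e f) (+-interchange _ _ _ _)

    -- Measures the order in y that is still missing: any `k` further factors y bring the element
    -- into `I`. Each box added to the first row will supply one such factor.
    Kills : ℕ → Carrier → Set i
    Kills zero    z = I z
    Kills (suc k) z = ∀ i → Kills k (z * y i)

    Kills-cong : ∀ k {z z′} → z ≈ z′ → Kills k z → Kills k z′
    Kills-cong zero    e kz = I-cong e kz
    Kills-cong (suc k) e kz = λ i → Kills-cong k (*-congʳ e) (kz i)

    Kills-* : ∀ k {z} u → Kills k z → Kills k (z * u)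
    Kills-* zero    u kz = I-* u kz
    Kills-* (suc k) u kz = λ i → Kills-cong k (*-exchangeʳ _ _ _) (Kills-* k u (kz i))

    Kills-zero : ∀ k {z} → z ≈ 0# → Kills k z
    Kills-zero zero    e = I-cong (sym e) I-0
    Kills-zero (suc k) e = λ i → Kills-zero k (zero-* _ e)

    Kills-run : ∀ i (g : ℕ → Carrier) k d l {z} → Kills (d ℕ.+ k) z → Kills k (z * run (λ s → y i * g s) l d)
    Kills-run i g k zero    l kz = Kills-cong k (sym (*-identityʳ _)) kz
    Kills-run i g k (suc d) l {z} kz = Kills-cong k
      (solve 4 (λ z y g s → ((z :* y) :* g) :* s := z :* ((y :* g) :* s)) refl z (y i) (g l) (run (λ s → y i * g s) (suc l) d))
      (Kills-run i g k d (suc l) (Kills-* (d ℕ.+ k) (g l) (kz i)))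

    -- A strip adds r - m boxes to the first row, and each brings a factor y; the number of missing
    -- factors drops by exactly as many.
    Kills-strip : ∀ N i {n μs} → Shape N n μs → ∀ ρs → length ρs ≡ n → ∀ {z} → Kills (suc N ∸ firstPart μs) z →
      Kills (suc N ∸ firstPart ρs) (z * strip (runWeight i) 1 N μs ρs)
    Kills-strip N i []                     []       eq kz = Kills-* (suc N) _ kz
    Kills-strip N i (_∷_ {l = m} {ls} m≤N μs↓) (r ∷ rs) eq {z} kz with ⟦≤⟧-split m r | ⟦≤⟧-split r N
    ... | inj₂ (_ , e)   | _              = Kills-zero (suc N ∸ r) (*-zero z (zero-* _ (zero-* _ (zero-* _ e))))
    ... | inj₁ _         | inj₂ (_ , e)   = Kills-zero (suc N ∸ r) (*-zero z (zero-* _ (zero-* _ (*-zero _ e))))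
    ... | inj₁ (m≤r , _) | inj₁ (r≤N , _) = Kills-cong (suc N ∸ r)
      (solve 4 (λ z w i s → (z :* w) :* (i :* s) := z :* ((i :* w) :* s)) refl z (runWeight i 1 m r)
        (⟦ m ≤ r ⟧ * ⟦ r ≤ N ⟧) (strip (runWeight i) 2 m ls rs))
      (Kills-* (suc N ∸ r) _ (Kills-run i _ (suc N ∸ r) (r ∸ m) (suc m)
        (≡.subst (λ s → Kills s z) count kz)))
      where
      count : suc N ∸ m ≡ r ∸ m ℕ.+ (suc N ∸ r)
      count = ≡.trans (≡.cong (_∸ m) (≡.sym (ℕₚ.m+[n∸m]≡n (ℕₚ.m≤n⇒m≤1+n r≤N)))) (ℕₚ.+-∸-comm (suc N ∸ r) m≤r)

    shifted : ℕ → A → Carrier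
    shifted = newton x (h n)

    alternant : List ℕ → Carrier
    alternant μs = E (rows shifted n μs) cs

    kernelValue : ℕ → List ℕ → Carrier
    kernelValue m μs = Πrows (αs m) 1 μs * ∏[ m ] λ i → Π[ cs ] (g i)

    module _ (i : ℕ) where

      private
        K = suc N
        F : ℕ → A → Carrier
        F β a = α i n β * (g i a * shifted β a)

        -- Once γ cancels α at β + 1, what remains is (1 - x y) + y (x - b) = 1 - b y, divided by 1
        -- - x y.
        F-step : ∀ β a → F β a ≈ shifted β a + q₁ i n (suc β) * F (suc β) a
        F-step β a = sym (begin
          s + (y i * γ′) * (α′ * (G * (s * (x a - b))))
            ≈⟨ +-cong (sym (one-* s (g-inverse i a))) (trans
                 (solve 6 (λ y γ α g s d → (y :* γ) :* (α :* (g :* (s :* d))) := (α :* γ) :* ((y :* d) :* (g :* s)))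
                   refl (y i) γ′ α′ G s (x a - b)) (one-* _ (γ-inverse i n (suc β)))) ⟩
          ((1# - x a * y i) * G) * s + (y i * (x a - b)) * (G * s)
            ≈⟨ solve 4 (λ u G s v → (u :* G) :* s :+ v :* (G :* s) := (u :+ v) :* (G :* s)) refl
                 (1# - x a * y i) G s (y i * (x a - b)) ⟩
          ((1# - x a * y i) + y i * (x a - b)) * (G * s)
            ≈⟨ *-congʳ (begin
                 (1# - x a * y i) + y i * (x a - b)
                   ≈⟨ +-congˡ (trans (x[y-z]≈xy-xz _ _ _) (neg-cong₂ (*-comm _ _) (*-comm _ _))) ⟩
                 (1# - x a * y i) + (x a * y i - b * y i)
                   ≈⟨ trans (+-assoc _ _ _) (+-congˡ (trans (sym (+-assoc _ _ _)) (trans (+-congʳ (-‿inverseˡ _)) (+-identityˡ _)))) ⟩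
                 1# - b * y i ∎) ⟩
          (1# - b * y i) * (G * s) ∎)
          where
          s = shifted β a
          G = g i a
          b = h n β
          γ′ = γ i n (suc β)
          α′ = α i n (suc β)

        F-sum : ∀ d β a → F β a ≈
          Σ[ upTo d ] (λ j → run (q₁ i n) (suc β) j * shifted (β ℕ.+ j) a) + run (q₁ i n) (suc β) d * F (β ℕ.+ d) a
        F-sum zero    β a rewrite ℕₚ.+-identityʳ β = sym (trans (+-identityˡ _) (*-identityˡ _))
        F-sum (suc d) β a = begin
          F β a
            ≈⟨ trans (F-step β a) (+-congˡ (trans (*-congˡ (F-sum d (suc β) a)) (distribˡ _ _ _))) ⟩
          shifted β a + (q₁ i n (suc β) * Σ[ upTo d ] (λ j → run (q₁ i n) (suc (suc β)) j * shifted (suc β ℕ.+ j) a) +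
                         q₁ i n (suc β) * (run (q₁ i n) (suc (suc β)) d * F (suc β ℕ.+ d) a))
            ≈⟨ +-congˡ (+-cong (trans (Σ-*ˡ _ _ (upTo d)) (Σ-cong (λ j → trans (sym (*-assoc _ _ _))
                 (*-congˡ (reflexive (≡.cong (λ s → shifted s a) (≡.sym (ℕₚ.+-suc β j)))))) (upTo d)))
                 (trans (sym (*-assoc _ _ _)) (*-congˡ (reflexive (≡.cong (λ s → F s a) (≡.sym (ℕₚ.+-suc β d))))))) ⟩
          shifted β a + (Σ[ upTo d ] (λ j → run (q₁ i n) (suc β) (suc j) * shifted (β ℕ.+ suc j) a) +
                         run (q₁ i n) (suc β) (suc d) * F (β ℕ.+ suc d) a)
            ≈⟨ +-assoc _ _ _ ⟨
          (shifted β a + Σ[ upTo d ] (λ j → run (q₁ i n) (suc β) (suc j) * shifted (β ℕ.+ suc j) a)) + _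
            ≈⟨ +-congʳ (+-congʳ (trans (reflexive (≡.cong (λ s → shifted s a) (≡.sym (ℕₚ.+-identityʳ β)))) (sym (*-identityˡ _)))) ⟩
          (1# * shifted (β ℕ.+ 0) a + Σ[ upTo d ] (λ j → run (q₁ i n) (suc β) (suc j) * shifted (β ℕ.+ suc j) a)) + _
            ≈⟨ +-congʳ (Σ-upTo-suc d (λ j → run (q₁ i n) (suc β) j * shifted (β ℕ.+ j) a)) ⟨
          _ ∎

        sumRow : ℕ → ℕ → ℕ → ℕ → A → Carrier
        sumRow k t b m a = Σ[ upTo K ] (λ r → (⟦ m ≤ r ⟧ * ⟦ r ≤ b ⟧) * (Q i k m r * shifted (r ℕ.+ t) a))

        γ-shift′ : ∀ k t l → k ℕ.+ t ≡ n → γ i k l ≈ γ i n (l ℕ.+ t)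
        γ-shift′ k t l ≡.refl = sym (γ-shift i k l t)

        α-shift : ∀ k t l → k ℕ.+ t ≡ n → α i n (l ℕ.+ t) ≈ α i k l
        α-shift k t l ≡.refl = +-congˡ (-‿cong (*-congʳ (sym (h-shift k t l))))

        -- The expansion is stopped after b - m + 1 steps because its remainder is then a multiple
        -- of `F` at b + t + 1, the function in the previous row of length b. Shifting by t turns
        -- the coefficients at level n into those of row k.
        F-sumRow : ∀ k t {b m} → k ℕ.+ t ≡ n → m ≤ b → b < K → ∀ a →
          F (m ℕ.+ t) a ≈ sumRow k t b m a + run (q₁ i k) (suc m) (suc (b ∸ m)) * F (b ℕ.+ suc t) a
        F-sumRow k t {b} {m} eq m≤b b<K a = begin
          F (m ℕ.+ t) a
            ≈⟨ F-sum (suc (b ∸ m)) (m ℕ.+ t) a ⟩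
          Σ[ upTo (suc (b ∸ m)) ] (λ j → run (q₁ i n) (suc m ℕ.+ t) j * shifted (m ℕ.+ t ℕ.+ j) a) +
            run (q₁ i n) (suc m ℕ.+ t) (suc (b ∸ m)) * F (m ℕ.+ t ℕ.+ suc (b ∸ m)) a
            ≈⟨ +-cong (trans (Σ-cong (λ j → *-cong
                   (trans (sym (shiftRun j)) (reflexive (≡.cong (run (q₁ i k) (suc m)) (≡.sym (ℕₚ.m+n∸m≡n m j)))))
                   (reflexive (≡.cong (λ s → shifted s a) (index j)))) (upTo (suc (b ∸ m))))
                 (trans (sym (one-* _ (⟦≤⟧-one m≤b))) (sym (Σ-interval {m} {b} K (λ r → Q i k m r * shifted (r ℕ.+ t) a) b<K))))
                 (*-cong (sym (shiftRun (suc (b ∸ m)))) (reflexive (≡.cong (λ s → F s a) index′))) ⟩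
          sumRow k t b m a + run (q₁ i k) (suc m) (suc (b ∸ m)) * F (b ℕ.+ suc t) a ∎
          where
          shiftRun : ∀ d → run (q₁ i k) (suc m) d ≈ run (q₁ i n) (suc m ℕ.+ t) d
          shiftRun d = run-shift t (λ l → *-congˡ (γ-shift′ k t l eq)) (suc m) d
          index : ∀ j → m ℕ.+ t ℕ.+ j ≡ m ℕ.+ j ℕ.+ t
          index j = ≡.trans (ℕₚ.+-assoc m t j) (≡.trans (≡.cong (m ℕ.+_) (ℕₚ.+-comm t j)) (≡.sym (ℕₚ.+-assoc m j t)))
          index′ : m ℕ.+ t ℕ.+ suc (b ∸ m) ≡ b ℕ.+ suc t
          index′ = ≡.trans (ℕₚ.+-suc (m ℕ.+ t) (b ∸ m)) (≡.trans (≡.cong suc (index (b ∸ m)))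
            (≡.trans (≡.cong (λ s → suc (s ℕ.+ t)) (ℕₚ.m+[n∸m]≡n m≤b)) (≡.sym (ℕₚ.+-suc b t))))

        sumRows : ℕ → ℕ → ℕ → List ℕ → List (A → Carrier)
        sumRows k zero    b _        = []
        sumRows k (suc t) b []       = []
        sumRows k (suc t) b (m ∷ ms) = sumRow k t b m ∷ sumRows (suc k) t m ms

        index-suc : ∀ {k t} → k ℕ.+ suc t ≡ n → suc k ℕ.+ t ≡ n
        index-suc {k} {t} = ≡.trans (≡.sym (ℕₚ.+-suc k t))

        -- Rows are corrected from the bottom upwards, so that the previous row, a multiple of which
        -- is subtracted, is still an unaltered `F`.
        E-rows-sumRows : ∀ k t {b ms} → k ℕ.+ t ≡ n → b < K → Shape b t ms → ∀ cs →
          E (F (b ℕ.+ t) ∷ rows F t ms) cs ≈ E (F (b ℕ.+ t) ∷ sumRows (suc k) t b ms) cs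
        E-rows-sumRows k zero    eq b<K [] cs = refl
        E-rows-sumRows k (suc t) {b} {m ∷ ms} eq b<K (m≤b ∷ ms↓) cs = begin
          E (F (b ℕ.+ suc t) ∷ F (m ℕ.+ t) ∷ rows F t ms) cs
            ≈⟨ E-head (F (b ℕ.+ suc t)) {F (m ℕ.+ t) ∷ rows F t ms} {F (m ℕ.+ t) ∷ sumRows (suc (suc k)) t m ms}
                 (E-rows-sumRows (suc k) t eq′ (ℕₚ.≤-<-trans m≤b b<K) ms↓) cs ⟩
          E (F (b ℕ.+ suc t) ∷ F (m ℕ.+ t) ∷ sumRows (suc (suc k)) t m ms) cs
            ≈⟨ E-subtractPrevious (F (m ℕ.+ t)) (F (b ℕ.+ suc t)) (run (q₁ i (suc k)) (suc m) (suc (b ∸ m))) (sumRows (suc (suc k)) t m ms) cs ⟨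
          E (F (b ℕ.+ suc t) ∷ (λ a → F (m ℕ.+ t) a - run (q₁ i (suc k)) (suc m) (suc (b ∸ m)) * F (b ℕ.+ suc t) a) ∷
             sumRows (suc (suc k)) t m ms) cs
            ≈⟨ E-head (F (b ℕ.+ suc t))
                 {(λ a → F (m ℕ.+ t) a - run (q₁ i (suc k)) (suc m) (suc (b ∸ m)) * F (b ℕ.+ suc t) a) ∷ sumRows (suc (suc k)) t m ms}
                 {sumRow (suc k) t b m ∷ sumRows (suc (suc k)) t m ms} (λ cs → pick-cong (λ c r → *-congʳ
                 (trans (+-congʳ (F-sumRow (suc k) t eq′ m≤b b<K c))
                   (trans (+-assoc _ _ _) (trans (+-congˡ (-‿inverseʳ _)) (+-identityʳ _))))) cs) cs ⟩
          E (F (b ℕ.+ suc t) ∷ sumRows (suc k) (suc t) b (m ∷ ms)) cs ∎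
          where
          eq′ : suc k ℕ.+ t ≡ n
          eq′ = index-suc eq

        E-sumRows : ∀ k t {b ms} → Shape b t ms → ∀ cs →
          E (sumRows k t b ms) cs ≈ Σ[ tuples K t ] (λ ρs → strip (Q i) k b ms ρs * E (rows shifted t ρs) cs)
        E-sumRows k zero    [] cs = sym (trans (Σ-tuples-zero K (λ ρs → strip (Q i) k 0 [] ρs * E [] cs)) (*-identityˡ _))
        E-sumRows k (suc t) {b} {m ∷ ms} (m≤b ∷ ms↓) cs = begin
          pick (λ c r → sumRow k t b m c * E (sumRows (suc k) t m ms) r) cs
            ≈⟨ pick-cong (λ c r → trans (*-congˡ (E-sumRows (suc k) t ms↓ r)) (Σ-* _ (upTo K) _ (tuples K t))) cs ⟩
          pick (λ c r → Σ[ upTo K ] (λ ρ → Σ[ tuples K t ] (λ ρs →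
            ((⟦ m ≤ ρ ⟧ * ⟦ ρ ≤ b ⟧) * (Q i k m ρ * shifted (ρ ℕ.+ t) c)) *
            (strip (Q i) (suc k) m ms ρs * E (rows shifted t ρs) r)))) cs
            ≈⟨ trans (pick-Σ _ (upTo K) cs) (Σ-cong (λ ρ → trans (pick-Σ _ (tuples K t) cs)
                 (Σ-cong (λ ρs → trans
                   (pick-cong (λ c r → solve 5 (λ a b c d e → (a :* (b :* c)) :* (d :* e) := ((a :* b) :* d) :* (c :* e))
                      refl (⟦ m ≤ ρ ⟧ * ⟦ ρ ≤ b ⟧) (Q i k m ρ) (shifted (ρ ℕ.+ t) c)
                           (strip (Q i) (suc k) m ms ρs) (E (rows shifted t ρs) r)) cs)
                   (pick-*ˡ _ _ cs)) (tuples K t))) (upTo K)) ⟩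
          Σ[ upTo K ] (λ ρ → Σ[ tuples K t ] (λ ρs →
            strip (Q i) k b (m ∷ ms) (ρ ∷ ρs) * E (rows shifted (suc t) (ρ ∷ ρs)) cs))
            ≈⟨ Σ-tuples-suc K t (λ ρs → strip (Q i) k b (m ∷ ms) ρs * E (rows shifted (suc t) ρs) cs) ⟨
          _ ∎

        E-rows-scale : ∀ k t {b ms} → k ℕ.+ t ≡ n → Shape b t ms → ∀ cs →
          E (rows F t ms) cs ≈ Πrows (α i) (suc k) ms * E (map (λ f a → g i a * f a) (rows shifted t ms)) cs
        E-rows-scale k zero    eq [] cs = sym (*-identityˡ _)
        E-rows-scale k (suc t) {b} {m ∷ ms} eq (_ ∷ ms↓) cs = begin
          pick (λ c r → F (m ℕ.+ t) c * E (rows F t ms) r) cs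
            ≈⟨ pick-cong (λ c r → trans (*-cong (*-congʳ (α-shift (suc k) t m (index-suc eq))) (E-rows-scale (suc k) t (index-suc eq) ms↓ r))
                 (*-interchange _ _ _ _)) cs ⟩
          pick (λ c r → (α i (suc k) m * Πrows (α i) (suc (suc k)) ms) *
            ((g i c * shifted (m ℕ.+ t) c) * E (map (λ f a → g i a * f a) (rows shifted t ms)) r)) cs
            ≈⟨ pick-*ˡ _ _ cs ⟩
          _ ∎

        -- The first row is treated as if a row of length N preceded it. The remainder that cannot
        -- be subtracted has N - μ₁ + 1 factors y, so its product with z lies in `I`.
        kill-head : ∀ {μs z} → Shape N n μs → Kills (suc N ∸ firstPart μs) z → ∀ cs →
          z * E (rows F n μs) cs ~ z * E (sumRows 1 n N μs) cs
        kill-head []            kz cs = ≈⇒~ refl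
        kill-head {μ ∷ μs} {z} (_∷_ {n = t} μ≤N μs↓) kz cs = _ , I-* (E (F (N ℕ.+ suc t) ∷ sumRows 2 t μ μs) cs) killed , (begin
          z * E (F (μ ℕ.+ t) ∷ rows F t μs) cs
            ≈⟨ *-congˡ (E-rows-sumRows 1 t ≡.refl (s≤s μ≤N) μs↓ cs) ⟩
          z * E (F (μ ℕ.+ t) ∷ sumRows 2 t μ μs) cs
            ≈⟨ *-congˡ (trans (pick-cong (λ c r → trans (*-congʳ (F-sumRow 1 t ≡.refl μ≤N ℕₚ.≤-refl c))
                 (trans (distribʳ _ _ _) (+-congˡ (*-assoc _ _ _)))) cs) (trans (pick-+ _ _ cs) (+-congˡ (pick-*ˡ _ _ cs)))) ⟩
          z * (E (sumRows 1 n N (μ ∷ μs)) cs + run (q₁ i 1) (suc μ) (suc (N ∸ μ)) * E (F (N ℕ.+ suc t) ∷ sumRows 2 t μ μs) cs)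
            ≈⟨ trans (distribˡ _ _ _) (+-congˡ (sym (*-assoc _ _ _))) ⟩
          z * E (sumRows 1 n N (μ ∷ μs)) cs + (z * run (q₁ i 1) (suc μ) (suc (N ∸ μ))) * E (F (N ℕ.+ suc t) ∷ sumRows 2 t μ μs) cs ∎)
          where
          killed : I (z * run (q₁ i 1) (suc μ) (suc (N ∸ μ)))
          killed = Kills-run i (γ i 1) 0 (suc (N ∸ μ)) (suc μ)
            (≡.subst (λ s → Kills s z) (≡.trans (ℕₚ.+-∸-assoc 1 μ≤N) (≡.sym (ℕₚ.+-identityʳ _))) kz)

      -- The factors 1 - a y_i belong to the rows and the factors 1/(1 - x y_i) to the columns; the
      -- determinant absorbs both, and its rows become the functions `F`.
      pieri : ∀ {μs z} → Shape N n μs → Kills (suc N ∸ firstPart μs) z →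
        z * ((Πrows (α i) 1 μs * Π[ cs ] (g i)) * alternant μs) ~
        z * Σ[ tuples (suc N) n ] (λ ρs → strip (Q i) 1 N μs ρs * alternant ρs)
      pieri {μs} {z} μs↓ kz = ~-trans (≈⇒~ (*-congˡ (begin
        (Πrows (α i) 1 μs * Π[ cs ] (g i)) * alternant μs
          ≈⟨ trans (*-assoc _ _ _) (*-congˡ (sym (E-scaleColumns (g i) (rows shifted n μs) cs))) ⟩
        Πrows (α i) 1 μs * E (map (λ f a → g i a * f a) (rows shifted n μs)) cs
          ≈⟨ E-rows-scale 0 n ≡.refl μs↓ cs ⟨
        E (rows F n μs) cs ∎)))
        (~-trans (kill-head μs↓ kz cs) (≈⇒~ (*-congˡ (E-sumRows 1 n μs↓ cs))))

    -- The last variable y is split off first, since the largest entries form the strip next to μ.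
    -- The weight of that strip joins the multiplier z before the induction hypothesis is applied,
    -- so that the order it supplies is not lost.
    cauchy : ∀ m {μs z} → Shape N n μs → Kills (suc N ∸ firstPart μs) z →
      z * (kernelValue m μs * alternant μs) ~
      z * Σ[ tuples (suc N) n ] (λ νs → alternant νs * chains runWeight N n m μs νs)
    cauchy zero {μs} {z} μs↓ kz = ≈⇒~ (*-congˡ (begin
      (Πrows (λ _ _ → 1#) 1 μs * 1#) * alternant μs
        ≈⟨ one-* _ (trans (*-identityʳ _) (Πrows-one 1 μs)) ⟩
      alternant μs
        ≈⟨ Σ-δ alternant (Shape-All ℕₚ.≤-refl μs↓) (Shape-length μs↓) ⟨
      Σ[ tuples (suc N) n ] (λ νs → δ μs νs * alternant νs)
        ≈⟨ Σ-cong (λ νs → *-comm _ _) (tuples (suc N) n) ⟩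
      Σ[ tuples (suc N) n ] (λ νs → alternant νs * δ μs νs) ∎))
    cauchy (suc m) {μs} {z} μs↓ kz = ~-trans (≈⇒~ (begin
      z * (kernelValue (suc m) μs * alternant μs)
        ≈⟨ *-congˡ (*-congʳ (trans (*-congʳ (Πrows-* (αs m) (α (suc m)) 1 μs)) (*-interchange _ _ _ _))) ⟩
      z * ((kernelValue m μs * (Πrows (α (suc m)) 1 μs * Π[ cs ] (g (suc m)))) * alternant μs)
        ≈⟨ solve 4 (λ z k s a → z :* ((k :* s) :* a) := k :* (z :* (s :* a))) refl z (kernelValue m μs)
             (Πrows (α (suc m)) 1 μs * Π[ cs ] (g (suc m))) (alternant μs) ⟩
      kernelValue m μs * (z * ((Πrows (α (suc m)) 1 μs * Π[ cs ] (g (suc m))) * alternant μs)) ∎))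
      (~-trans (~-*ˡ (kernelValue m μs) (pieri (suc m) μs↓ kz))
      (~-trans (≈⇒~ (trans (sym (*-assoc _ _ _)) (Σ-*ˡ _ _ T)))
      (~-trans (~-Σ (All.map (λ {ρs} → each ρs) (tuples-length (suc N) n)))
      (≈⇒~ (begin
        Σ[ T ] (λ ρs → Σ[ T ] (λ νs → z * (alternant νs * (strip (runWeight (suc m)) 1 N μs ρs * chains runWeight N n m ρs νs))))
          ≈⟨ trans (Σ-swap _ T T) (Σ-cong (λ νs → trans (sym (Σ-*ˡ _ _ T)) (*-congˡ (sym (Σ-*ˡ _ _ T)))) T) ⟩
        Σ[ T ] (λ νs → z * (alternant νs * chains runWeight N n (suc m) μs νs))
          ≈⟨ Σ-*ˡ _ _ T ⟨
        z * Σ[ T ] (λ νs → alternant νs * chains runWeight N n (suc m) μs νs) ∎)))))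
      where
      T = tuples (suc N) n
      G = ∏[ m ] λ i → Π[ cs ] (g i)
      each : ∀ ρs → length ρs ≡ n →
        (kernelValue m μs * z) * (strip (Q (suc m)) 1 N μs ρs * alternant ρs) ~
        Σ[ T ] (λ νs → z * (alternant νs * (strip (runWeight (suc m)) 1 N μs ρs * chains runWeight N n m ρs νs)))
      each ρs eq = ~-trans (≈⇒~ (begin
        ((Πrows (αs m) 1 μs * G) * z) * (strip (Q (suc m)) 1 N μs ρs * alternant ρs)
          ≈⟨ solve 5 (λ p g z s a → ((p :* g) :* z) :* (s :* a) := (z :* (p :* s)) :* (g :* a)) refl
               (Πrows (αs m) 1 μs) G z (strip (Q (suc m)) 1 N μs ρs) (alternant ρs) ⟩
        (z * (Πrows (αs m) 1 μs * strip (Q (suc m)) 1 N μs ρs)) * (G * alternant ρs)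
          ≈⟨ *-congʳ (*-congˡ (strip-gauge (αs m) (runWeight-gauge m) 1 N μs ρs)) ⟨
        (z * (S * Πrows (αs m) 1 ρs)) * (G * alternant ρs)
          ≈⟨ solve 5 (λ z s p g a → (z :* (s :* p)) :* (g :* a) := (z :* s) :* ((p :* g) :* a)) refl
               z S (Πrows (αs m) 1 ρs) G (alternant ρs) ⟩
        (z * S) * (kernelValue m ρs * alternant ρs) ∎))
        (~-trans step (≈⇒~ (trans (Σ-*ˡ _ _ T) (Σ-cong (λ νs →
          solve 4 (λ z s a c → (z :* s) :* (a :* c) := z :* (a :* (s :* c))) refl
               z S (alternant νs) (chains runWeight N n m ρs νs)) T))))
        where
        S = strip (runWeight (suc m)) 1 N μs ρs
        step : (z * S) * (kernelValue m ρs * alternant ρs) ~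
               (z * S) * Σ[ T ] (λ νs → alternant νs * chains runWeight N n m ρs νs)
        step with strip-support (runWeight (suc m)) 1 μs↓ ρs eq
        ... | inj₁ z₁  = ≈⇒~ (trans (zero-* _ (*-zero z z₁)) (sym (zero-* _ (*-zero z z₁))))
        ... | inj₂ ρs↓ = cauchy m ρs↓ (Kills-strip N (suc m) μs↓ ρs eq kz)

-- Dual Schur functions and the recursion in the smallest entry.

module DualFunctions (R : CommutativeRing c ℓ) (x : ℕ → CommutativeRing.Carrier R)
  (h : ℕ → ℕ → CommutativeRing.Carrier R)
  (h-diagonal : Diagonal R h)
  (γ : ℕ → ℕ → ℕ → CommutativeRing.Carrier R)
  (γ-inverse : Inverse R x h γ) where

  open CommutativeRing R hiding (zero)
  open Weights R x h h-diagonal γ γ-inverse using (α; q₁; Q; γ-diagonal; γ-shift)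
  open Strips R
  open SetoidReasoning setoid
  open SemiringSolver commutativeSemiring using (solve; _:+_; _:*_; _:=_)

  -- The value at 0 makes ψ(n+1)/(1 - aₙ x) = ψ(n) hold for n = 0 as well.
  ψ : ℕ → ℕ → Carrier
  ψ zero    i = γ i 0 0
  ψ (suc n) i = ∏[ n ] λ s → α i s 0

  -- Covers both kinds of entries in the determinant of a dual Schur function. The numerators 1 -
  -- a_s x, 1 ≤ s < n, cancel against the denominators with index at least 1. For β < n some
  -- numerators may be left, for β ≥ n the denominators from 1 - a₀ x onwards.
  dual : ℕ → ℕ → ℕ → Carrier
  dual n β i = ψ n i * run (q₁ i n) 1 β

  private
    ψ-suc : ∀ n i → ψ (suc n) i * γ i n 0 ≈ ψ n i
    ψ-suc zero    i = *-identityˡ _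
    ψ-suc (suc n) i = trans (*-assoc _ _ _) (trans (*-congˡ (γ-inverse i (suc n) 0)) (*-identityʳ _))

    run-q₁-rotate : ∀ i n s β → run (q₁ i n) s β * γ i n (s ℕ.+ β) ≈ γ i n s * run (q₁ i n) (suc s) β
    run-q₁-rotate i n s zero    rewrite ℕₚ.+-identityʳ s = *-comm _ _
    run-q₁-rotate i n s (suc β) rewrite ℕₚ.+-suc s β = begin
      (q₁ i n s * run (q₁ i n) (suc s) β) * γ i n (suc (s ℕ.+ β))
        ≈⟨ trans (*-assoc _ _ _) (*-congˡ (run-q₁-rotate i n (suc s) β)) ⟩
      (x i * γ i n s) * (γ i n (suc s) * run (q₁ i n) (suc (suc s)) β)
        ≈⟨ solve 4 (λ x g h r → (x :* g) :* (h :* r) := g :* ((x :* h) :* r)) refl (x i) (γ i n s) (γ i n (suc s)) _ ⟩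
      γ i n s * run (q₁ i n) (suc s) (suc β) ∎

    -- Lowering the level shifts the window of denominators by one. The new denominator at its end
    -- is traded for the one at its start, 1/(1 - a_n x), which `ψ` absorbs.
    dual-level : ∀ n β i → dual (suc n) β i * γ i (suc n) (suc β) ≈ dual n β i
    dual-level n β i = begin
      (ψ (suc n) i * run (q₁ i (suc n)) 1 β) * γ i (suc n) (suc β)
        ≈⟨ trans (*-assoc _ _ _) (*-congˡ (run-q₁-rotate i (suc n) 1 β)) ⟩
      ψ (suc n) i * (γ i (suc n) 1 * run (q₁ i (suc n)) 2 β)
        ≈⟨ *-congˡ (*-cong (γ-diagonal i n 0) (sym (run-shift 1 shift 1 β))) ⟩
      ψ (suc n) i * (γ i n 0 * run (q₁ i n) 1 β)
        ≈⟨ trans (sym (*-assoc _ _ _)) (*-congʳ (ψ-suc n i)) ⟩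
      dual n β i ∎
      where
      shift : ∀ l → q₁ i n l ≈ q₁ i (suc n) (l ℕ.+ 1)
      shift l rewrite ℕₚ.+-comm l 1 = *-congˡ (sym (γ-diagonal i n l))

    -- This is u/(1 - hu) - v/(1 - hv) = (u - v)/((1 - hu)(1 - hv)): over the common denominator the
    -- terms h u v cancel.
    difference : ∀ h u v g g′ → (1# - h * u) * g ≈ 1# → (1# - h * v) * g′ ≈ 1# →
      u * g ≈ v * g′ + (u - v) * (g′ * g)
    difference h u v g g′ e e′ = sym (begin
      v * g′ + (u - v) * (g′ * g)
        ≈⟨ +-cong (expand v g′ u g e) (trans (*-comm _ _) (x[y-z]≈xy-xz _ _ _)) ⟩
      (g′ * g * v - (g′ * g) * (h * u * v)) + (g′ * g * u - g′ * g * v)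
        ≈⟨ solve 4 (λ a b c d → (a :+ b) :+ (c :+ d) := (a :+ d) :+ (c :+ b)) refl _ _ _ _ ⟩
      (g′ * g * v - g′ * g * v) + (g′ * g * u - (g′ * g) * (h * u * v))
        ≈⟨ trans (+-congʳ (-‿inverseʳ _)) (+-identityˡ _) ⟩
      g′ * g * u - (g′ * g) * (h * u * v)
        ≈⟨ neg-cong₂ (*-congʳ (*-comm _ _)) (*-cong (*-comm _ _) (*-exchangeʳ _ _ _)) ⟩
      g * g′ * u - (g * g′) * (h * v * u)
        ≈⟨ expand u g v g′ e′ ⟨
      u * g ∎)
      where
      expand : ∀ v g′ u g → (1# - h * u) * g ≈ 1# → v * g′ ≈ g′ * g * v - (g′ * g) * (h * u * v)
      expand v g′ u g e = begin
        v * g′                          ≈⟨ *-identityʳ _ ⟨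
        (v * g′) * 1#                   ≈⟨ *-congˡ e ⟨
        (v * g′) * ((1# - h * u) * g)
          ≈⟨ solve 4 (λ v g′ d g → (v :* g′) :* (d :* g) := (g′ :* g) :* (v :* d)) refl v g′ (1# - h * u) g ⟩
        (g′ * g) * (v * (1# - h * u))
          ≈⟨ trans (*-congˡ (trans (x[y-z]≈xy-xz _ _ _) (neg-cong₂ (*-identityʳ _) (*-comm _ _)))) (x[y-z]≈xy-xz _ _ _) ⟩
        g′ * g * v - (g′ * g) * (h * u * v) ∎

  -- Only the last factor x/(1 - a x) is differenced; the denominator at x(i) that is left over
  -- lowers the level of the rest.
  dual-step : ∀ n β z i → dual (suc n) (suc β) i ≈
    q₁ z (suc n) (suc β) * dual (suc n) β i + (x i - x z) * (γ z (suc n) (suc β) * dual n β i)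
  dual-step n β z i = begin
    ψ (suc n) i * run (q₁ i (suc n)) 1 (suc β)
      ≈⟨ trans (*-congˡ (run-last (q₁ i (suc n)) 1 β)) (sym (*-assoc _ _ _)) ⟩
    dual (suc n) β i * (x i * g)
      ≈⟨ *-congˡ (difference (h (suc n) (suc β)) (x i) (x z) g g′ (γ-inverse i (suc n) (suc β)) (γ-inverse z (suc n) (suc β))) ⟩
    dual (suc n) β i * (x z * g′ + (x i - x z) * (g′ * g))
      ≈⟨ solve 5 (λ d x g′ w g → d :* (x :* g′ :+ w :* (g′ :* g)) := (x :* g′) :* d :+ w :* (g′ :* (d :* g))) refl
           (dual (suc n) β i) (x z) g′ (x i - x z) g ⟩
    (x z * g′) * dual (suc n) β i + (x i - x z) * (g′ * (dual (suc n) β i * g))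
      ≈⟨ +-congˡ (*-congˡ (*-congˡ (dual-level n β i))) ⟩
    _ ∎
    where
    g = γ i (suc n) (suc β)
    g′ = γ z (suc n) (suc β)

module DualAlternants (R : CommutativeRing c ℓ) (x : ℕ → CommutativeRing.Carrier R)
  (h : ℕ → ℕ → CommutativeRing.Carrier R)
  (h-diagonal : Diagonal R h)
  (γ : ℕ → ℕ → ℕ → CommutativeRing.Carrier R)
  (γ-inverse : Inverse R x h γ)
  (N : ℕ) where

  open CommutativeRing R hiding (zero)
  open Weights R x h h-diagonal γ γ-inverse using (α; q₁; Q; γ-diagonal; γ-shift)
  open Strips R
  open DualFunctions R x h h-diagonal γ γ-inverse
  open SetoidReasoning setoid
  open SemiringSolver commutativeSemiring using (solve; _:+_; _:*_; _:=_)

  private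
    K = suc N

  open Branching R x dual (λ n β z → q₁ z (suc n) (suc β)) (λ n β z → γ z (suc n) (suc β)) dual-step K public

  -- `ι` relabels the variables, and passing to `ι ∘ suc` discards the first of them.
  module _ (ι : ℕ → ℕ) where
    open Weights R (x ∘ ι) h h-diagonal (γ ∘ ι) (γ-inverse ∘ ι) public using () renaming (runWeight to stripWeight; X to X′)

  private
    -- In column l + 1 the first variable enters the weight of a larger entry through (1 - a_{k-l}
    -- x)/(1 - a_{k-l-1} x), a ratio of values at neighbouring columns; along a row these ratios
    -- telescope.
    X-suc : ∀ ι i k l → X′ ι (suc (suc i)) k (suc l) * α (ι 1) k (suc l) ≈ α (ι 1) k l * X′ (ι ∘ suc) (suc i) k (suc l)
    X-suc ι i k l = begin
      (y * ((∏[ suc i ] λ j → α (ι j) k l) * (∏[ suc (suc i) ] λ j → γ (ι j) k (suc l)))) * α (ι 1) k (suc l)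
        ≈⟨ *-congʳ (*-congˡ (*-cong (∏-first _ i) (∏-first _ (suc i)))) ⟩
      (y * ((α (ι 1) k l * A′) * (γ (ι 1) k (suc l) * G))) * α (ι 1) k (suc l)
        ≈⟨ solve 6 (λ y a A g G b → (y :* ((a :* A) :* (g :* G))) :* b := (b :* g) :* (a :* (y :* (A :* G)))) refl
             y (α (ι 1) k l) A′ (γ (ι 1) k (suc l)) G (α (ι 1) k (suc l)) ⟩
      (α (ι 1) k (suc l) * γ (ι 1) k (suc l)) * (α (ι 1) k l * (y * (A′ * G)))
        ≈⟨ one-* _ (γ-inverse (ι 1) k (suc l)) ⟩
      α (ι 1) k l * X′ (ι ∘ suc) (suc i) k (suc l) ∎
      where
      y = x (ι (suc (suc i)))
      A′ = ∏[ i ] λ j → α (ι (suc j)) k l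
      G = ∏[ suc i ] λ j → γ (ι (suc j)) k (suc l)

    stripWeight-suc : ∀ ι i k m r → m ≤ r →
      stripWeight ι (suc (suc i)) k m r * α (ι 1) k r ≈ α (ι 1) k m * stripWeight (ι ∘ suc) (suc i) k m r
    stripWeight-suc ι i k m r m≤r = begin
      run (X′ ι (suc (suc i)) k) (suc m) (r ∸ m) * α (ι 1) k r
        ≡⟨ ≡.cong (λ s → run (X′ ι (suc (suc i)) k) (suc m) (r ∸ m) * α (ι 1) k s) (≡.sym (ℕₚ.m+[n∸m]≡n m≤r)) ⟩
      run (X′ ι (suc (suc i)) k) (suc m) (r ∸ m) * α (ι 1) k (m ℕ.+ (r ∸ m))
        ≈⟨ telescope m (r ∸ m) ⟩
      α (ι 1) k m * stripWeight (ι ∘ suc) (suc i) k m r ∎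
      where
      telescope : ∀ m d → run (X′ ι (suc (suc i)) k) (suc m) d * α (ι 1) k (m ℕ.+ d) ≈
                          α (ι 1) k m * run (X′ (ι ∘ suc) (suc i) k) (suc m) d
      telescope m zero rewrite ℕₚ.+-identityʳ m = *-comm _ _
      telescope m (suc d) rewrite ℕₚ.+-suc m d = begin
        (X′ ι (suc (suc i)) k (suc m) * T) * α (ι 1) k (suc (m ℕ.+ d))
          ≈⟨ trans (*-assoc _ _ _) (*-congˡ (telescope (suc m) d)) ⟩
        X′ ι (suc (suc i)) k (suc m) * (α (ι 1) k (suc m) * S)
          ≈⟨ trans (sym (*-assoc _ _ _)) (trans (*-congʳ (X-suc ι i k m)) (*-assoc _ _ _)) ⟩
        α (ι 1) k m * (X′ (ι ∘ suc) (suc i) k (suc m) * S) ∎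
        where
        T = run (X′ ι (suc (suc i)) k) (suc (suc m)) d
        S = run (X′ (ι ∘ suc) (suc i) k) (suc (suc m)) d

    δ-transport : ∀ (a : ℕ → ℕ → Carrier) k ms ns → δ ms ns * Πrows a k ns ≈ Πrows a k ms * δ ms ns
    δ-transport a k []       []       = refl
    δ-transport a k []       (_ ∷ _)  = trans (zeroˡ _) (sym (zeroʳ _))
    δ-transport a k (_ ∷ _)  []       = trans (zeroˡ _) (sym (zeroʳ _))
    δ-transport a k (m ∷ ms) (n ∷ ns) = begin
      (I * δ ms ns) * (a k n * Πrows a (suc k) ns)
        ≈⟨ *-interchange _ _ _ _ ⟩
      (I * a k n) * (δ ms ns * Πrows a (suc k) ns)
        ≈⟨ *-cong head (δ-transport a (suc k) ms ns) ⟩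
      (a k m * I) * (Πrows a (suc k) ms * δ ms ns)
        ≈⟨ *-interchange _ _ _ _ ⟩
      Πrows a k (m ∷ ms) * (I * δ ms ns) ∎
      where
      I = ⟦ m ≤ n ⟧ * ⟦ n ≤ m ⟧
      head : I * a k n ≈ a k m * I
      head with ⟦≤⟧-split m n | ⟦≤⟧-split n m
      ... | inj₂ (_ , e)   | _              = trans (zero-* _ (zero-* _ e)) (sym (*-zero _ (zero-* _ e)))
      ... | inj₁ _         | inj₂ (_ , e)   = trans (zero-* _ (*-zero _ e)) (sym (*-zero _ (*-zero _ e)))
      ... | inj₁ (m≤n , _) | inj₁ (n≤m , _) rewrite ℕₚ.≤-antisym m≤n n≤m = *-comm _ _

    -- The strips here hold the entries from 2 on, whose weights still contain the first variable.
    -- The gauge factor removes it and leaves the chain sum in the other variables.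
    chains-gauge : ∀ ι n m μs νs →
      chains (stripWeight ι ∘ suc) N n m μs νs * Πrows (α (ι 1)) 1 νs ≈
      Πrows (α (ι 1)) 1 μs * chains (stripWeight (ι ∘ suc)) N n m μs νs
    chains-gauge ι n zero    μs νs = δ-transport (α (ι 1)) 1 μs νs
    chains-gauge ι n (suc m) μs νs = begin
      Σ[ T ] (λ ρs → S ρs * C ρs) * Πrows (α (ι 1)) 1 νs
        ≈⟨ trans (Σ-*ʳ _ _ T) (Σ-cong (λ ρs → trans (*-assoc _ _ _) (*-congˡ (chains-gauge ι n m ρs νs))) T) ⟩
      Σ[ T ] (λ ρs → S ρs * (Πrows (α (ι 1)) 1 ρs * C′ ρs))
        ≈⟨ Σ-cong (λ ρs → trans (sym (*-assoc _ _ _)) (trans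
             (*-congʳ (strip-gauge (α (ι 1)) (stripWeight-suc ι m) 1 N μs ρs)) (*-assoc _ _ _))) T ⟩
      Σ[ T ] (λ ρs → Πrows (α (ι 1)) 1 μs * (strip (stripWeight (ι ∘ suc) (suc m)) 1 N μs ρs * C′ ρs))
        ≈⟨ Σ-*ˡ _ _ T ⟨
      Πrows (α (ι 1)) 1 μs * chains (stripWeight (ι ∘ suc)) N n (suc m) μs νs ∎
      where
      T = tuples K n
      S C C′ : List ℕ → Carrier
      S ρs = strip (stripWeight ι (suc (suc m))) 1 N μs ρs
      C ρs = chains (stripWeight ι ∘ suc) N n m ρs νs
      C′ ρs = chains (stripWeight (ι ∘ suc)) N n m ρs νs

  atMost : ℕ → List ℕ → Carrier
  atMost zero    []       = 1#
  atMost zero    (l ∷ ls) = ⟦ l ≤ 0 ⟧ * atMost zero ls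
  atMost (suc m) []       = 1#
  atMost (suc m) (l ∷ ls) = atMost m ls

  private
    zeros : ℕ → List ℕ
    zeros n = replicate n 0

    δ-zeros : ∀ ls → δ (zeros (length ls)) ls ≈ atMost 0 ls
    δ-zeros []       = refl
    δ-zeros (l ∷ ls) = *-cong (*-identityˡ _) (δ-zeros ls)

    strip-zeros : ∀ W k → (∀ k m → W k m m ≈ 1#) → ∀ ls → strip W k 0 (zeros (length ls)) ls ≈ atMost 0 ls
    strip-zeros W k e []       = refl
    strip-zeros W k e (l ∷ ls) = *-cong (head l) (strip-zeros W (suc k) e ls)
      where
      head : ∀ l → (1# * ⟦ l ≤ 0 ⟧) * W k 0 l ≈ ⟦ l ≤ 0 ⟧
      head zero    = trans (*-cong (*-identityˡ _) (e k 0)) (*-identityˡ _)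
      head (suc _) = zero-* _ (zeroʳ _)

    Πrows-inverse : ∀ z k ls → Πrows (α z) k ls * Πrows (γ z) k ls ≈ 1#
    Πrows-inverse z k []       = *-identityˡ _
    Πrows-inverse z k (l ∷ ls) = trans (*-interchange _ _ _ _)
      (trans (*-cong (γ-inverse z k l) (Πrows-inverse z (suc k) ls)) (*-identityˡ _))

    -- Removal of the entries 1 when M + 1 variables are present. `z` is the first of them, and `W`
    -- is its strip weight, which has no factors from smaller variables.
    module _ (z M : ℕ) (W : ℕ → ℕ → ℕ → Carrier) (W≈Q : ∀ k m r → W k m r ≈ Q z k m r) where

      W-diagonal : ∀ k m → W k m m ≈ 1#
      W-diagonal k m = trans (W≈Q k m m) (reflexive (≡.cong (run (q₁ z k) (suc m)) (ℕₚ.n∸n≡0 m)))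

      -- A diagonal shift by t takes the indices (k, r) of a box to the level and exponent in the
      -- divided difference. The additional `γ` is the gauge factor that the intermediate shape
      -- owes.
      term-γ : ∀ k t l r → k ℕ.+ t ≡ M → term M z t l r ≈ γ z k r * W k r l
      term-γ k t l r ≡.refl = *-cong (trans (γ-diagonal z _ _) (γ-shift z k r t))
        (trans (sym (run-shift t (λ s → *-congˡ (sym (trans (γ-diagonal z _ _) (γ-shift z k s t)))) (suc r) (l ∸ r)))
          (sym (W≈Q k r l)))

      -- The gauge factors of the empty inner shape in the upper rows, times the weight of the whole
      -- bottom row. Together they turn out to be the function `dual` of the last row at z, the
      -- gauge factors giving `ψ`.
      lastFactor : ℕ → ℕ → ℕ → Carrier
      lastFactor k zero    l = W k 0 l
      lastFactor k (suc m) l = α z k 0 * lastFactor (suc k) m l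

      -- Summing over the shapes ρ with at most m rows, k being the index of
      -- the first row.
      branch : ∀ k m n b ls → k ℕ.+ m ≡ suc M → suc m ≤ n → length ls ≡ n → ∀ (F : List ℕ → Carrier) →
        Σ[ tuples K n ] (λ ρs → (atMost m ρs * F (take m ρs)) *
          (Πrows (α z) k (zeros n) * (Πrows (γ z) k ρs * strip W k b ρs ls))) ≈
        (⟦ firstPart ls ≤ b ⟧ * atMost (suc m) ls) *
        (lastFactor k m (lastPart (take (suc m) ls)) * Σ[ tuples K m ] (λ ρs → coef M z m (take (suc m) ls) ρs * F ρs))
      branch k zero n b (l ∷ ls) eq _ ≡.refl F = begin
        Σ[ tuples K n ] (λ ρs → (atMost 0 ρs * F []) * (A₀ * (Πrows (γ z) k ρs * strip W k b ρs (l ∷ ls))))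
          -- With m = 0 the inner shape is empty and the sum has a single term, in which the strip
          -- is the one row `l` and everything below it must be zero.
          ≈⟨ Σ-cong-All (All.map (λ {ρs} len → trans (*-assoc _ _ _) (*-congʳ
               (trans (sym (δ-zeros ρs)) (reflexive (≡.cong (λ s → δ (zeros s) ρs) len))))) (tuples-length K n)) ⟩
        Σ[ tuples K n ] (λ ρs → δ (zeros n) ρs * (F [] * (A₀ * (Πrows (γ z) k ρs * strip W k b ρs (l ∷ ls)))))
          ≈⟨ Σ-δ {K} {n} {zeros n} (λ ρs → F [] * (A₀ * (Πrows (γ z) k ρs * strip W k b ρs (l ∷ ls))))
               (AllProperties.replicate⁺ n (s≤s z≤n)) (Listₚ.length-replicate n) ⟩
        F [] * (A₀ * (Πrows (γ z) k (zeros n) * strip W k b (zeros n) (l ∷ ls)))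
          ≈⟨ *-congˡ (trans (sym (*-assoc _ _ _)) (one-* _ (Πrows-inverse z k (zeros n)))) ⟩
        F [] * (((1# * ⟦ l ≤ b ⟧) * W k 0 l) * strip W (suc k) 0 (zeros (length ls)) ls)
          ≈⟨ *-congˡ (*-cong (*-congʳ (*-identityˡ _)) (strip-zeros W (suc k) W-diagonal ls)) ⟩
        F [] * ((⟦ l ≤ b ⟧ * W k 0 l) * atMost 0 ls)
          ≈⟨ solve 4 (λ f i w a → f :* ((i :* w) :* a) := (i :* a) :* (w :* f)) refl (F []) ⟦ l ≤ b ⟧ (W k 0 l) (atMost 0 ls) ⟩
        (⟦ l ≤ b ⟧ * atMost 0 ls) * (W k 0 l * F [])
          ≈⟨ *-congˡ (*-congˡ (sym (trans (Σ-tuples-zero K (λ ρs → 1# * F ρs)) (*-identityˡ _)))) ⟩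
        (⟦ l ≤ b ⟧ * atMost 0 ls) * (W k 0 l * Σ[ tuples K 0 ] (λ ρs → 1# * F ρs)) ∎
        where A₀ = Πrows (α z) k (zeros n)
      branch k (suc m) (suc n) b (l ∷ l′ ∷ ls) eq (s≤s m<n) len F = begin
        _
          ≈⟨ Σ-tuples-suc K n _ ⟩
        Σ[ upTo K ] (λ r → Σ[ tuples K n ] (λ ρs → (atMost m ρs * F (r ∷ take m ρs)) *
          ((α z k 0 * A₀) * ((γ z k r * Πrows (γ z) (suc k) ρs) * (((⟦ r ≤ l ⟧ * ⟦ l ≤ b ⟧) * W k r l) * strip W (suc k) r ρs (l′ ∷ ls))))))
          -- The factor `γ z k r` joins the row weight to form `term`, while `α z k 0` is left for
          -- `lastFactor`.
          ≈⟨ Σ-cong (λ r → trans (trans (Σ-cong (λ ρs →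
               solve 9 (λ f a A g G i j w s → f :* ((a :* A) :* ((g :* G) :* (((i :* j) :* w) :* s))) :=
                   ((a :* j) :* (i :* (g :* w))) :* (f :* (A :* (G :* s)))) refl
                 (atMost m ρs * F (r ∷ take m ρs)) (α z k 0) A₀ (γ z k r) (Πrows (γ z) (suc k) ρs)
                 ⟦ r ≤ l ⟧ ⟦ l ≤ b ⟧ (W k r l) (strip W (suc k) r ρs (l′ ∷ ls))) (tuples K n))
               (sym (Σ-*ˡ _ _ (tuples K n))))
               (*-cong (*-congˡ (*-congˡ (sym (term-γ k m l r index))))
                 (branch (suc k) m n r (l′ ∷ ls) (≡.trans (≡.sym (ℕₚ.+-suc k m)) eq) m<n (ℕₚ.suc-injective len) (F ∘ (r ∷_))))) (upTo K) ⟩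
        Σ[ upTo K ] (λ r → ((α z k 0 * ⟦ l ≤ b ⟧) * (⟦ r ≤ l ⟧ * term M z m l r)) *
          ((⟦ l′ ≤ r ⟧ * a) * (L * Σ[ tuples K m ] (λ ρs → coef M z m (l′ ∷ take m ls) ρs * F (r ∷ ρs)))))
          ≈⟨ Σ-cong (λ r → trans (solve 8 (λ α j i t i′ a L S →
                 ((α :* j) :* (i :* t)) :* ((i′ :* a) :* (L :* S)) := ((j :* a) :* (α :* L)) :* (((i′ :* i) :* t) :* S)) refl
               (α z k 0) ⟦ l ≤ b ⟧ ⟦ r ≤ l ⟧ (term M z m l r) ⟦ l′ ≤ r ⟧ a L _)
             (*-congˡ (trans (Σ-*ˡ _ _ (tuples K m)) (Σ-cong (λ ρs → sym (*-assoc _ _ _)) (tuples K m))))) (upTo K) ⟩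
        Σ[ upTo K ] (λ r → ((⟦ l ≤ b ⟧ * a) * (α z k 0 * L)) *
          Σ[ tuples K m ] (λ ρs → coef M z (suc m) (l ∷ l′ ∷ take m ls) (r ∷ ρs) * F (r ∷ ρs)))
          ≈⟨ trans (sym (Σ-*ˡ _ _ (upTo K))) (trans (*-assoc _ _ _) (*-congˡ (*-congˡ
               (sym (Σ-tuples-suc K m (λ ρs → coef M z (suc m) (l ∷ l′ ∷ take m ls) ρs * F ρs)))))) ⟩
        (⟦ l ≤ b ⟧ * a) * ((α z k 0 * L) *
          Σ[ tuples K (suc m) ] (λ ρs → coef M z (suc m) (l ∷ l′ ∷ take m ls) ρs * F ρs)) ∎
        where
        A₀ = Πrows (α z) (suc k) (zeros n)
        a = atMost (suc m) (l′ ∷ ls)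
        L = lastFactor (suc k) m (lastPart (l′ ∷ take m ls))
        index : k ℕ.+ m ≡ M
        index = ℕₚ.suc-injective (≡.trans (≡.sym (ℕₚ.+-suc k m)) eq)
      branch k (suc m) (suc n) b (l ∷ []) eq (s≤s ()) ≡.refl F

      lastFactor-∏ : ∀ k m l → lastFactor (suc k) m l ≈ (∏[ m ] λ s → α z (k ℕ.+ s) 0) * W (suc (k ℕ.+ m)) 0 l
      lastFactor-∏ k zero    l rewrite ℕₚ.+-identityʳ k = sym (*-identityˡ _)
      lastFactor-∏ k (suc m) l = begin
        α z (suc k) 0 * lastFactor (suc (suc k)) m l
          ≈⟨ *-congˡ (lastFactor-∏ (suc k) m l) ⟩
        α z (suc k) 0 * ((∏[ m ] λ s → α z (suc k ℕ.+ s) 0) * W (suc (suc k ℕ.+ m)) 0 l)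
          ≈⟨ *-assoc _ _ _ ⟨
        (α z (suc k) 0 * (∏[ m ] λ s → α z (suc k ℕ.+ s) 0)) * W (suc (suc k ℕ.+ m)) 0 l
          ≈⟨ *-cong (trans (*-cong (reflexive (≡.cong (λ s → α z s 0) (ℕₚ.+-comm 1 k)))
                 (∏-cong (λ s → reflexive (≡.cong (λ s → α z s 0) (≡.sym (ℕₚ.+-suc k s)))) m))
               (sym (∏-first (λ s → α z (k ℕ.+ s) 0) m)))
               (reflexive (≡.cong (λ s → W (suc s) 0 l) (≡.sym (ℕₚ.+-suc k m)))) ⟩
        (∏[ suc m ] λ s → α z (k ℕ.+ s) 0) * W (suc (k ℕ.+ suc m)) 0 l ∎

      lastFactor-dual : ∀ l → lastFactor 1 M l ≈ dual (suc M) l z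
      lastFactor-dual l = trans (lastFactor-∏ 0 M l) (*-congˡ (W≈Q (suc M) 0 l))

  -- Removing the entries 1 gives the recursion that defines `D`. The number n of rows may exceed
  -- the number m of variables, so that the vanishing of tableau sums for shapes with too many rows
  -- is included.
  dual-chains : ∀ m n ι ls → m ≤ n → length ls ≡ n → All (_< K) ls →
    chains (stripWeight ι) N n m (replicate n 0) ls ≈ atMost m ls * D m (ι ∘ suc) (take m ls)
  dual-chains zero    n ι ls _ ≡.refl _ = trans (δ-zeros ls) (sym (*-identityʳ _))
  dual-chains (suc m) n ι ls m<n len ls< = begin
    chains (stripWeight ι) N n (suc m) (zeros n) ls
      ≈⟨ chains-suc (stripWeight ι) N n m (AllProperties.replicate⁺ n (s≤s z≤n)) (Listₚ.length-replicate n) ls< len ⟩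
    Σ[ T ] (λ ρs → chains (stripWeight ι ∘ suc) N n m (zeros n) ρs * S ρs)
      ≈⟨ Σ-cong-All (All.zipWith (λ {ρs} (l , l′) → each ρs l l′) (tuples-length K n , tuples-All K n)) ⟩
    Σ[ T ] (λ ρs → (atMost m ρs * F (take m ρs)) * (Πrows (α z) 1 (zeros n) * (Πrows (γ z) 1 ρs * S ρs)))
      ≈⟨ branch z m (stripWeight ι 1) W≈Q 1 m n N ls ≡.refl m<n len F ⟩
    (⟦ firstPart ls ≤ N ⟧ * atMost (suc m) ls) *
      (lastFactor z m (stripWeight ι 1) W≈Q 1 m (lastPart (take (suc m) ls)) * Σ[ tuples K m ] (λ ρs → coef m z m (take (suc m) ls) ρs * F ρs))
      ≈⟨ *-cong (one-* _ (first≤ ls m<n len ls<)) (*-congʳ (lastFactor-dual z m (stripWeight ι 1) W≈Q (lastPart (take (suc m) ls)))) ⟩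
    atMost (suc m) ls * D (suc m) (ι ∘ suc) (take (suc m) ls) ∎
    where
    T = tuples K n
    z = ι 1
    F : List ℕ → Carrier
    F = D m (ι ∘ suc ∘ suc)
    S : List ℕ → Carrier
    S ρs = strip (stripWeight ι 1) 1 N ρs ls
    W≈Q : ∀ k μ r → stripWeight ι 1 k μ r ≈ Q z k μ r
    W≈Q k μ r = run-cong (λ l → *-congˡ (trans (*-identityˡ _) (*-identityˡ _))) (suc μ) (r ∸ μ)
    first≤ : ∀ ls → suc m ≤ n → length ls ≡ n → All (_< K) ls → ⟦ firstPart ls ≤ N ⟧ ≈ 1#
    first≤ []       _ _ _        = refl
    first≤ (l ∷ ls) _ _ (l< ∷ _) = ⟦≤⟧-one (s≤s⁻¹ l<)
    each : ∀ ρs → length ρs ≡ n → All (_< K) ρs →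
      chains (stripWeight ι ∘ suc) N n m (zeros n) ρs * S ρs ≈
      (atMost m ρs * F (take m ρs)) * (Πrows (α z) 1 (zeros n) * (Πrows (γ z) 1 ρs * S ρs))
    each ρs l l′ = begin
      C * S ρs
        -- A product of inverse gauge factors is inserted, because `chains-gauge` applies only in
        -- the presence of the factor of its outer shape.
        ≈⟨ *-congʳ (trans (*-congˡ (Πrows-inverse z 1 ρs)) (*-identityʳ _)) ⟨
      (C * (Πrows (α z) 1 ρs * Πrows (γ z) 1 ρs)) * S ρs
        ≈⟨ *-congʳ (trans (sym (*-assoc _ _ _)) (*-congʳ (trans (chains-gauge ι n m (zeros n) ρs)
             (*-congˡ (dual-chains m n (ι ∘ suc) ρs (ℕₚ.<⇒≤ m<n) l l′))))) ⟩
      ((Πrows (α z) 1 (zeros n) * (atMost m ρs * F (take m ρs))) * Πrows (γ z) 1 ρs) * S ρs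
        ≈⟨ solve 4 (λ a b c d → ((a :* b) :* c) :* d := b :* (a :* (c :* d))) refl
             (Πrows (α z) 1 (zeros n)) (atMost m ρs * F (take m ρs)) (Πrows (γ z) 1 ρs) (S ρs) ⟩
      _ ∎
      where C = chains (stripWeight ι ∘ suc) N n m (zeros n) ρs

-- Fillings, and the tableau conditions row by row.

countFrom : ℕ → ℕ → List ℕ
countFrom k zero    = []
countFrom k (suc n) = k ∷ countFrom (suc k) n

applyUpTo-countFrom : ∀ (f : ℕ → ℕ) k n → (∀ i → f i ≡ k ℕ.+ i) → applyUpTo f n ≡ countFrom k n
applyUpTo-countFrom f k zero    e = ≡.refl
applyUpTo-countFrom f k (suc n) e = ≡.cong₂ _∷_ (≡.trans (e 0) (ℕₚ.+-identityʳ k))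
  (applyUpTo-countFrom (f ∘ suc) (suc k) n (λ i → ≡.trans (e (suc i)) (ℕₚ.+-suc k i)))

oneTo≡applyUpTo : ∀ n → oneTo n ≡ applyUpTo suc n
oneTo≡applyUpTo n = Listₚ.map-applyUpTo id suc n

oneTo≡countFrom : ∀ n → oneTo n ≡ countFrom 1 n
oneTo≡countFrom n = ≡.trans (oneTo≡applyUpTo n) (applyUpTo-countFrom suc 1 n (λ _ → ≡.refl))

∈-oneTo : ∀ {k} n → k ∈ oneTo n → 1 ≤ k × k ≤ n
∈-oneTo n k∈ with ∈-map⁻ suc k∈
... | _ , j∈ , ≡.refl = s≤s z≤n , ∈-upTo⁻ j∈

map-nth-∷ : ∀ {A : Set} (d : A) x xs k n →
  map (nth d (x ∷ xs)) (countFrom (suc (suc k)) n) ≡ map (nth d xs) (countFrom (suc k) n)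
map-nth-∷ d x xs k zero    = ≡.refl
map-nth-∷ d x xs k (suc n) = ≡.cong (nth d xs (suc k) ∷_) (map-nth-∷ d x xs (suc k) n)

map-nth : ∀ {A : Set} (d : A) xs → map (nth d xs) (countFrom 1 (length xs)) ≡ xs
map-nth d []       = ≡.refl
map-nth d (x ∷ xs) = ≡.cong (x ∷_) (≡.trans (map-nth-∷ d x xs 0 (length xs)) (map-nth d xs))

nth-drop : ∀ {A : Set} (d : A) n xs l → nth d (drop n xs) (suc l) ≡ nth d xs (suc (n ℕ.+ l))
nth-drop d zero    xs       l = ≡.refl
nth-drop d (suc n) []       l = ≡.refl
nth-drop d (suc n) (x ∷ xs) l = nth-drop d n xs l

nth-decreasing : ∀ {xs} → Linked _≥_ xs → ∀ k → nth 0 xs (suc (suc k)) ≤ nth 0 xs (suc k)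
nth-decreasing []        k       = z≤n
nth-decreasing [-]       k       = z≤n
nth-decreasing (x≥y ∷ l) zero    = x≥y
nth-decreasing (x≥y ∷ l) (suc k) = nth-decreasing l k

nth-beyond : ∀ xs k → length xs < k → nth 0 xs k ≡ 0
nth-beyond []       (suc k)       _       = ≡.refl
nth-beyond (x ∷ xs) (suc (suc k)) (s≤s l) = nth-beyond xs (suc k) l

part-decreasing : ∀ μ {k} → 1 ≤ k → part μ (suc k) ≤ part μ k
part-decreasing μ {suc k} _ = nth-decreasing (decreasing μ) k

part-beyond : ∀ μ {k} → len μ < k → part μ k ≡ 0
part-beyond μ {k} = nth-beyond (parts μ) k

Bounded : ℕ → List ℕ → Set
Bounded b []       = ⊤
Bounded b (i ∷ is) = i ≤ b × Bounded i is

Above : List ℕ → List ℕ → Set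
Above []       _        = ⊤
Above (_ ∷ _)  []       = ⊤
Above (i ∷ is) (j ∷ js) = j < i × Above is js

Bounded⇒nth : ∀ {b} is → Bounded b is → ∀ l → suc (suc l) ≤ length is → nth 0 is (suc (suc l)) ≤ nth 0 is (suc l)
Bounded⇒nth (i ∷ [])      _                 l       (s≤s ())
Bounded⇒nth (i ∷ j ∷ is) (_ , j≤i , _)      zero    _       = j≤i
Bounded⇒nth (i ∷ j ∷ is) (_ , b)            (suc l) (s≤s l<) = Bounded⇒nth (j ∷ is) b l l<

nth⇒Bounded : ∀ {b} is → nth 0 is 1 ≤ b →
  (∀ l → suc (suc l) ≤ length is → nth 0 is (suc (suc l)) ≤ nth 0 is (suc l)) → Bounded b is
nth⇒Bounded []           i≤ f = tt
nth⇒Bounded (i ∷ [])     i≤ f = i≤ , tt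
nth⇒Bounded (i ∷ j ∷ is) i≤ f = i≤ , nth⇒Bounded (j ∷ is) (f 0 (s≤s (s≤s z≤n))) (λ l l< → f (suc l) (s≤s l<))

Above⇒nth : ∀ is js → Above is js → ∀ l → suc l ≤ length is → suc l ≤ length js → nth 0 js (suc l) < nth 0 is (suc l)
Above⇒nth (i ∷ is) (j ∷ js) (j<i , _) zero    _        _        = j<i
Above⇒nth (i ∷ is) (j ∷ js) (_ , a)   (suc l) (s≤s l<) (s≤s l<′) = Above⇒nth is js a l l< l<′

nth⇒Above : ∀ is js → (∀ l → suc l ≤ length is → suc l ≤ length js → nth 0 js (suc l) < nth 0 is (suc l)) → Above is js
nth⇒Above []       js       f = tt
nth⇒Above (i ∷ is) []       f = tt
nth⇒Above (i ∷ is) (j ∷ js) f = f 0 (s≤s z≤n) (s≤s z≤n) , nth⇒Above is js (λ l l< l<′ → f (suc l) (s≤s l<) (s≤s l<′))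

-- The tableau condition in the form that `tableauSum` follows. The row above starts in column b + 1
-- and this one in column μ k + 1, so its first `b ∸ μ k` entries have nothing above them.
RowsReverse : (ℕ → ℕ) → ℕ → ℕ → ℕ → List ℕ → Filling → Set
RowsReverse μ m k b is []      = ⊤
RowsReverse μ m k b is (r ∷ T) = (Bounded m r × Above is (drop (b ∸ μ k) r)) × RowsReverse μ m (suc k) (μ k) r T

rowsReverse⁺ : ∀ μ m (row : ℕ → List ℕ) k n {b is} →
  (∀ j → k ≤ j → j < k ℕ.+ n → Bounded m (row j)) →
  Above is (drop (b ∸ μ k) (row k)) →
  (∀ j → k ≤ j → suc j < k ℕ.+ n → Above (row j) (drop (μ j ∸ μ (suc j)) (row (suc j)))) →
  RowsReverse μ m k b is (map row (countFrom k n))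
rowsReverse⁺ μ m row k zero          B a A = tt
rowsReverse⁺ μ m row k (suc zero)    B a A = (B k ℕₚ.≤-refl (ℕₚ.m<m+n k (s≤s z≤n)) , a) , tt
rowsReverse⁺ μ m row k (suc (suc n)) B a A = (B k ℕₚ.≤-refl (ℕₚ.m<m+n k (s≤s z≤n)) , a) ,
  rowsReverse⁺ μ m row (suc k) (suc n)
    (λ j k<j j< → B j (ℕₚ.<⇒≤ k<j) (≡.subst (j <_) (≡.sym (ℕₚ.+-suc k (suc n))) j<))
    (A k ℕₚ.≤-refl (≡.subst (suc k <_) (≡.sym (ℕₚ.+-suc k (suc n))) (s≤s (ℕₚ.m<m+n k (s≤s z≤n)))))
    (λ j k<j j< → A j (ℕₚ.<⇒≤ k<j) (≡.subst (suc j <_) (≡.sym (ℕₚ.+-suc k (suc n))) j<))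

rowsReverse⁻ : ∀ μ m (row : ℕ → List ℕ) k n {b is} → RowsReverse μ m k b is (map row (countFrom k n)) →
  (∀ j → k ≤ j → j < k ℕ.+ n → Bounded m (row j)) ×
  (∀ j → k ≤ j → suc j < k ℕ.+ n → Above (row j) (drop (μ j ∸ μ (suc j)) (row (suc j))))
rowsReverse⁻ μ m row k zero    _ = (λ j k≤j j< → contradiction (≡.subst (j <_) (ℕₚ.+-identityʳ k) j<) (ℕₚ.≤⇒≯ k≤j)) ,
  (λ j k≤j j< → contradiction (ℕₚ.<⇒≤ (≡.subst (suc j <_) (ℕₚ.+-identityʳ k) j<)) (ℕₚ.≤⇒≯ k≤j))
rowsReverse⁻ μ m row k (suc n) {b} {is} ((B , _) , rest) = bounded , above n rest (proj₂ rest⁻)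
  where
  rest⁻ = rowsReverse⁻ μ m row (suc k) n rest
  bounded : ∀ j → k ≤ j → j < k ℕ.+ suc n → Bounded m (row j)
  bounded j k≤j j< with ℕₚ.m≤n⇒m<n∨m≡n k≤j
  ... | inj₂ ≡.refl = B
  ... | inj₁ k<j    = proj₁ rest⁻ j k<j (≡.subst (j <_) (ℕₚ.+-suc k n) j<)
  above : ∀ n → RowsReverse μ m (suc k) (μ k) (row k) (map row (countFrom (suc k) n)) →
    (∀ j → suc k ≤ j → suc j < suc k ℕ.+ n → Above (row j) (drop (μ j ∸ μ (suc j)) (row (suc j)))) →
    ∀ j → k ≤ j → suc j < k ℕ.+ suc n → Above (row j) (drop (μ j ∸ μ (suc j)) (row (suc j)))
  above zero    _ _ j k≤j j< = contradiction (s≤s⁻¹ (≡.subst (suc j <_) (≡.trans (ℕₚ.+-suc k 0) (≡.cong suc (ℕₚ.+-identityʳ k))) j<)) (ℕₚ.≤⇒≯ k≤j)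
  above (suc n) ((_ , a) , _) ih j k≤j j< with ℕₚ.m≤n⇒m<n∨m≡n k≤j
  ... | inj₂ ≡.refl = a
  ... | inj₁ k<j    = ih j k<j (≡.subst (suc j <_) (ℕₚ.+-suc k (suc n)) j<)

module _ {P : Box → Set p} (ν μ : Partition) where

  boxes-All⁺ : (∀ k → 1 ≤ k → k ≤ len ν → ∀ j → 1 ≤ j → j ≤ part ν k ∸ part μ k → P (k , part μ k ℕ.+ j)) → All P (boxes ν μ)
  boxes-All⁺ f = AllProperties.concat⁺ (AllProperties.map⁺ (All.tabulate (λ {k} k∈ →
    AllProperties.map⁺ (All.tabulate (λ {j} j∈ →
      f k (proj₁ (∈-oneTo _ k∈)) (proj₂ (∈-oneTo _ k∈)) j (proj₁ (∈-oneTo _ j∈)) (proj₂ (∈-oneTo _ j∈)))))))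

  boxes-All⁻ : All P (boxes ν μ) → ∀ k → 1 ≤ k → k ≤ len ν → ∀ j → 1 ≤ j → j ≤ part ν k ∸ part μ k → P (k , part μ k ℕ.+ j)
  boxes-All⁻ ps k 1≤k k≤ j 1≤j j≤ = All.lookup ps (∈-concat⁺′ (∈-map⁺ (λ l → k , part μ k ℕ.+ l) (∈-oneTo⁺ 1≤j j≤))
    (∈-map⁺ (λ k → map (λ l → k , part μ k ℕ.+ l) (oneTo (part ν k ∸ part μ k))) (∈-oneTo⁺ 1≤k k≤)))
    where
    ∈-oneTo⁺ : ∀ {k n} → 1 ≤ k → k ≤ n → k ∈ oneTo n
    ∈-oneTo⁺ {suc k} _ k< = ∈-map⁺ suc (∈-upTo⁺ k<)

Fits : Partition → Partition → ℕ → Filling → Set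
Fits ν μ m T = length T ≡ len ν ×
  (∀ k → 1 ≤ k → k ≤ len ν → length (nth [] T k) ≡ part ν k ∸ part μ k × All (_≤ m) (nth [] T k))

module _ (ν μ : Partition) (m : ℕ) {T : Filling} (fits : Fits ν μ m T) where

  private
    row : ℕ → List ℕ
    row = nth [] T

    T≡ : map row (countFrom 1 (len ν)) ≡ T
    T≡ = ≡.trans (≡.cong (λ n → map row (countFrom 1 n)) (≡.sym (proj₁ fits))) (map-nth [] T)

    entry-row : ∀ k j → entry μ T (k , part μ k ℕ.+ j) ≡ nth 0 (row k) j
    entry-row k j = ≡.cong (nth 0 (row k)) (ℕₚ.m+n∸m≡n (part μ k) j)

    entry-row-suc : ∀ k j → entry μ T (k , suc (part μ k ℕ.+ j)) ≡ nth 0 (row k) (suc j)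
    entry-row-suc k j = ≡.trans (≡.cong (λ l → entry μ T (k , l)) (≡.sym (ℕₚ.+-suc (part μ k) j))) (entry-row k (suc j))

    length-row : ∀ {k} → 1 ≤ k → k ≤ len ν → length (row k) ≡ part ν k ∸ part μ k
    length-row 1≤k k≤ = proj₁ (proj₂ fits _ 1≤k k≤)

    -- The subtraction is truncated; n ≥ 1 guarantees that o exceeds m.
    below : ∀ {m n o} → n ≤ o ∸ m → 1 ≤ n → m ℕ.+ n ≤ o
    below {m} {n} {o} l 1≤n = ≡.subst (m ℕ.+ n ≤_) (ℕₚ.m+[n∸m]≡n (ℕₚ.<⇒≤ (ℕₚ.m∸n≢0⇒n<m {o} {m} λ e → contradiction (≡.subst (n ≤_) e l) (ℕₚ.<⇒≱ 1≤n))))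
      (ℕₚ.+-monoʳ-≤ m l)

    column : ∀ k j → 1 ≤ k → part μ k ∸ part μ (suc k) ℕ.+ j ≡ (part μ k ℕ.+ j) ∸ part μ (suc k)
    column k j 1≤k = ≡.sym (ℕₚ.+-∸-comm j (part-decreasing μ 1≤k))

  reverse⇒rows : IsReverse ν μ T → RowsReverse (part μ) m 1 0 [] T
  reverse⇒rows rev = ≡.subst (RowsReverse (part μ) m 1 0 []) T≡ (rowsReverse⁺ (part μ) m row 1 (len ν)
    (λ k 1≤k k< → nth⇒Bounded (row k) (first≤ (proj₂ (proj₂ fits k 1≤k (s≤s⁻¹ k<)))) (λ l l< →
      ≡.subst₂ _≤_ (entry-row-suc k (suc l)) (entry-row k (suc l))
        (proj₁ (boxes-All⁻ ν μ rev k 1≤k (s≤s⁻¹ k<) (suc l) (s≤s z≤n) (ℕₚ.<⇒≤ (len≤ 1≤k (s≤s⁻¹ k<) l<)))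
          (s≤s (ℕₚ.m≤m+n _ _) , ≡.subst (_≤ part ν k) (ℕₚ.+-suc (part μ k) (suc l)) (below (len≤ 1≤k (s≤s⁻¹ k<) l<) (s≤s z≤n))))))
    tt
    (λ k 1≤k k< → nth⇒Above (row k) _ (λ l l< l<′ → columnCondition k 1≤k (s≤s⁻¹ k<) l l< l<′)))
    where
    first≤ : ∀ {b is} → All (_≤ b) is → nth 0 is 1 ≤ b
    first≤ []      = z≤n
    first≤ (l ∷ _) = l
    len≤ : ∀ {k n} → 1 ≤ k → k ≤ len ν → n ≤ length (row k) → n ≤ part ν k ∸ part μ k
    len≤ 1≤k k≤ = ≡.subst (_ ≤_) (length-row 1≤k k≤)
    columnCondition : ∀ k → 1 ≤ k → suc k ≤ len ν → ∀ l → suc l ≤ length (row k) →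
      suc l ≤ length (drop (part μ k ∸ part μ (suc k)) (row (suc k))) →
      nth 0 (drop (part μ k ∸ part μ (suc k)) (row (suc k))) (suc l) < nth 0 (row k) (suc l)
    columnCondition k 1≤k k< l l< l<′ = ≡.subst₂ _<_
      (≡.sym (≡.trans (nth-drop 0 (part μ k ∸ part μ (suc k)) (row (suc k)) l)
        (≡.cong (nth 0 (row (suc k))) (≡.trans (≡.sym (ℕₚ.+-suc _ l)) (column k (suc l) 1≤k)))))
      (entry-row k (suc l))
      (proj₂ (boxes-All⁻ ν μ rev k 1≤k (ℕₚ.<⇒≤ k<) (suc l) (s≤s z≤n) (len≤ 1≤k (ℕₚ.<⇒≤ k<) l<))
        (ℕₚ.≤-<-trans (part-decreasing μ 1≤k) (ℕₚ.m<m+n _ (s≤s z≤n)) , in-next))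
      where
      δ = part μ k ∸ part μ (suc k)
      in-next : part μ k ℕ.+ suc l ≤ part ν (suc k)
      in-next = ≡.subst (_≤ part ν (suc k)) (≡.trans (≡.sym (ℕₚ.+-assoc (part μ (suc k)) δ (suc l)))
          (≡.cong (ℕ._+ suc l) (ℕₚ.m+[n∸m]≡n (part-decreasing μ 1≤k))))
        (below {part μ (suc k)} (below {δ} (≡.subst (suc l ≤_) (≡.trans (Listₚ.length-drop δ (row (suc k)))
          (≡.cong (_∸ δ) (length-row (s≤s z≤n) k<))) l<′) (s≤s z≤n)) (ℕₚ.m≤n⇒m≤o+n δ (s≤s z≤n)))

  rows⇒reverse : RowsReverse (part μ) m 1 0 [] T → IsReverse ν μ T
  rows⇒reverse rec = boxes-All⁺ ν μ cell
    where
    conditions = rowsReverse⁻ (part μ) m row 1 (len ν) (≡.subst (RowsReverse (part μ) m 1 0 []) (≡.sym T≡) rec)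
    -- A box in row k + 1 shows that this row belongs to ν, so the condition on consecutive rows is
    -- available for it.
    next≤ : ∀ k → 1 ≤ part ν (suc k) → suc k ≤ len ν
    next≤ k 1≤ with suc k ℕₚ.≤? len ν
    ... | yes l = l
    ... | no  l = contradiction (≡.subst (1 ≤_) (part-beyond ν (ℕₚ.≰⇒> l)) 1≤) λ ()
    columnCondition : ∀ k → 1 ≤ k → suc k ≤ len ν → ∀ l → suc l ≤ length (row k) → part μ k ℕ.+ suc l ≤ part ν (suc k) →
      entry μ T (suc k , part μ k ℕ.+ suc l) < entry μ T (k , part μ k ℕ.+ suc l)
    columnCondition k 1≤k k< l l< in-next = ≡.subst₂ _<_
      (≡.trans (nth-drop 0 δ (row (suc k)) l)
        (≡.cong (nth 0 (row (suc k))) (≡.trans (≡.sym (ℕₚ.+-suc δ l)) (column k (suc l) 1≤k))))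
      (≡.sym (entry-row k (suc l)))
      (Above⇒nth (row k) (drop δ (row (suc k))) (proj₂ conditions k 1≤k (s≤s k<)) l l<
        (≡.subst (suc l ≤_) (≡.sym (≡.trans (Listₚ.length-drop δ (row (suc k)))
          (≡.trans (≡.cong (_∸ δ) (length-row (s≤s z≤n) k<))
            (≡.trans (ℕₚ.∸-+-assoc (part ν (suc k)) (part μ (suc k)) δ)
              (≡.cong (part ν (suc k) ∸_) (ℕₚ.m+[n∸m]≡n (part-decreasing μ 1≤k)))))))
          (≡.subst (_≤ part ν (suc k) ∸ part μ k) (ℕₚ.m+n∸m≡n (part μ k) (suc l)) (ℕₚ.∸-monoˡ-≤ (part μ k) in-next))))
      where δ = part μ k ∸ part μ (suc k)
    cell : ∀ k → 1 ≤ k → k ≤ len ν → ∀ j → 1 ≤ j → j ≤ part ν k ∸ part μ k → _ × _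
    cell k 1≤k k≤ (suc l) 1≤j j≤ =
      (λ (_ , in-row) → ≡.subst₂ _≤_ (≡.sym (entry-row-suc k (suc l))) (≡.sym (entry-row k (suc l)))
        (Bounded⇒nth (row k) (proj₁ conditions k 1≤k (s≤s k≤)) l
          (≡.subst (suc (suc l) ≤_) (≡.sym (length-row 1≤k k≤))
            (≡.subst (_≤ part ν k ∸ part μ k) (ℕₚ.m+n∸m≡n (part μ k) (suc (suc l)))
              (ℕₚ.∸-monoˡ-≤ (part μ k) (≡.subst (_≤ part ν k) (≡.sym (ℕₚ.+-suc (part μ k) (suc l))) in-row)))))) ,
      (λ (_ , in-next) → columnCondition k 1≤k (next≤ k (ℕₚ.≤-trans (s≤s z≤n) (ℕₚ.≤-trans (ℕₚ.m≤n+m (suc l) (part μ k)) in-next)))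
         l (≡.subst (suc l ≤_) (≡.sym (length-row 1≤k k≤)) j≤) in-next)

rowChoices : Partition → Partition → ℕ → ℕ → List (List ℕ)
rowChoices ν μ m k = choices (replicate (part ν k ∸ part μ k) (oneTo m))

rowChoices-All : ∀ m n → All (λ r → length r ≡ n × All (_≤ m) r) (choices (replicate n (oneTo m)))
rowChoices-All m zero    = (≡.refl , []) ∷ []
rowChoices-All m (suc n) = choices-All (oneTo m) (replicate n (oneTo m))
  (λ i∈ (eq , r≤) → ≡.cong suc eq , proj₂ (∈-oneTo m i∈) ∷ r≤) (rowChoices-All m n)

fillings-Fits : ∀ m ν μ → All (Fits ν μ m) (fillings m ν μ)
fillings-Fits m ν μ = ≡.subst (λ ks → All (Fits ν μ m) (choices (map (rowChoices ν μ m) ks))) (≡.sym (oneTo≡countFrom (len ν)))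
  (All.map (λ (eq , f) → eq , fits f) (go 1 (len ν)))
  where
  Good : ℕ → List ℕ → Set
  Good k r = length r ≡ part ν k ∸ part μ k × All (_≤ m) r
  go : ∀ k n → All (λ T → length T ≡ n × (∀ j → j < n → Good (k ℕ.+ j) (nth [] T (suc j))))
    (choices (map (rowChoices ν μ m) (countFrom k n)))
  go k zero    = (≡.refl , λ _ ()) ∷ []
  go k (suc n) = choices-All (rowChoices ν μ m k) (map (rowChoices ν μ m) (countFrom (suc k) n))
    (λ {r} {T} r∈ (eq , f) → ≡.cong suc eq , cons r T (All.lookup (rowChoices-All m _) r∈) f) (go (suc k) n)
    where
    cons : ∀ r T → Good k r → (∀ j → j < n → Good (suc k ℕ.+ j) (nth [] T (suc j))) →
      ∀ j → j < suc n → Good (k ℕ.+ j) (nth [] (r ∷ T) (suc j))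
    cons r T g f zero    _       rewrite ℕₚ.+-identityʳ k = g
    cons r T g f (suc j) (s≤s l) rewrite ℕₚ.+-suc k j = f j l
  fits : ∀ {T} → (∀ j → j < len ν → Good (suc j) (nth [] T (suc j))) → ∀ k → 1 ≤ k → k ≤ len ν → Good k (nth [] T k)
  fits f (suc k) _ k< = f k k<

-- From sums over reverse tableaux to `tableauSum`.

module TableauBridge (R : CommutativeRing c ℓ) (X : ℕ → ℕ → ℕ → CommutativeRing.Carrier R) where

  open CommutativeRing R hiding (zero)
  open Strips R
  open TableauSum R X
  open SetoidReasoning setoid
  open SemiringSolver commutativeSemiring using (solve; _:+_; _:*_; _:=_)

  -- The disjunction carries the truth value itself, since in a ring where 1 and 0 coincide it could
  -- not be recovered from the element.
  Indicates : Carrier → Set p → Set _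
  Indicates u P = (P × u ≈ 1#) ⊎ (¬ P × u ≈ 0#)

  indicates-× : ∀ {P : Set p} {Q : Set q} {u v} → Indicates u P → Indicates v Q → Indicates (u * v) (P × Q)
  indicates-× (inj₁ (a , e)) (inj₁ (b , f)) = inj₁ ((a , b) , trans (*-cong e f) (*-identityˡ _))
  indicates-× (inj₁ _)       (inj₂ (b , f)) = inj₂ ((λ (_ , b′) → b b′) , *-zero _ f)
  indicates-× (inj₂ (a , e)) _              = inj₂ ((λ (a′ , _) → a a′) , zero-* _ e)

  indicates-⇔ : ∀ {P : Set p} {Q : Set q} {u} → (P → Q) → (Q → P) → Indicates u P → Indicates u Q
  indicates-⇔ f g (inj₁ (a , e)) = inj₁ (f a , e)
  indicates-⇔ f g (inj₂ (a , e)) = inj₂ ((λ b → a (g b)) , e)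

  indicates-≤ : ∀ m n → Indicates ⟦ m ≤ n ⟧ (m ≤ n)
  indicates-≤ m n with ⟦≤⟧-split m n
  ... | inj₁ p       = inj₁ p
  ... | inj₂ (l , e) = inj₂ (ℕₚ.<⇒≱ l , e)

  Σ-filter : ∀ {P : A → Set p} (P? : Decidable P) (u f : A → Carrier) {xs} →
    All (λ x → Indicates (u x) (P x)) xs → Σ[ filter P? xs ] f ≈ Σ[ xs ] (λ x → u x * f x)
  Σ-filter P? u f []                     = refl
  Σ-filter P? u f (_∷_ {x = x} i is) with P? x | i
  ... | yes _ | inj₁ (_ , e) = +-cong (sym (one-* _ e)) (Σ-filter P? u f is)
  ... | yes y | inj₂ (n , _) = contradiction y n
  ... | no n  | inj₁ (y , _) = contradiction y n
  ... | no _  | inj₂ (_ , e) = trans (Σ-filter P? u f is) (sym (trans (+-congʳ (zero-* _ e)) (+-identityˡ _)))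

  bounded : ℕ → List ℕ → Carrier
  bounded b []       = 1#
  bounded b (i ∷ is) = ⟦ i ≤ b ⟧ * bounded i is

  bounded-indicates : ∀ b is → Indicates (bounded b is) (Bounded b is)
  bounded-indicates b []       = inj₁ (tt , refl)
  bounded-indicates b (i ∷ is) = indicates-× (indicates-≤ i b) (bounded-indicates i is)

  above-indicates : ∀ is js → Indicates (above is js) (Above is js)
  above-indicates []       js       = inj₁ (tt , refl)
  above-indicates (i ∷ is) []       = inj₁ (tt , refl)
  above-indicates (i ∷ is) (j ∷ js) = indicates-× (indicates-≤ (suc j) i) (above-indicates is js)

  rowsReverse : (ℕ → ℕ) → ℕ → ℕ → ℕ → List ℕ → Filling → Carrier
  rowsReverse μ m k b is []      = 1#
  rowsReverse μ m k b is (r ∷ T) = (bounded m r * above is (drop (b ∸ μ k) r)) * rowsReverse μ m (suc k) (μ k) r T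

  rowsReverse-indicates : ∀ μ m k b is T → Indicates (rowsReverse μ m k b is T) (RowsReverse μ m k b is T)
  rowsReverse-indicates μ m k b is []      = inj₁ (tt , refl)
  rowsReverse-indicates μ m k b is (r ∷ T) =
    indicates-× (indicates-× (bounded-indicates m r) (above-indicates is _)) (rowsReverse-indicates μ m (suc k) (μ k) r T)

  private
    Σ-oneTo-≤ : ∀ {b} m (f : ℕ → Carrier) → b ≤ m → Σ[ oneTo m ] (λ i → ⟦ i ≤ b ⟧ * f i) ≈ Σ[ oneTo b ] f
    Σ-oneTo-≤ {b} m f b≤m = begin
      Σ[ oneTo m ] (λ i → ⟦ i ≤ b ⟧ * f i)          ≈⟨ Σ-map _ suc (upTo m) ⟩
      Σ[ upTo m ] (λ j → ⟦ suc j ≤ b ⟧ * f (suc j)) ≈⟨ go m b≤m (f ∘ suc) ⟩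
      Σ[ upTo b ] (f ∘ suc)                         ≈⟨ Σ-map f suc (upTo b) ⟨
      Σ[ oneTo b ] f                                ∎
      where
      go : ∀ {b} m → b ≤ m → ∀ f → Σ[ upTo m ] (λ j → ⟦ suc j ≤ b ⟧ * f j) ≈ Σ[ upTo b ] f
      go m       z≤n       f = trans (Σ-cong (λ j → zeroˡ _) (upTo m)) (Σ-zero (upTo m))
      go {suc b} (suc m) (s≤s b≤m) f = begin
        Σ[ upTo (suc m) ] (λ j → ⟦ suc j ≤ suc b ⟧ * f j)      ≈⟨ Σ-upTo-suc m (λ j → ⟦ suc j ≤ suc b ⟧ * f j) ⟩
        1# * f 0 + Σ[ upTo m ] (λ j → ⟦ suc j ≤ b ⟧ * f (suc j)) ≈⟨ +-cong (*-identityˡ _) (go m b≤m (f ∘ suc)) ⟩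
        f 0 + Σ[ upTo b ] (f ∘ suc)                            ≈⟨ Σ-upTo-suc b f ⟨
        Σ[ upTo (suc b) ] f                                    ∎

    Σ-weaklyDecreasing-head : ∀ b n (f : List ℕ → Carrier) →
      Σ[ oneTo b ] (λ i → Σ[ weaklyDecreasing i n ] (λ r → f (i ∷ r))) ≈ Σ[ weaklyDecreasing b (suc n) ] f
    Σ-weaklyDecreasing-head zero    n f = refl
    Σ-weaklyDecreasing-head (suc b) n f = begin
      Σ[ oneTo (suc b) ] F           ≈⟨ Σ-map F suc (upTo (suc b)) ⟩
      Σ[ upTo (suc b) ] (F ∘ suc)    ≈⟨ Σ-upTo-last b (F ∘ suc) ⟩
      Σ[ upTo b ] (F ∘ suc) + F (suc b)
        ≈⟨ +-congʳ (trans (sym (Σ-map F suc (upTo b))) (Σ-weaklyDecreasing-head b n f)) ⟩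
      Σ[ weaklyDecreasing b (suc n) ] f + F (suc b)
        ≈⟨ trans (+-comm _ _) (+-congʳ (sym (Σ-map f (suc b ∷_) (weaklyDecreasing (suc b) n)))) ⟩
      Σ[ map (suc b ∷_) (weaklyDecreasing (suc b) n) ] f + Σ[ weaklyDecreasing b (suc n) ] f
        ≈⟨ Σ-++ f (map (suc b ∷_) (weaklyDecreasing (suc b) n)) _ ⟨
      Σ[ weaklyDecreasing (suc b) (suc n) ] f ∎
      where
      F : ℕ → Carrier
      F i = Σ[ weaklyDecreasing i n ] (λ r → f (i ∷ r))

  -- Fillings choose the entries of a row independently; the indicator keeps the decreasing rows,
  -- which are grouped by their first entry.
  Σ-bounded : ∀ {b} m n (f : List ℕ → Carrier) → b ≤ m →
    Σ[ choices (replicate n (oneTo m)) ] (λ r → bounded b r * f r) ≈ Σ[ weaklyDecreasing b n ] f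
  Σ-bounded m zero    f b≤m = +-congʳ (*-identityˡ _)
  Σ-bounded {b} m (suc n) f b≤m = begin
    Σ[ choices (oneTo m ∷ replicate n (oneTo m)) ] (λ r → bounded b r * f r)
      ≈⟨ Σ-choices _ (oneTo m) (replicate n (oneTo m)) ⟩
    Σ[ oneTo m ] (λ i → Σ[ choices (replicate n (oneTo m)) ] (λ r → (⟦ i ≤ b ⟧ * bounded i r) * f (i ∷ r)))
      ≈⟨ Σ-cong-All {xs = oneTo m} (All.tabulate (λ {i} i∈ → trans (Σ-cong (λ r → *-assoc _ _ _) (choices (replicate n (oneTo m))))
           (trans (sym (Σ-*ˡ _ _ (choices (replicate n (oneTo m)))))
             (*-congˡ (Σ-bounded m n (λ r → f (i ∷ r)) (proj₂ (∈-oneTo m i∈))))))) ⟩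
    Σ[ oneTo m ] (λ i → ⟦ i ≤ b ⟧ * Σ[ weaklyDecreasing i n ] (λ r → f (i ∷ r)))
      ≈⟨ Σ-oneTo-≤ m _ b≤m ⟩
    Σ[ oneTo b ] (λ i → Σ[ weaklyDecreasing i n ] (λ r → f (i ∷ r)))
      ≈⟨ Σ-weaklyDecreasing-head b n f ⟩
    Σ[ weaklyDecreasing b (suc n) ] f ∎

  rowWeight-nth : ∀ k p r → rowWeight k p r ≈ Π[ countFrom 1 (length r) ] (λ l → X (nth 0 r l) k (p ℕ.+ l))
  rowWeight-nth k p []       = refl
  rowWeight-nth k p (i ∷ is) = *-cong (reflexive (≡.cong (X i k) (ℕₚ.+-comm 1 p)))
    (trans (rowWeight-nth k (suc p) is) (skip 0 (length is)))
    where
    skip : ∀ l n → Π[ countFrom (suc l) n ] (λ l → X (nth 0 is l) k (suc p ℕ.+ l)) ≈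
                   Π[ countFrom (suc (suc l)) n ] (λ l → X (nth 0 (i ∷ is) l) k (p ℕ.+ l))
    skip l zero    = refl
    skip l (suc n) = *-cong (reflexive (≡.cong (X (nth 0 is (suc l)) k) (≡.sym (ℕₚ.+-suc p (suc l))))) (skip (suc l) n)

  module _ (ν μ : Partition) (m : ℕ) where

    fillingWeight : ℕ → Filling → Carrier
    fillingWeight k []      = 1#
    fillingWeight k (r ∷ T) = rowWeight k (part μ k) r * fillingWeight (suc k) T

    boxWeight : Filling → Carrier
    boxWeight T = Π[ boxes ν μ ] (λ α → X (entry μ T α) (proj₁ α) (proj₂ α))

    private
      Π-concatMap : ∀ (f : B → Carrier) (g : A → List B) xs → Π[ concatMap g xs ] f ≈ Π[ xs ] (λ x → Π[ g x ] f)
      Π-concatMap f g []       = refl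
      Π-concatMap f g (x ∷ xs) = trans (Π-++ f (g x) _) (*-congˡ (Π-concatMap f g xs))

      Π-cong-All : ∀ {f g : A → Carrier} {xs} → All (λ x → f x ≈ g x) xs → Π[ xs ] f ≈ Π[ xs ] g
      Π-cong-All []       = refl
      Π-cong-All (e ∷ es) = *-cong e (Π-cong-All es)

    boxWeight-rows : ∀ {T} → Fits ν μ m T → boxWeight T ≈ fillingWeight 1 T
    boxWeight-rows {T} (eq , fits) = begin
      Π[ boxes ν μ ] (λ α → X (entry μ T α) (proj₁ α) (proj₂ α))
        ≈⟨ Π-concatMap _ (λ k → map (λ l → k , part μ k ℕ.+ l) (oneTo (part ν k ∸ part μ k))) (oneTo (len ν)) ⟩
      Π[ oneTo (len ν) ] (λ k → Π[ map (λ l → k , part μ k ℕ.+ l) (oneTo (part ν k ∸ part μ k)) ] (λ α → X (entry μ T α) (proj₁ α) (proj₂ α)))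
        ≈⟨ Π-cong-All {xs = oneTo (len ν)} (All.tabulate (λ {k} k∈ → row k (fits k (proj₁ (∈-oneTo _ k∈)) (proj₂ (∈-oneTo _ k∈))))) ⟩
      Π[ oneTo (len ν) ] (λ k → rowWeight k (part μ k) (nth [] T k))
        ≡⟨ ≡.cong (λ ks → Π[ ks ] (λ k → rowWeight k (part μ k) (nth [] T k))) (oneTo≡countFrom (len ν)) ⟩
      Π[ countFrom 1 (len ν) ] (λ k → rowWeight k (part μ k) (nth [] T k))
        ≈⟨ eachRow 1 (len ν) (nth [] T) ⟩
      fillingWeight 1 (map (nth [] T) (countFrom 1 (len ν)))
        ≡⟨ ≡.cong (fillingWeight 1) (≡.trans (≡.cong (λ n → map (nth [] T) (countFrom 1 n)) (≡.sym eq)) (map-nth [] T)) ⟩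
      fillingWeight 1 T ∎
      where
      row : ∀ k → (length (nth [] T k) ≡ part ν k ∸ part μ k × All (_≤ m) (nth [] T k)) →
        Π[ map (λ l → k , part μ k ℕ.+ l) (oneTo (part ν k ∸ part μ k)) ] (λ α → X (entry μ T α) (proj₁ α) (proj₂ α)) ≈
        rowWeight k (part μ k) (nth [] T k)
      row k (len≡ , _) = begin
        Π[ map (λ l → k , part μ k ℕ.+ l) (oneTo (part ν k ∸ part μ k)) ] (λ α → X (entry μ T α) (proj₁ α) (proj₂ α))
          ≈⟨ Π-map _ (λ l → k , part μ k ℕ.+ l) (oneTo (part ν k ∸ part μ k)) ⟩
        Π[ oneTo (part ν k ∸ part μ k) ] (λ l → X (nth 0 (nth [] T k) (part μ k ℕ.+ l ∸ part μ k)) k (part μ k ℕ.+ l))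
          ≈⟨ Π-cong (λ l → reflexive (≡.cong (λ j → X (nth 0 (nth [] T k) j) k (part μ k ℕ.+ l)) (ℕₚ.m+n∸m≡n (part μ k) l))) (oneTo (part ν k ∸ part μ k)) ⟩
        Π[ oneTo (part ν k ∸ part μ k) ] (λ l → X (nth 0 (nth [] T k) l) k (part μ k ℕ.+ l))
          ≡⟨ ≡.cong (λ ks → Π[ ks ] (λ l → X (nth 0 (nth [] T k) l) k (part μ k ℕ.+ l)))
               (≡.trans (oneTo≡countFrom _) (≡.cong (countFrom 1) (≡.sym len≡))) ⟩
        Π[ countFrom 1 (length (nth [] T k)) ] (λ l → X (nth 0 (nth [] T k) l) k (part μ k ℕ.+ l))
          ≈⟨ rowWeight-nth k (part μ k) (nth [] T k) ⟨
        rowWeight k (part μ k) (nth [] T k) ∎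
      eachRow : ∀ k n (row : ℕ → List ℕ) → Π[ countFrom k n ] (λ k → rowWeight k (part μ k) (row k)) ≈ fillingWeight k (map row (countFrom k n))
      eachRow k zero    row = refl
      eachRow k (suc n) row = *-congˡ (eachRow (suc k) n row)

    Σ-choices-rows : μ ⊆ ν → ∀ k n b is →
      Σ[ choices (map (rowChoices ν μ m) (countFrom k n)) ] (λ T → rowsReverse (part μ) m k b is T * fillingWeight k T) ≈
      tableauSum m k b is (map (part μ) (countFrom k n)) (map (part ν) (countFrom k n))
    Σ-choices-rows μ⊆ν k zero    b is = trans (+-identityʳ _) (*-identityˡ _)
    Σ-choices-rows μ⊆ν k (suc n) b is = begin
      Σ[ choices (rowChoices ν μ m k ∷ Cs) ] (λ T → rowsReverse (part μ) m k b is T * fillingWeight k T)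
        ≈⟨ Σ-choices _ (rowChoices ν μ m k) Cs ⟩
      Σ[ rowChoices ν μ m k ] (λ r → Σ[ choices Cs ] (λ T →
        ((bounded m r * a r) * rowsReverse (part μ) m (suc k) (part μ k) r T) * (rowWeight k (part μ k) r * fillingWeight (suc k) T)))
        ≈⟨ Σ-cong (λ r → trans (Σ-cong (λ T → solve 5 (λ b a i w f → ((b :* a) :* i) :* (w :* f) := (b :* (a :* w)) :* (i :* f)) refl
               (bounded m r) (a r) (rowsReverse (part μ) m (suc k) (part μ k) r T) (rowWeight k (part μ k) r) (fillingWeight (suc k) T)) (choices Cs))
             (trans (sym (Σ-*ˡ _ _ (choices Cs))) (trans (*-congˡ (Σ-choices-rows μ⊆ν (suc k) n (part μ k) r))
               (trans (*-assoc _ _ _) (*-congˡ (trans (*-assoc _ _ _) (*-congʳ (sym (one-* _ (⟦≤⟧-one (μ⊆ν k))))))))))) (rowChoices ν μ m k) ⟩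
      Σ[ rowChoices ν μ m k ] (λ r → bounded m r * ((⟦ part μ k ≤ part ν k ⟧ * a r) * (rowWeight k (part μ k) r *
        tableauSum m (suc k) (part μ k) r (map (part μ) (countFrom (suc k) n)) (map (part ν) (countFrom (suc k) n)))))
        ≈⟨ Σ-bounded m (part ν k ∸ part μ k) _ ℕₚ.≤-refl ⟩
      tableauSum m k b is (map (part μ) (countFrom k (suc n))) (map (part ν) (countFrom k (suc n))) ∎
      where
      Cs = map (rowChoices ν μ m) (countFrom (suc k) n)
      a : List ℕ → Carrier
      a r = above is (drop (b ∸ part μ k) r)

    Σ-reverseTableaux : μ ⊆ ν → ∀ b → Σ[ reverseTableaux m ν μ ] boxWeight ≈
      tableauSum m 1 b [] (map (part μ) (countFrom 1 (len ν))) (map (part ν) (countFrom 1 (len ν)))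
    Σ-reverseTableaux μ⊆ν b = begin
      Σ[ reverseTableaux m ν μ ] boxWeight
        ≈⟨ Σ-filter (isReverse? ν μ) (rowsReverse (part μ) m 1 0 []) boxWeight (All.map (λ {T} fits →
             indicates-⇔ (rows⇒reverse ν μ m fits) (reverse⇒rows ν μ m fits) (rowsReverse-indicates (part μ) m 1 0 [] T)) (fillings-Fits m ν μ)) ⟩
      Σ[ fillings m ν μ ] (λ T → rowsReverse (part μ) m 1 0 [] T * boxWeight T)
        ≈⟨ Σ-cong-All (All.map (λ fits → *-congˡ (boxWeight-rows fits)) (fillings-Fits m ν μ)) ⟩
      Σ[ choices (map (rowChoices ν μ m) (oneTo (len ν))) ] (λ T → rowsReverse (part μ) m 1 0 [] T * fillingWeight 1 T)
        ≡⟨ ≡.cong (λ ks → Σ[ choices (map (rowChoices ν μ m) ks) ] (λ T → rowsReverse (part μ) m 1 0 [] T * fillingWeight 1 T)) (oneTo≡countFrom (len ν)) ⟩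
      Σ[ choices (map (rowChoices ν μ m) (countFrom 1 (len ν))) ] (λ T → rowsReverse (part μ) m 1 0 [] T * fillingWeight 1 T)
        ≈⟨ Σ-choices-rows μ⊆ν 1 (len ν) 0 [] ⟩
      tableauSum m 1 0 [] (map (part μ) (countFrom 1 (len ν))) (map (part ν) (countFrom 1 (len ν)))
        -- The bound 0 natural for a filling is replaced by the bound under which horizontal strips
        -- are taken.
        ≡⟨ irrelevant-bound (map (part μ) (countFrom 1 (len ν))) (map (part ν) (countFrom 1 (len ν))) ⟩
      tableauSum m 1 b [] (map (part μ) (countFrom 1 (len ν))) (map (part ν) (countFrom 1 (len ν))) ∎
      where
      irrelevant-bound : ∀ μs νs → tableauSum m 1 0 [] μs νs ≡ tableauSum m 1 b [] μs νs
      irrelevant-bound []       []       = ≡.refl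
      irrelevant-bound []       (_ ∷ _)  = ≡.refl
      irrelevant-bound (_ ∷ _)  []       = ≡.refl
      irrelevant-bound (_ ∷ _)  (_ ∷ _)  = ≡.refl

    -- Rows that are zero in both shapes admit only the empty row of entries, of weight 1. This
    -- allows the shapes to be padded to any common length.
    tableauSum-pad : ∀ k n e b is → (∀ j → k ℕ.+ n ≤ j → part μ j ≡ 0 × part ν j ≡ 0) →
      tableauSum m k b is (map (part μ) (countFrom k (n ℕ.+ e))) (map (part ν) (countFrom k (n ℕ.+ e))) ≈
      tableauSum m k b is (map (part μ) (countFrom k n)) (map (part ν) (countFrom k n))
    tableauSum-pad k zero    zero    b is f = refl
    tableauSum-pad k zero    (suc e) b is f with part μ k | part ν k | f k (ℕₚ.≤-reflexive (ℕₚ.+-identityʳ k))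
    ... | _ | _ | ≡.refl , ≡.refl = trans (+-identityʳ _) (trans (*-cong (trans (*-identityˡ _) (above-empty is))
        (trans (*-identityˡ _) (tableauSum-pad (suc k) zero e 0 [] (λ j l → f j (ℕₚ.≤-trans (ℕₚ.n≤1+n _) l))))) (*-identityˡ _))
      where
      above-empty : ∀ is → above is (drop b []) ≈ 1#
      above-empty []      = refl
      above-empty (_ ∷ _) rewrite Listₚ.drop-[] {A = ℕ} b = refl
    tableauSum-pad k (suc n) e b is f = Σ-cong (λ js → *-congˡ (*-congˡ
      (tableauSum-pad (suc k) n e (part μ k) js (λ j l → f j (≡.subst (_≤ j) (≡.sym (ℕₚ.+-suc k n)) l))))) (weaklyDecreasing m (part ν k ∸ part μ k))

-- Contents, diagonal boxes and exponents.

-content≡⊖ : ∀ k l → ℤ.- content (k , l) ≡ k ⊖ l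
-content≡⊖ k l = ≡.trans (≡.cong ℤ.-_ (ℤₚ.m-n≡m⊖n l k)) (≡.sym (ℤₚ.⊖-swap k l))

-content+1≡⊖ : ∀ k l → ℤ.- content (k , suc l) ℤ.+ ℤ.1ℤ ≡ k ⊖ l
-content+1≡⊖ k l = ≡.trans (≡.cong (ℤ._+ ℤ.1ℤ) (-content≡⊖ k (suc l)))
  (≡.trans (ℤₚ.distribˡ-⊖-+-pos 1 k (suc l)) (≡.trans (≡.cong (_⊖ suc l) (ℕₚ.+-comm k 1)) (ℤₚ.[1+m]⊖[1+n]≡m⊖n k l)))

1-p≡⊖ : ∀ n d → ℤ.1ℤ ℤ.- + suc d ≡ n ⊖ (n ℕ.+ d)
1-p≡⊖ n d = ≡.trans (ℤₚ.m-n≡m⊖n 1 (suc d)) (≡.trans (ℤₚ.[1+m]⊖[1+n]≡m⊖n 0 d) (shift n))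
  where
  shift : ∀ n → 0 ⊖ d ≡ n ⊖ (n ℕ.+ d)
  shift zero    = ≡.refl
  shift (suc n) = ≡.trans (shift n) (≡.sym (ℤₚ.[1+m]⊖[1+n]≡m⊖n n (n ℕ.+ d)))

firstParts : Partition → ℕ → List ℕ
firstParts μ n = map (part μ) (countFrom 1 n)

firstParts-shape : ∀ μ n → Shape (part μ 1) n (firstParts μ n)
firstParts-shape μ n = go 1 n (s≤s z≤n) ℕₚ.≤-refl
  where
  go : ∀ {b} k n → 1 ≤ k → part μ k ≤ b → Shape b n (map (part μ) (countFrom k n))
  go k zero    1≤k l = []
  go k (suc n) 1≤k l = l ∷ go (suc k) n (s≤s z≤n) (part-decreasing μ 1≤k)

tabulate-toℕ : ∀ (f : ℕ → A) n → tabulate {n = n} (f ∘ toℕ) ≡ applyUpTo f n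
tabulate-toℕ f zero    = ≡.refl
tabulate-toℕ f (suc n) = ≡.cong (f 0 ∷_) (tabulate-toℕ (f ∘ suc) n)

applyUpTo-∷ʳ : ∀ (f : ℕ → A) n → applyUpTo f (suc n) ≡ applyUpTo f n ++ f n ∷ []
applyUpTo-∷ʳ f zero    = ≡.refl
applyUpTo-∷ʳ f (suc n) = ≡.cong (f 0 ∷_) (applyUpTo-∷ʳ (f ∘ suc) n)

oneTo-∷ʳ : ∀ n → oneTo (suc n) ≡ oneTo n ++ suc n ∷ []
oneTo-∷ʳ n = ≡.trans (oneTo≡applyUpTo (suc n)) (≡.trans (applyUpTo-∷ʳ suc n) (≡.cong (_++ suc n ∷ []) (≡.sym (oneTo≡applyUpTo n))))

-- A property inherited by smaller indices holds on an initial segment, so counting the indices that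
-- satisfy it finds the end of that segment.
filter-initial : ∀ {P : ℕ → Set} (P? : Decidable P) → (∀ {k} → 1 ≤ k → P (suc k) → P k) →
  ∀ k n → 1 ≤ k → ∀ j → (n ≤ j → ¬ P (k ℕ.+ j)) → (P (k ℕ.+ j) → suc j ≤ length (filter P? (countFrom k n))) ×
  (suc j ≤ length (filter P? (countFrom k n)) → P (k ℕ.+ j))
filter-initial P? down k zero    1≤k j beyond = (λ Pk → contradiction Pk (beyond z≤n)) , λ ()
filter-initial {P} P? down k (suc n) 1≤k j beyond with P? k
... | no ¬Pk = (λ Pkj → contradiction (descend k j 1≤k Pkj) ¬Pk) ,
  λ l → contradiction (≡.subst (λ ks → suc j ≤ length ks) (Listₚ.filter-none P? (none (suc k) n (λ i Pi → ¬Pk (descend k (suc i) 1≤k (≡.subst P (≡.sym (ℕₚ.+-suc k i)) Pi))))) l) λ ()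
  where
  descend : ∀ k j → 1 ≤ k → P (k ℕ.+ j) → P k
  descend k zero    1≤k Pk = ≡.subst P (ℕₚ.+-identityʳ k) Pk
  descend k (suc j) 1≤k Pk = down 1≤k (descend (suc k) j (s≤s z≤n) (≡.subst P (ℕₚ.+-suc k j) Pk))
  none : ∀ k n → (∀ i → ¬ P (k ℕ.+ i)) → All (¬_ ∘ P) (countFrom k n)
  none k zero    f = []
  none k (suc n) f = ≡.subst (¬_ ∘ P) (ℕₚ.+-identityʳ k) (f 0) ∷ none (suc k) n (λ i → ≡.subst (¬_ ∘ P) (ℕₚ.+-suc k i) (f (suc i)))
filter-initial {P} P? down k (suc n) 1≤k zero    beyond | yes Pk = (λ _ → s≤s z≤n) , λ _ → ≡.subst P (≡.sym (ℕₚ.+-identityʳ k)) Pk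
filter-initial {P} P? down k (suc n) 1≤k (suc j) beyond | yes Pk rewrite ℕₚ.+-suc k j
  with filter-initial P? down (suc k) n (s≤s z≤n) j (λ n≤j → beyond (s≤s n≤j))
... | f , g = (λ Pj → s≤s (f Pj)) , λ l → g (s≤s⁻¹ l)

diagonal-spec : ∀ μ {l} → 1 ≤ l → (l ≤ part μ l → l ≤ diagonal μ) × (l ≤ diagonal μ → l ≤ part μ l)
diagonal-spec μ {suc l} _ = ≡.subst (λ ks → (P (suc l) → suc l ≤ length (filter P? ks)) × (suc l ≤ length (filter P? ks) → P (suc l)))
  (≡.sym (oneTo≡countFrom (len μ))) (filter-initial P? (λ 1≤k Pk → ℕₚ.≤-trans (ℕₚ.<⇒≤ Pk) (part-decreasing μ 1≤k))
    1 (len μ) (s≤s z≤n) l λ l< Pk → contradiction (≡.subst (suc l ≤_) (part-beyond μ (s≤s l<)) Pk) λ ())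
  where
  P : ℕ → Set
  P k = k ≤ part μ k
  P? : Decidable P
  P? k = k ℕₚ.≤? part μ k

-- With m the l-th part, this splits the number of denominators in `dual` into the n - 1 that cancel
-- against `ψ` and the m + 1 - l that remain.
exponent-≥ : ∀ {l n m} → 1 ≤ n → l ≤ n → l ≤ m → m ℕ.+ (n ∸ l) ≡ n ∸ 1 ℕ.+ (suc m ∸ l)
exponent-≥ {l} {n} {m} 1≤n l≤n l≤m = begin
  m ℕ.+ (n ∸ l)               ≡⟨ ℕₚ.+-∸-assoc m l≤n ⟨
  m ℕ.+ n ∸ l                 ≡⟨ ≡.cong (λ s → m ℕ.+ s ∸ l) (ℕₚ.m+[n∸m]≡n 1≤n) ⟨
  m ℕ.+ suc (n ∸ 1) ∸ l       ≡⟨ ≡.cong (_∸ l) (≡.trans (ℕₚ.+-suc m (n ∸ 1)) (ℕₚ.+-comm (suc m) (n ∸ 1))) ⟩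
  n ∸ 1 ℕ.+ suc m ∸ l         ≡⟨ ℕₚ.+-∸-assoc (n ∸ 1) (ℕₚ.m≤n⇒m≤1+n l≤m) ⟩
  n ∸ 1 ℕ.+ (suc m ∸ l)       ∎
  where open ≡.≡-Reasoning

-- Below the diagonal all denominators cancel, and l - m - 1 of the n - 1 numerators remain.
exponent-< : ∀ {l n m} → 1 ≤ l → l ≤ n → m < l → (l ∸ m ∸ 1) ℕ.+ (m ℕ.+ (n ∸ l)) ≡ n ∸ 1
exponent-< {l} {n} {m} 1≤l l≤n m<l = begin
  (l ∸ m ∸ 1) ℕ.+ (m ℕ.+ (n ∸ l))  ≡⟨ ℕₚ.+-assoc (l ∸ m ∸ 1) m (n ∸ l) ⟨
  (l ∸ m ∸ 1 ℕ.+ m) ℕ.+ (n ∸ l)    ≡⟨ ≡.cong (λ s → (s ℕ.+ m) ℕ.+ (n ∸ l)) exchange ⟩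
  (l ∸ 1 ∸ m ℕ.+ m) ℕ.+ (n ∸ l)    ≡⟨ ≡.cong (ℕ._+ (n ∸ l)) (ℕₚ.m∸n+n≡m (ℕₚ.∸-monoˡ-≤ 1 m<l)) ⟩
  l ∸ 1 ℕ.+ (n ∸ l)                ≡⟨ ℕₚ.+-comm (l ∸ 1) (n ∸ l) ⟩
  n ∸ l ℕ.+ (l ∸ 1)                ≡⟨ ℕₚ.+-∸-assoc (n ∸ l) 1≤l ⟨
  n ∸ l ℕ.+ l ∸ 1                  ≡⟨ ≡.cong (_∸ 1) (ℕₚ.m∸n+n≡m l≤n) ⟩
  n ∸ 1                            ∎
  where
  open ≡.≡-Reasoning
  exchange : l ∸ m ∸ 1 ≡ l ∸ 1 ∸ m
  exchange = ≡.trans (ℕₚ.∸-+-assoc l m 1) (≡.trans (≡.cong (l ∸_) (ℕₚ.+-comm m 1)) (≡.sym (ℕₚ.∸-+-assoc l 1 m)))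

-- Schur functions as quotients of alternants.

module SchurBridge (R : CommutativeRing c ℓ) (a : ℤ → CommutativeRing.Carrier R) (n : ℕ) where

  open Schur R a using (var; const; geometric; oneMinus; geometric-inverse; vandermonde;
    divVandermonde-unique; shiftedPower; detRatio; doubleSchur; dualSchur; weight; skewDualSchur) renaming (X to boxFactor)
  open CommutativeRing (Series R n) hiding (zero)
  open SetoidReasoning setoid

  h : ℕ → ℕ → Carrier
  h k l = const n (a (k ⊖ l))

  γ : ℕ → ℕ → ℕ → Carrier
  γ i k l = geometric n (a (k ⊖ l)) i

  h-diagonal : ∀ k l → h (suc k) (suc l) ≈ h k l
  h-diagonal k l = reflexive (≡.cong (const n ∘ a) (ℤₚ.[1+m]⊖[1+n]≡m⊖n k l))

  γ-inverse : ∀ i k l → (1# - h k l * var n i) * γ i k l ≈ 1#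
  γ-inverse i k l = geometric-inverse n (a (k ⊖ l)) i

  open Weights (Series R n) (var n) h h-diagonal γ γ-inverse using (X; runWeight; α; q₁; γ-shift)
  open Strips (Series R n)
  open TableauSum (Series R n) X using (tableauSum; tableauSum-chains)
  open TableauBridge (Series R n) X using (boxWeight; Σ-reverseTableaux; tableauSum-pad)

  boxFactor-X : ∀ i k l → boxFactor n i (a (ℤ.- content (k , suc l) ℤ.+ ℤ.1ℤ)) (a (ℤ.- content (k , suc l))) ≈ X i k (suc l)
  boxFactor-X i k l rewrite -content+1≡⊖ k l | -content≡⊖ k (suc l) = *-assoc _ _ _

  weight-boxWeight : ∀ ν μ T → weight n ν μ T ≈ boxWeight ν μ n T
  weight-boxWeight ν μ T = go {boxes ν μ} (boxes-All⁺ ν μ λ { k _ _ (suc j) _ _ →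
      trans (reflexive (≡.cong (λ l → F (k , l)) (ℕₚ.+-suc (part μ k) j)))
        (trans (boxFactor-X _ k (part μ k ℕ.+ j)) (reflexive (≡.cong (λ l → G (k , l)) (≡.sym (ℕₚ.+-suc (part μ k) j))))) })
    where
    F G : Box → Carrier
    F α = boxFactor n (entry μ T α) (a (ℤ.- content α ℤ.+ ℤ.1ℤ)) (a (ℤ.- content α))
    G α = X (entry μ T α) (proj₁ α) (proj₂ α)
    go : ∀ {bs} → All (λ α → F α ≈ G α) bs → Π[ bs ] F ≈ Π[ bs ] G
    go []       = refl
    go (e ∷ es) = *-cong e (go es)

  skewDualSchur-chains : ∀ {ν μ} n′ {N} → μ ⊆ ν → len ν ≤ n′ → part ν 1 ≤ N →
    skewDualSchur n ν μ ≈ chains runWeight N n′ n (firstParts μ n′) (firstParts ν n′)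
  skewDualSchur-chains {ν} {μ} n′ {N} μ⊆ν len≤ part≤ = begin
    Σ[ reverseTableaux n ν μ ] (weight n ν μ)
      ≈⟨ Σ-cong (weight-boxWeight ν μ) (reverseTableaux n ν μ) ⟩
    Σ[ reverseTableaux n ν μ ] (boxWeight ν μ n)
      ≈⟨ Σ-reverseTableaux ν μ n μ⊆ν N ⟩
    tableauSum n 1 N [] (firstParts μ (len ν)) (firstParts ν (len ν))
      ≈⟨ tableauSum-pad ν μ n 1 (len ν) (n′ ∸ len ν) N [] (λ j l →
           let ν≡0 = part-beyond ν l in ℕₚ.n≤0⇒n≡0 (≡.subst (part μ j ≤_) ν≡0 (μ⊆ν j)) , ν≡0) ⟨
    tableauSum n 1 N [] (firstParts μ (len ν ℕ.+ (n′ ∸ len ν))) (firstParts ν (len ν ℕ.+ (n′ ∸ len ν)))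
      ≡⟨ ≡.cong (λ s → tableauSum n 1 N [] (firstParts μ s) (firstParts ν s)) (ℕₚ.m+[n∸m]≡n len≤) ⟩
    tableauSum n 1 N [] (firstParts μ n′) (firstParts ν n′)
      ≈⟨ tableauSum-chains n (Shape-weaken (ℕₚ.≤-trans (μ⊆ν 1) part≤) (firstParts-shape μ n′)) (Shape-weaken part≤ (firstParts-shape ν n′)) ⟩
    chains runWeight N n′ n (firstParts μ n′) (firstParts ν n′) ∎

  points : List ℕ
  points = applyUpTo suc n

  -- `pairs` groups the factors by the larger index and `vandermondeOn` by the smaller one, so the
  -- induction appends the last point.
  Π-pairs : ∀ (x : ℕ → Carrier) m → Π[ Schur.pairs R a m ] (λ (k , l) → x k - x l) ≈ vandermondeOn x (applyUpTo suc m)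
  Π-pairs x zero    = refl
  Π-pairs x (suc m) = begin
    Π[ concatMap G (oneTo (suc m)) ] F
      ≡⟨ ≡.cong (λ ks → Π[ concatMap G ks ] F) (oneTo-∷ʳ m) ⟩
    Π[ concatMap G (oneTo m ++ suc m ∷ []) ] F
      ≡⟨ ≡.cong (λ ps → Π[ ps ] F) (Listₚ.concatMap-++ G (oneTo m) (suc m ∷ [])) ⟩
    Π[ concatMap G (oneTo m) ++ G (suc m) ++ [] ] F
      ≈⟨ Π-++ F (concatMap G (oneTo m)) _ ⟩
    Π[ concatMap G (oneTo m) ] F * Π[ G (suc m) ++ [] ] F
      ≈⟨ *-cong (Π-pairs x m) (trans (Π-++ F (G (suc m)) []) (trans (*-identityʳ _)
           (trans (Π-map F (_, suc m) (oneTo m)) (reflexive (≡.cong (λ ks → Π[ ks ] (λ k → x k - x (suc m))) (oneTo≡applyUpTo m)))))) ⟩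
    vandermondeOn x (applyUpTo suc m) * Π[ applyUpTo suc m ] (λ k → x k - x (suc m))
      ≈⟨ vandermondeOn-snoc x (applyUpTo suc m) (suc m) ⟨
    vandermondeOn x (applyUpTo suc m ++ suc m ∷ [])
      ≡⟨ ≡.cong (vandermondeOn x) (applyUpTo-∷ʳ suc m) ⟨
    vandermondeOn x (applyUpTo suc (suc m)) ∎
    where
    F : ℕ × ℕ → Carrier
    F (k , l) = x k - x l
    G : ℕ → List (ℕ × ℕ)
    G l = map (λ k → k , l) (oneTo (l ∸ 1))

  vandermonde-points : vandermonde n ≈ vandermondeOn (var n) points
  vandermonde-points = Π-pairs (var n) n

  open Determinant (Series R n) using (det)

  -- In `detRatio` the points index the rows and the parts index the columns; in `rows` it is the
  -- other way round, hence the transposition.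
  det-rows : ∀ μ (g : ℕ → ℕ → Carrier) (M : ℕ → ℕ → Carrier) →
    (∀ k l → 1 ≤ l → l ≤ n → M k l ≈ g (part μ l ℕ.+ (n ∸ l)) k) →
    det n (λ k l → M (suc (toℕ k)) (suc (toℕ l))) ≈ E (rows g n (firstParts μ n)) points
  det-rows μ g M e = begin
    det n (λ k l → M (suc (toℕ k)) (suc (toℕ l)))
      ≈⟨ det-E n (λ k → M (suc (toℕ k))) (suc ∘ toℕ) ⟩
    E (tabulate {n = n} (M ∘ suc ∘ toℕ)) (tabulate {n = n} (suc ∘ toℕ))
      ≡⟨ ≡.cong₂ E (≡.trans (tabulate-toℕ (M ∘ suc) n) (≡.sym (Listₚ.map-applyUpTo suc M n))) (tabulate-toℕ suc n) ⟩
    E (map M points) points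
      ≈⟨ E-transpose (map M points) points ⟩
    E (map (λ c f → f c) points) (map M points)
      ≈⟨ E-map (map (λ c f → f c) points) M points ⟩
    E (map (_∘ M) (map (λ c f → f c) points)) points
      ≈⟨ E-cong (≡.subst (λ ks → map (_∘ M) (map (λ c f → f c) ks) ≗ rows g n (firstParts μ n))
           (≡.sym (applyUpTo-countFrom suc 1 n (λ _ → ≡.refl))) (go 1 n (s≤s z≤n) ≡.refl)) points ⟩
    E (rows g n (firstParts μ n)) points ∎
    where
    go : ∀ k t → 1 ≤ k → k ℕ.+ t ≡ suc n →
      map (_∘ M) (map (λ c f → f c) (countFrom k t)) ≗ rows g t (map (part μ) (countFrom k t))
    go k zero    1≤k eq = []
    go k (suc t) 1≤k eq = (λ i → trans (e i k 1≤k (≡.subst (k ≤_) k+t (ℕₚ.m≤m+n k t)))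
        (reflexive (≡.cong (λ s → g (part μ k ℕ.+ s) i) (≡.trans (≡.cong (_∸ k) (≡.sym k+t)) (ℕₚ.m+n∸m≡n k t)))))
      ∷ go (suc k) t (s≤s z≤n) (≡.trans (≡.sym (ℕₚ.+-suc k t)) eq)
      where
      k+t : k ℕ.+ t ≡ n
      k+t = ℕₚ.suc-injective (≡.trans (≡.sym (ℕₚ.+-suc k t)) eq)

  detRatio-rows : ∀ μ (g : ℕ → ℕ → Carrier) (M : ℕ → ℕ → Carrier) G →
    (∀ k l → 1 ≤ l → l ≤ n → M k l ≈ g (part μ l ℕ.+ (n ∸ l)) k) →
    vandermondeOn (var n) points * G ≈ E (rows g n (firstParts μ n)) points →
    detRatio n M ≈ G
  detRatio-rows μ g M G e e′ = divVandermonde-unique n G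
    (trans (det-rows μ g M e) (trans (sym e′) (*-congʳ (sym vandermonde-points))))

  private
    newton-step : ∀ p x z b → p * (x - b) ≈ (z - b) * p + (x - z) * (1# * p)
    newton-step p x z b = sym (begin
      (z - b) * p + (x - z) * (1# * p) ≈⟨ +-congˡ (*-congˡ (*-identityˡ p)) ⟩
      (z - b) * p + (x - z) * p        ≈⟨ distribʳ _ _ _ ⟨
      ((z - b) + (x - z)) * p
        ≈⟨ *-congʳ (trans (+-comm _ _) (trans (+-assoc _ _ _) (+-congˡ (trans (sym (+-assoc _ _ _)) (trans (+-congʳ (-‿inverseˡ z)) (+-identityˡ _)))))) ⟩
      (x - b) * p                      ≈⟨ *-comm _ _ ⟩
      p * (x - b)                      ∎)

    module Newton (N : ℕ) = Branching (Series R n) (var n) (λ _ → newton (var n) (h n)) (λ _ β z → var n z - h n β)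
      (λ _ _ _ → 1#) (λ _ β z i → newton-step (newton (var n) (h n) β i) (var n i) (var n z) (h n β)) (suc N)

  shiftedPower-newton : ∀ k r → shiftedPower n k r ≈ newton (var n) (h n) r k
  shiftedPower-newton k zero    = refl
  shiftedPower-newton k (suc r) = *-cong (shiftedPower-newton k r)
    (+-congˡ (-‿cong (reflexive (≡.cong (const n ∘ a) (≡.trans (ℤₚ.m-n≡m⊖n (suc n) (suc r)) (ℤₚ.[1+m]⊖[1+n]≡m⊖n n r))))))

  -- `divVandermonde` returns the true quotient only for multiples of the Vandermonde product;
  -- `Newton.D` shows that the alternant is such a multiple.
  doubleSchur-alternant : ∀ μ → len μ ≤ n →
    vandermondeOn (var n) points * doubleSchur n μ ≈ E (rows (newton (var n) (h n)) n (firstParts μ n)) points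
  doubleSchur-alternant μ len≤ with len μ ℕₚ.≤? n
  ... | no  l = contradiction len≤ l
  ... | yes _ = trans (*-congˡ (detRatio-rows μ (newton (var n) (h n)) _ (Newton.D (part μ 1) n suc (firstParts μ n))
      (λ k l _ _ → shiftedPower-newton k (part μ l ℕ.+ (n ∸ l))) V*D)) V*D
    where
    V*D : vandermondeOn (var n) points * Newton.D (part μ 1) n suc (firstParts μ n) ≈ E (rows (newton (var n) (h n)) n (firstParts μ n)) points
    V*D = Newton.vandermonde-D (part μ 1) n suc ℕₚ.≤-refl (firstParts-shape μ n)

  doubleSchur-zero : ∀ μ → n < len μ → doubleSchur n μ ≈ 0#
  doubleSchur-zero μ l with len μ ℕₚ.≤? n
  ... | no  _ = refl
  ... | yes l′ = contradiction l′ (ℕₚ.<⇒≱ l)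

  open DualFunctions (Series R n) (var n) h h-diagonal γ γ-inverse using (ψ; dual)

  module Dual (N : ℕ) = DualAlternants (Series R n) (var n) h h-diagonal γ γ-inverse N

  open Exponentiation semiring using (_^_)

  private
    -- The factors 1 - aₛ x of the numerator cancel against the first n - 1
    -- denominators.
    cancel : ∀ i t d → t ℕ.+ d < n → (∏[ t ℕ.+ d ] λ s → α i s 0) * run (γ i n) (n ∸ (t ℕ.+ d)) d ≈ ∏[ t ] λ s → α i s 0
    cancel i t zero    l rewrite ℕₚ.+-identityʳ t = *-identityʳ _
    cancel i t (suc d) l rewrite ℕₚ.+-suc t d = begin
      ((∏[ t ℕ.+ d ] λ s → α i s 0) * α i m 0) * (γ i n (n ∸ m) * run (γ i n) (suc (n ∸ m)) d)
        ≈⟨ *-interchange _ _ _ _ ⟩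
      ((∏[ t ℕ.+ d ] λ s → α i s 0) * γ i n (n ∸ m)) * (α i m 0 * run (γ i n) (suc (n ∸ m)) d)
        ≈⟨ trans (*-assoc _ _ _) (*-congˡ (trans (sym (*-assoc _ _ _)) (one-* _ (trans (*-congʳ γ≈) (trans (*-comm _ _) (γ-inverse i m 0)))))) ⟩
      (∏[ t ℕ.+ d ] λ s → α i s 0) * run (γ i n) (suc (n ∸ m)) d
        ≡⟨ ≡.cong (λ s → (∏[ t ℕ.+ d ] λ s → α i s 0) * run (γ i n) s d) (≡.sym (ℕₚ.+-∸-assoc 1 (ℕₚ.<⇒≤ l))) ⟩
      (∏[ t ℕ.+ d ] λ s → α i s 0) * run (γ i n) (n ∸ (t ℕ.+ d)) d
        ≈⟨ cancel i t d (ℕₚ.<⇒≤ l) ⟩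
      (∏[ t ] λ s → α i s 0) ∎
      where
      m = suc (t ℕ.+ d)
      γ≈ : γ i n (n ∸ m) ≈ γ i m 0
      γ≈ = trans (reflexive (≡.cong (λ s → γ i s (n ∸ m)) (≡.sym (ℕₚ.m+[n∸m]≡n (ℕₚ.<⇒≤ l))))) (γ-shift i m 0 (n ∸ m))

    run-∏ : ∀ (f g : ℕ → Carrier) p d → (∀ j → g (p ℕ.+ j) ≈ f (suc j)) → run g p d ≈ ∏[ d ] f
    run-∏ f g p zero    e = refl
    run-∏ f g p (suc d) e = trans (run-last g p d) (*-cong (run-∏ f g p d e) (e d))

    run-const : ∀ u p d → run (λ _ → u) p d ≈ u ^ d
    run-const u p zero    = refl
    run-const u p (suc d) = *-congˡ (run-const u (suc p) d)

    ψ-pred : ∀ m i → 1 ≤ m → ψ m i ≈ ∏[ m ∸ 1 ] λ s → α i s 0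
    ψ-pred (suc m) i _ = refl

    dualEntry : Partition → ℕ → ℕ → Carrier
    dualEntry μ k l = var n k ^ (part μ l ℕ.+ (n ∸ l)) *
      (ifDec (l ℕₚ.≤? diagonal μ)
       then ∏[ suc (part μ l) ∸ l ] (λ p → geometric n (a (ℤ.1ℤ ℤ.- + p)) k)
       else ∏[ l ∸ part μ l ∸ 1 ] (λ p → oneMinus n (a (+ p)) k))

    dualEntry-dual : ∀ μ k l → 1 ≤ l → l ≤ n → dualEntry μ k l ≈ dual n (part μ l ℕ.+ (n ∸ l)) k
    dualEntry-dual μ k l 1≤l l≤n = sym (begin
      ψ₀ * run (q₁ k n) 1 β
        ≈⟨ *-congˡ (trans (run-* (λ _ → var n k) (γ k n) 1 β) (*-congʳ (run-const (var n k) 1 β))) ⟩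
      ψ₀ * (var n k ^ β * run (γ k n) 1 β)
        ≈⟨ *-exchange _ _ _ ⟩
      var n k ^ β * (ψ₀ * run (γ k n) 1 β)
        ≈⟨ *-congˡ factor ⟩
      dualEntry μ k l ∎)
      where
      β = part μ l ℕ.+ (n ∸ l)
      ψ₀ = ψ n k
      1≤n : 1 ≤ n
      1≤n = ℕₚ.≤-trans 1≤l l≤n
      n∸1<n : n ∸ 1 < n
      n∸1<n = ≡.subst (n ∸ 1 <_) (ℕₚ.m+[n∸m]≡n 1≤n) ℕₚ.≤-refl
      factor : ψ₀ * run (γ k n) 1 β ≈
        (ifDec (l ℕₚ.≤? diagonal μ)
         then ∏[ suc (part μ l) ∸ l ] (λ p → geometric n (a (ℤ.1ℤ ℤ.- + p)) k)
         else ∏[ l ∸ part μ l ∸ 1 ] (λ p → oneMinus n (a (+ p)) k))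
      factor with l ℕₚ.≤? diagonal μ
      -- On or above the diagonal β ≥ n: the first n - 1 denominators use up all of `ψ`, and those
      -- that follow start at 1 - a₀ x.
      ... | yes l≤d = begin
        ψ₀ * run (γ k n) 1 β
          ≈⟨ *-cong (ψ-pred n k 1≤n) (trans (reflexive (≡.cong (run (γ k n) 1) β≡)) (trans (run-+ (γ k n) 1 (n ∸ 1) (suc (part μ l) ∸ l))
               (*-congˡ (reflexive (≡.cong (λ s → run (γ k n) s (suc (part μ l) ∸ l)) (ℕₚ.m+[n∸m]≡n 1≤n)))))) ⟩
        P * (run (γ k n) 1 (n ∸ 1) * run (γ k n) n (suc (part μ l) ∸ l))
          ≈⟨ trans (sym (*-assoc _ _ _)) (one-* _ (trans (*-congˡ (reflexive (≡.cong (λ s → run (γ k n) s (n ∸ 1)) (≡.sym (ℕₚ.m∸[m∸n]≡n 1≤n)))))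
               (cancel k 0 (n ∸ 1) n∸1<n))) ⟩
        run (γ k n) n (suc (part μ l) ∸ l)
          ≈⟨ run-∏ (λ p → geometric n (a (ℤ.1ℤ ℤ.- + p)) k) (γ k n) n (suc (part μ l) ∸ l)
               (λ j → reflexive (≡.cong (λ z → geometric n (a z) k) (≡.sym (1-p≡⊖ n j)))) ⟩
        ∏[ suc (part μ l) ∸ l ] (λ p → geometric n (a (ℤ.1ℤ ℤ.- + p)) k) ∎
        where
        P = ∏[ n ∸ 1 ] λ s → α k s 0
        l≤ : l ≤ part μ l
        l≤ = proj₂ (diagonal-spec μ 1≤l) l≤d
        β≡ : β ≡ n ∸ 1 ℕ.+ (suc (part μ l) ∸ l)
        β≡ = exponent-≥ 1≤n l≤n l≤
      -- Below the diagonal β < n: every denominator cancels, together with the last β factors of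
      -- `ψ`.
      ... | no l≰d = begin
        ψ₀ * run (γ k n) 1 β
          ≈⟨ *-cong (trans (ψ-pred n k 1≤n) (reflexive (≡.cong (λ t → ∏[ t ] λ s → α k s 0) (≡.sym t+β))))
               (reflexive (≡.cong (λ s → run (γ k n) s β) (≡.sym (≡.trans (≡.cong (n ∸_) t+β) (ℕₚ.m∸[m∸n]≡n 1≤n))))) ⟩
        (∏[ t ℕ.+ β ] λ s → α k s 0) * run (γ k n) (n ∸ (t ℕ.+ β)) β
          ≈⟨ cancel k t β (≡.subst (_< n) (≡.sym t+β) n∸1<n) ⟩
        ∏[ t ] (λ s → α k s 0) ∎
        where
        t = l ∸ part μ l ∸ 1
        λ<l : part μ l < l
        λ<l = ℕₚ.≰⇒> (λ l≤ → l≰d (proj₁ (diagonal-spec μ 1≤l) l≤))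
        t+β : t ℕ.+ β ≡ n ∸ 1
        t+β = exponent-< 1≤l l≤n λ<l

  private
    firstParts-∅ : ∀ k n′ → map (part ∅) (countFrom k n′) ≡ replicate n′ 0
    firstParts-∅ k       zero     = ≡.refl
    firstParts-∅ zero    (suc n′) = ≡.cong (0 ∷_) (firstParts-∅ 1 n′)
    firstParts-∅ (suc k) (suc n′) = ≡.cong (0 ∷_) (firstParts-∅ (suc (suc k)) n′)

  skewDualSchur-D : ∀ μ n′ → n ≤ n′ → len μ ≤ n′ → let open Dual (part μ 1) in
    skewDualSchur n μ ∅ ≈ atMost n (firstParts μ n′) * D n suc (take n (firstParts μ n′))
  skewDualSchur-D μ n′ n≤n′ len≤ = begin
    skewDualSchur n μ ∅
      ≈⟨ skewDualSchur-chains {μ} {∅} n′ {part μ 1} ∅⊆ len≤ ℕₚ.≤-refl ⟩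
    chains runWeight (part μ 1) n′ n (firstParts ∅ n′) (firstParts μ n′)
      ≡⟨ ≡.cong (λ ms → chains runWeight (part μ 1) n′ n ms (firstParts μ n′)) (firstParts-∅ 1 n′) ⟩
    chains runWeight (part μ 1) n′ n (replicate n′ 0) (firstParts μ n′)
      ≈⟨ Dual.dual-chains (part μ 1) n n′ id (firstParts μ n′) n≤n′ (Shape-length (firstParts-shape μ n′))
           (Shape-All ℕₚ.≤-refl (firstParts-shape μ n′)) ⟩
    _ ∎
    where
    ∅⊆ : ∅ ⊆ μ
    ∅⊆ zero    = z≤n
    ∅⊆ (suc k) = z≤n

  dualSchur-skew : ∀ μ → dualSchur n μ ≈ skewDualSchur n μ ∅
  dualSchur-skew μ with len μ ℕₚ.≤? n
  ... | yes len≤ = detRatio-rows μ (dual n) (dualEntry μ) (skewDualSchur n μ ∅) (λ k l → dualEntry-dual μ k l) (begin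
      vandermondeOn (var n) points * skewDualSchur n μ ∅
        ≈⟨ *-congˡ (trans (skewDualSchur-D μ n ℕₚ.≤-refl len≤) (one-* _ (all-rows n (firstParts-shape μ n)))) ⟩
      vandermondeOn (var n) points * Dual.D N n suc (take n (firstParts μ n))
        ≡⟨ ≡.cong (λ ms → vandermondeOn (var n) points * Dual.D N n suc ms)
             (≡.trans (≡.cong (λ s → take s (firstParts μ n)) (≡.sym (Shape-length (firstParts-shape μ n)))) (Listₚ.take-all _ (firstParts μ n) ℕₚ.≤-refl)) ⟩
      vandermondeOn (var n) points * Dual.D N n suc (firstParts μ n)
        ≈⟨ Dual.vandermonde-D N n suc ℕₚ.≤-refl (firstParts-shape μ n) ⟩
      E (rows (dual n) n (firstParts μ n)) points ∎)
    where
    N = part μ 1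
    all-rows : ∀ {b ms} n → Shape b n ms → Dual.atMost N n ms ≈ 1#
    all-rows zero    []       = refl
    all-rows (suc n) (_ ∷ ms) = all-rows n ms
  -- The shape is listed with all its rows; row n + 1 is positive, so the indicator `atMost n` is
  -- zero.
  ... | no len≰ = sym (begin
      skewDualSchur n μ ∅
        ≈⟨ skewDualSchur-D μ (len μ) (ℕₚ.<⇒≤ n<len) ℕₚ.≤-refl ⟩
      Dual.atMost N n (firstParts μ (len μ)) * Dual.D N n suc (take n (firstParts μ (len μ)))
        ≈⟨ zero-* _ (extra-row 1 n (len μ) n<len (nth-positive (positive μ) n n<len)) ⟩
      0# ∎)
    where
    N = part μ 1
    n<len : n < len μ
    n<len = ℕₚ.≰⇒> len≰
    nth-positive : ∀ {xs} → All (1 ≤_) xs → ∀ k → k < length xs → 1 ≤ nth 0 xs (suc k)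
    nth-positive (p ∷ ps) zero    _       = p
    nth-positive (p ∷ ps) (suc k) (s≤s l) = nth-positive ps k l
    extra-row : ∀ k n n′ → n < n′ → 1 ≤ part μ (k ℕ.+ n) → Dual.atMost N n (map (part μ) (countFrom k n′)) ≈ 0#
    extra-row k zero    (suc n′) _       p rewrite ℕₚ.+-identityʳ k = zero-* _ (⟦≤⟧-zero p)
    extra-row k (suc n) (suc n′) (s≤s l) p rewrite ℕₚ.+-suc k n = extra-row (suc k) n n′ l p

-- Order of power series, coefficients and constants.

module Order (R : CommutativeRing c ℓ) where

  open Variables R
  open PowerSeriesIn using (convolve; constant-*; indeterminate-*; indeterminate-*₀)

  -- The coefficients of total degree less than d vanish.
  Order : ∀ m → ℕ → Ser.Carrier m → Set ℓ
  Order zero    zero    f = Lift ℓ ⊤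
  Order zero    (suc d) f = Ser._≈_ zero f (Ser.0# zero)
  Order (suc m) d       f = ∀ k → Order m (d ∸ k) (f k)

  order-cong : ∀ m d {f g} → Ser._≈_ m f g → Order m d f → Order m d g
  order-cong zero    zero    e o = o
  order-cong zero    (suc d) e o = Ser.trans zero (Ser.sym zero e) o
  order-cong (suc m) d       e o = λ k → order-cong m (d ∸ k) (e k) (o k)

  order-0 : ∀ m d → Order m d (Ser.0# m)
  order-0 zero    zero    = lift tt
  order-0 zero    (suc d) = Ser.refl zero
  order-0 (suc m) d       = λ k → order-0 m (d ∸ k)

  order-zero : ∀ m f → Order m 0 f
  order-zero zero    f = lift tt
  order-zero (suc m) f = λ { zero → order-zero m (f 0) ; (suc k) → order-zero m (f (suc k)) }

  order-mono : ∀ m {d d′ f} → d ≤ d′ → Order m d′ f → Order m d f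
  order-mono zero    {zero}            l       o = lift tt
  order-mono zero    {suc d} {suc d′}  l       o = o
  order-mono (suc m) l o = λ k → order-mono m (ℕₚ.∸-monoˡ-≤ k l) (o k)

  order-+ : ∀ m d {f g} → Order m d f → Order m d g → Order m d (Ser._+_ m f g)
  order-+ zero    zero    o o′ = lift tt
  order-+ zero    (suc d) o o′ = Ser.trans zero (Ser.+-cong zero o o′) (Ser.+-identityˡ zero _)
  order-+ (suc m) d       o o′ = λ k → order-+ m (d ∸ k) (o k) (o′ k)

  order-*ˡ : ∀ m d f {g} → Order m d g → Order m d (Ser._*_ m f g)
  order-*ˡ zero    zero    f o = lift tt
  order-*ˡ zero    (suc d) f o = Ser.trans zero (Ser.*-congˡ zero o) (Ser.zeroʳ zero f)
  order-*ˡ (suc m) d f {g} o = go f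
    where
    go : ∀ f k → Order m (d ∸ k) (convolve (Series R m) f g k)
    go f zero    = order-*ˡ m d (f 0) (o 0)
    go f (suc k) = order-+ m (d ∸ suc k) (order-*ˡ m (d ∸ suc k) (f 0) (o (suc k)))
      (order-mono m (ℕₚ.∸-monoʳ-≤ d (ℕₚ.n≤1+n k)) (go (λ j → f (suc j)) k))

  order-*ʳ : ∀ m d {f} g → Order m d f → Order m d (Ser._*_ m f g)
  order-*ʳ m d g o = order-cong m d (Ser.*-comm m _ _) (order-*ˡ m d g o)

  order-var : ∀ m d i {f} → Order m d f → Order m (suc d) (Ser._*_ m (var m i) f)
  order-var zero    d i o = Ser.zeroˡ zero _
  order-var (suc m) d i {f} o with i ℕₚ.≟ suc m
  ... | yes _ = λ
    { zero    → order-cong m (suc d) (Ser.sym m (indeterminate-*₀ (Series R m) f)) (order-0 m (suc d))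
    ; (suc k) → order-cong m (d ∸ k) (Ser.sym m (indeterminate-* (Series R m) f k)) (o k) }
  ... | no  _ = λ k → order-cong m (suc d ∸ k) (Ser.sym m (constant-* (Series R m) (var m i) f k))
    (order-mono m (suc∸ d k) (order-var m (d ∸ k) i (o k)))
    where
    suc∸ : ∀ d k → suc d ∸ k ≤ suc (d ∸ k)
    suc∸ d       zero    = ℕₚ.≤-refl
    suc∸ zero    (suc k) = ℕₚ.≤-trans (ℕₚ.m∸n≤m 0 k) z≤n
    suc∸ (suc d) (suc k) = suc∸ d k

  order-coeff : ∀ {m d} {f : Ser.Carrier m} (e : Vec ℕ m) → Vec.sum e < d → Order m d f → Ser._≈_ zero (coeff e f) (Ser.0# zero)
  order-coeff {d = suc d} []      l o = o
  order-coeff {d = d} (k ∷ e) l o = order-coeff e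
    (ℕₚ.m+n≤o⇒m≤o∸n (suc (Vec.sum e)) (≡.subst (_≤ d) (≡.cong suc (ℕₚ.+-comm k (Vec.sum e))) l)) (o k)

  coeff-cong : ∀ {m} {f g : Ser.Carrier m} (e : Vec ℕ m) → Ser._≈_ m f g → Ser._≈_ zero (coeff e f) (coeff e g)
  coeff-cong []      eq = eq
  coeff-cong (k ∷ e) eq = coeff-cong e (eq k)

  coeff-+ : ∀ {m} (e : Vec ℕ m) (f g : Ser.Carrier m) → Ser._≈_ zero (coeff e (Ser._+_ m f g)) (Ser._+_ zero (coeff e f) (coeff e g))
  coeff-+ []      f g = Ser.refl zero
  coeff-+ (k ∷ e) f g = coeff-+ e (f k) (g k)

  coeff-0 : ∀ {m} (e : Vec ℕ m) → Ser._≈_ zero (coeff e (Ser.0# m)) (Ser.0# zero)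
  coeff-0 []      = Ser.refl zero
  coeff-0 (k ∷ e) = coeff-0 e

  coeff-Σ : ∀ {m} (e : Vec ℕ m) (f : A → Ser.Carrier m) xs →
    Ser._≈_ zero (BigOperators.∑ R (map (λ x → coeff e (f x)) xs)) (coeff e (BigOperators.∑ (Series R m) (map f xs)))
  coeff-Σ e f []       = Ser.sym zero (coeff-0 e)
  coeff-Σ {m = m} e f (x ∷ xs) = Ser.trans zero (Ser.+-congˡ zero (coeff-Σ e f xs)) (Ser.sym zero (coeff-+ e (f x) _))

  -- Multiplication by a constant acts on each coefficient separately, so an element that can be
  -- cancelled in the base ring can be cancelled from every coefficient of low degree.
  order-cancel : ∀ m d v → (∀ w → Ser._≈_ zero (Ser._*_ zero v w) (Ser.0# zero) → Ser._≈_ zero w (Ser.0# zero)) →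
    ∀ u → Order m d (Ser._*_ m (const m v) u) → Order m d u
  order-cancel zero    zero    v cancel u o = lift tt
  order-cancel zero    (suc d) v cancel u o = cancel u o
  order-cancel (suc m) d       v cancel u o = λ k → order-cancel m (d ∸ k) v cancel (u k)
    (order-cong m (d ∸ k) (constant-* (Series R m) (const m v) u k) (o k))

  open PowerSeriesIn using (constant; constant-cong; constant-hom)

  const-cong : ∀ m {u v} → Ser._≈_ zero u v → Ser._≈_ m (const m u) (const m v)
  const-cong zero    e = e
  const-cong (suc m) e = constant-cong (Series R m) (const-cong m e)

  const-+ : ∀ m u v → Ser._≈_ m (const m (Ser._+_ zero u v)) (Ser._+_ m (const m u) (const m v))
  const-+ zero    u v         = Ser.refl zero
  const-+ (suc m) u v zero    = const-+ m u v
  const-+ (suc m) u v (suc k) = Ser.sym m (Ser.+-identityˡ m _)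

  const-* : ∀ m u v → Ser._≈_ m (const m (Ser._*_ zero u v)) (Ser._*_ m (const m u) (const m v))
  const-* zero    u v = Ser.refl zero
  const-* (suc m) u v = Ser.trans (suc m) {const (suc m) (Ser._*_ zero u v)} {constant (Series R m) (Ser._*_ m (const m u) (const m v))}
    {Ser._*_ (suc m) (const (suc m) u) (const (suc m) v)}
    (constant-cong (Series R m) (const-* m u v)) (λ k → Ser.sym m (constant-hom (Series R m) (const m u) (const m v) k))

  const-0 : ∀ m → Ser._≈_ m (const m (Ser.0# zero)) (Ser.0# m)
  const-0 zero            = Ser.refl zero
  const-0 (suc m) zero    = const-0 m
  const-0 (suc m) (suc k) = Ser.refl m

  const-1 : ∀ m → Ser._≈_ m (const m (Ser.1# zero)) (Ser.1# m)
  const-1 zero    = Ser.refl zero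
  const-1 (suc m) = constant-cong (Series R m) (const-1 m)

-- Alternants under ring homomorphisms.

module Homomorphism (R : CommutativeRing c ℓ) (S : CommutativeRing c′ ℓ′)
  (φ : CommutativeRing.Carrier R → CommutativeRing.Carrier S)
  (φ-cong : ∀ {u v} → CommutativeRing._≈_ R u v → CommutativeRing._≈_ S (φ u) (φ v))
  (φ-+ : ∀ u v → CommutativeRing._≈_ S (φ (CommutativeRing._+_ R u v)) (CommutativeRing._+_ S (φ u) (φ v)))
  (φ-* : ∀ u v → CommutativeRing._≈_ S (φ (CommutativeRing._*_ R u v)) (CommutativeRing._*_ S (φ u) (φ v)))
  (φ-0 : CommutativeRing._≈_ S (φ (CommutativeRing.0# R)) (CommutativeRing.0# S))
  (φ-1 : CommutativeRing._≈_ S (φ (CommutativeRing.1# R)) (CommutativeRing.1# S)) where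

  private
    module R = Rows R
    module Rᶜ = CommutativeRing R
    open CommutativeRing S hiding (zero)
    open Rows S
    open SetoidReasoning setoid

  φ-neg : ∀ u → φ (Rᶜ.- u) ≈ - φ u
  φ-neg u = begin
    φ (Rᶜ.- u)                     ≈⟨ +-identityʳ _ ⟨
    φ (Rᶜ.- u) + 0#                ≈⟨ +-congˡ (-‿inverseʳ (φ u)) ⟨
    φ (Rᶜ.- u) + (φ u - φ u)       ≈⟨ +-assoc _ _ _ ⟨
    (φ (Rᶜ.- u) + φ u) - φ u       ≈⟨ +-congʳ (trans (sym (φ-+ _ _)) (trans (φ-cong (Rᶜ.-‿inverseˡ u)) φ-0)) ⟩
    0# - φ u                       ≈⟨ +-identityˡ _ ⟩
    - φ u                          ∎

  φ-- : ∀ u v → φ (u Rᶜ.- v) ≈ φ u - φ v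
  φ-- u v = trans (φ-+ _ _) (+-congˡ (φ-neg v))

  φ-pick : ∀ (h : A → List A → Rᶜ.Carrier) cs → φ (R.pick h cs) ≈ pick (λ c r → φ (h c r)) cs
  φ-pick h []       = φ-0
  φ-pick h (c ∷ cs) = trans (φ-- _ _) (+-congˡ (-‿cong (φ-pick _ cs)))

  φ-E : ∀ (fs : List (A → Rᶜ.Carrier)) cs → φ (R.E fs cs) ≈ E (map (φ ∘_) fs) cs
  φ-E []       []      = φ-1
  φ-E []       (_ ∷ _) = φ-0
  φ-E (f ∷ fs) cs      = trans (φ-pick _ cs) (pick-cong (λ c r → trans (φ-* _ _) (*-congˡ (φ-E fs r))) cs)

  φ-newton : ∀ (x : A → Rᶜ.Carrier) b β a → φ (R.newton x b β a) ≈ newton (φ ∘ x) (φ ∘ b) β a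
  φ-newton x b zero    a = φ-1
  φ-newton x b (suc β) a = trans (φ-* _ _) (*-cong (φ-newton x b β a) (φ-- _ _))

  φ-rows : ∀ (x : A → Rᶜ.Carrier) b n ls → map (φ ∘_) (R.rows (R.newton x b) n ls) ≗ rows (newton (φ ∘ x) (φ ∘ b)) n ls
  φ-rows x b zero    ls       = []
  φ-rows x b (suc t) []       = []
  φ-rows x b (suc t) (l ∷ ls) = (φ-newton x b (l ℕ.+ t)) ∷ φ-rows x b t ls

-- Partitions and zero-padded lists.

Shape⇒Linked : ∀ {b n ls} → Shape b n ls → Linked _≥_ ls
Shape⇒Linked []                 = []
Shape⇒Linked (_ ∷ [])           = [-]
Shape⇒Linked (_ ∷ ls@(l≤ ∷ _))  = l≤ ∷ Shape⇒Linked ls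

shape? : ∀ b n ls → Dec (Shape b n ls)
shape? b zero    []       = yes []
shape? b zero    (_ ∷ _)  = no λ ()
shape? b (suc n) []       = no λ ()
shape? b (suc n) (l ∷ ls) with l ℕₚ.≤? b | shape? l n ls
... | yes l≤ | yes s = yes (l≤ ∷ s)
... | no  ¬l | _     = no λ { (l≤ ∷ _) → ¬l l≤ }
... | yes _  | no ¬s = no λ { (_ ∷ s) → ¬s s }

positives : List ℕ → List ℕ
positives = filter (1 ℕₚ.≤?_)

-- ∅ is a junk value, used if ls is not weakly decreasing.
toPartition : List ℕ → Partition
toPartition ls with Linked.linked? ℕₚ._≥?_ (positives ls)
... | yes l = record { parts = positives ls ; decreasing = l ; positive = AllProperties.all-filter (1 ℕₚ.≤?_) ls }
... | no  _ = ∅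

parts-toPartition : ∀ {b n ls} → Shape b n ls → parts (toPartition ls) ≡ positives ls
parts-toPartition {ls = ls} s with Linked.linked? ℕₚ._≥?_ (positives ls)
... | yes _ = ≡.refl
... | no ¬l = contradiction (LinkedProperties.filter⁺ (1 ℕₚ.≤?_) (λ i≥j j≥k → ℕₚ.≤-trans j≥k i≥j) (Shape⇒Linked s)) ¬l

partition-≡ : ∀ {μ ν} → parts μ ≡ parts ν → μ ≡ ν
partition-≡ {μ} {ν} ≡.refl = ≡.cong₂ (λ d p → record { parts = parts μ ; decreasing = d ; positive = p })
  (Linked.irrelevant ℕₚ.≤-irrelevant _ _) (All.irrelevant ℕₚ.≤-irrelevant _ _)

private
  zero-shape : ∀ {n ls} → Shape 0 n ls → positives ls ≡ [] × (∀ k → nth 0 ls k ≡ 0)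
  zero-shape [] = ≡.refl , λ { zero → ≡.refl ; (suc _) → ≡.refl }
  zero-shape (z≤n ∷ s) with zero-shape s
  ... | e , f = e , λ { zero → ≡.refl ; (suc zero) → ≡.refl ; (suc (suc k)) → f (suc k) }

-- In a weakly decreasing list the zeros come last, and 0 is also the default value of `nth`, so
-- deleting them changes no part.
nth-positives : ∀ {b n ls} → Shape b n ls → ∀ k → nth 0 (positives ls) k ≡ nth 0 ls k
nth-positives []                       k             = ≡.refl
nth-positives (_∷_ {l = zero}  _ s)    k with zero-shape s
... | e , f = ≡.trans (≡.cong (λ xs → nth 0 xs k) e) (≡.trans (nth-[] k) (≡.sym (rest k)))
  where
  nth-[] : ∀ k → nth 0 [] k ≡ 0
  nth-[] zero    = ≡.refl
  nth-[] (suc _) = ≡.refl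
  rest : ∀ k → nth 0 (0 ∷ _) k ≡ 0
  rest zero          = ≡.refl
  rest (suc zero)    = ≡.refl
  rest (suc (suc k)) = f (suc k)
nth-positives (_∷_ {l = suc l} _ s) zero          = ≡.refl
nth-positives (_∷_ {l = suc l} _ s) (suc zero)    = ≡.refl
nth-positives (_∷_ {l = suc l} _ s) (suc (suc k)) = nth-positives s (suc k)

part-toPartition : ∀ {b n ls} → Shape b n ls → ∀ k → part (toPartition ls) k ≡ nth 0 ls k
part-toPartition s k = ≡.trans (≡.cong (λ xs → nth 0 xs k) (parts-toPartition s)) (nth-positives s k)

firstParts-toPartition : ∀ {b n ls} → Shape b n ls → firstParts (toPartition ls) n ≡ ls
firstParts-toPartition {n = n} {ls} s = ≡.trans (Listₚ.map-cong (part-toPartition s) (countFrom 1 n))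
  (≡.trans (≡.cong (λ k → map (nth 0 ls) (countFrom 1 k)) (≡.sym (Shape-length s))) (map-nth 0 ls))

positives-firstParts : ∀ ν n → len ν ≤ n → positives (firstParts ν n) ≡ parts ν
positives-firstParts ν n = go (positive ν) n
  where
  empty : ∀ k n → positives (map (nth 0 []) (countFrom k n)) ≡ []
  empty k       zero    = ≡.refl
  empty zero    (suc n) = empty 1 n
  empty (suc k) (suc n) = empty (suc (suc k)) n
  go : ∀ {xs} → All (1 ≤_) xs → ∀ n → length xs ≤ n → positives (map (nth 0 xs) (countFrom 1 n)) ≡ xs
  go []                           n       _       = empty 1 n
  go (_∷_ {x = suc x} {xs} _ ps) (suc n) (s≤s l) = ≡.cong (suc x ∷_)
    (≡.trans (≡.cong positives (map-nth-∷ 0 (suc x) xs 0 n)) (go ps n l))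

toPartition-firstParts : ∀ ν n → len ν ≤ n → toPartition (firstParts ν n) ≡ ν
toPartition-firstParts ν n l = partition-≡ (≡.trans (parts-toPartition (firstParts-shape ν n)) (positives-firstParts ν n l))

nth-firstParts : ∀ μ n → len μ ≤ n → ∀ k → nth 0 (firstParts μ n) k ≡ part μ k
nth-firstParts μ n l k = ≡.trans (≡.sym (nth-positives (firstParts-shape μ n) k))
  (≡.cong (λ xs → nth 0 xs k) (positives-firstParts μ n l))

len-toPartition : ∀ {b n ls} → Shape b n ls → len (toPartition ls) ≤ n
len-toPartition {n = n} {ls} s = ≡.subst₂ _≤_ (≡.cong length (≡.sym (parts-toPartition s))) (Shape-length s) (Listₚ.length-filter (1 ℕₚ.≤?_) ls)

nth-Pointwise : ∀ {xs ys} → Pointwise _≤_ xs ys → ∀ k → nth 0 xs k ≤ nth 0 ys k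
nth-Pointwise []       zero          = z≤n
nth-Pointwise []       (suc k)       = z≤n
nth-Pointwise (l ∷ ls) zero          = z≤n
nth-Pointwise (l ∷ ls) (suc zero)    = l
nth-Pointwise (l ∷ ls) (suc (suc k)) = nth-Pointwise ls (suc k)

firstParts-⊆ : ∀ {μ ν} → μ ⊆ ν → ∀ n → Pointwise _≤_ (firstParts μ n) (firstParts ν n)
firstParts-⊆ {μ} {ν} μ⊆ν n = go 1 n
  where
  go : ∀ k n → Pointwise _≤_ (map (part μ) (countFrom k n)) (map (part ν) (countFrom k n))
  go k zero    = []
  go k (suc n) = μ⊆ν k ∷ go (suc k) n

tuples-Unique : ∀ K n → Unique (tuples K n)
tuples-Unique K zero    = [] ∷ []
tuples-Unique K (suc n) = UniqueProperties.cartesianProductWith⁺ _∷_ (λ { ≡.refl → ≡.refl , ≡.refl }) (UniqueProperties.upTo⁺ K) (tuples-Unique K n)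

∈-tuples : ∀ {K n ls} → All (_< K) ls → length ls ≡ n → ls ∈ tuples K n
∈-tuples []       ≡.refl = here ≡.refl
∈-tuples {K} (l ∷ ls) ≡.refl = ∈-cartesianProductWith⁺ _∷_ (∈-upTo⁺ l) (∈-tuples ls ≡.refl)

map-Unique : ∀ {A B : Set} {P : A → Set} (f : A → B) (g : B → A) → (∀ x → P x → g (f x) ≡ x) →
  ∀ {xs} → All P xs → Unique xs → Unique (map f xs)
map-Unique f g inv []       []       = []
map-Unique {P = P} f g inv {x ∷ _} (p ∷ ps) (x∉ ∷ u) = AllProperties.map⁺ (go ps x∉) ∷ map-Unique f g inv ps u
  where
  go : ∀ {ys} → All P ys → All (x ≢_) ys → All (λ y → f x ≢ f y) ys
  go []        []        = []
  go (q ∷ qs) (x≢ ∷ r) = (λ e → x≢ (≡.trans (≡.sym (inv _ p)) (≡.trans (≡.cong g e) (inv _ q)))) ∷ go qs r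

-- The Cauchy identity, coefficient by coefficient.

module ChainSupport (R : CommutativeRing c ℓ) where

  open CommutativeRing R hiding (zero)
  open Strips R

  Σ-filter-support : ∀ {P : A → Set p} (P? : Decidable P) (f : A → Carrier) →
    ∀ {xs} → All (λ x → ¬ P x → f x ≈ 0#) xs → Σ[ filter P? xs ] f ≈ Σ[ xs ] f
  Σ-filter-support P? f [] = refl
  Σ-filter-support P? f (_∷_ {x = x} e es) with P? x
  ... | yes _ = +-congˡ (Σ-filter-support P? f es)
  ... | no ¬p = trans (Σ-filter-support P? f es) (sym (trans (+-congʳ (e ¬p)) (+-identityˡ _)))

  δ-support : ∀ ms ns → δ ms ns ≈ 0# ⊎ ms ≡ ns
  δ-support []       []       = inj₂ ≡.refl
  δ-support []       (_ ∷ _)  = inj₁ refl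
  δ-support (_ ∷ _)  []       = inj₁ refl
  δ-support (m ∷ ms) (n ∷ ns) with ⟦≤⟧-split m n | ⟦≤⟧-split n m | δ-support ms ns
  ... | inj₂ (_ , e)   | _              | _        = inj₁ (zero-* _ (zero-* _ e))
  ... | inj₁ _         | inj₂ (_ , e)   | _        = inj₁ (zero-* _ (*-zero _ e))
  ... | inj₁ _         | inj₁ _         | inj₁ e   = inj₁ (*-zero _ e)
  ... | inj₁ (m≤n , _) | inj₁ (n≤m , _) | inj₂ eq  = inj₂ (≡.cong₂ _∷_ (ℕₚ.≤-antisym m≤n n≤m) eq)

  strip-contains : ∀ W k b ms rs → strip W k b ms rs ≈ 0# ⊎ Pointwise _≤_ ms rs
  strip-contains W k b []       []       = inj₂ []
  strip-contains W k b []       (_ ∷ _)  = inj₁ refl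
  strip-contains W k b (_ ∷ _)  []       = inj₁ refl
  strip-contains W k b (m ∷ ms) (r ∷ rs) with ⟦≤⟧-split m r | strip-contains W (suc k) m ms rs
  ... | inj₂ (_ , e)   | _       = inj₁ (zero-* _ (zero-* _ (zero-* _ e)))
  ... | inj₁ _         | inj₁ e  = inj₁ (*-zero _ e)
  ... | inj₁ (m≤r , _) | inj₂ ls = inj₂ (m≤r ∷ ls)

  chains-support : ∀ W N n m {μs νs} → Shape N n μs → ¬ (Shape N n νs × Pointwise _≤_ μs νs) → chains W N n m μs νs ≈ 0#
  chains-support W N n zero    {μs} {νs} μs↓ ¬good with δ-support μs νs
  ... | inj₁ e      = e
  ... | inj₂ ≡.refl = contradiction (μs↓ , Pointwise.refl ℕₚ.≤-refl) ¬good
  chains-support W N n (suc m) {μs} {νs} μs↓ ¬good =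
    trans (Σ-cong-All (All.map (λ {ρs} → each ρs) (tuples-length (suc N) n))) (Σ-zero (tuples (suc N) n))
    where
    each : ∀ ρs → length ρs ≡ n → strip (W (suc m)) 1 N μs ρs * chains W N n m ρs νs ≈ 0#
    each ρs eq with strip-support (W (suc m)) 1 μs↓ ρs eq | strip-contains (W (suc m)) 1 N μs ρs
    ... | inj₁ e   | _        = zero-* _ e
    ... | inj₂ _   | inj₁ e   = zero-* _ e
    ... | inj₂ ρs↓ | inj₂ μ≤ρ = *-zero _ (chains-support W N n m ρs↓
      (λ (νs↓ , ρ≤ν) → ¬good (νs↓ , Pointwise.transitive ℕₚ.≤-trans μ≤ρ ρ≤ν)))

module CauchyIdentity (R : CommutativeRing c ℓ) (a : ℤ → CommutativeRing.Carrier R) (n m : ℕ) where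

  private
    module C = Cauchy R a n m
    module x = C.x
    module y = C.y
    module xₛ = SchurBridge R a n
    module yₛ = SchurBridge (Series R n) (λ k → x.const n (a k)) m
    module Rₙ = CommutativeRing (Series R n)
    module Eₙ = Rows (Series R n)
  open CommutativeRing (Series (Series R n) m) hiding (zero)
  open Order (Series R n)
  open Weights (Series (Series R n) m) (y.var m) yₛ.h yₛ.h-diagonal yₛ.γ yₛ.γ-inverse
  open ChainSupport (Series (Series R n) m)
  open Homomorphism (Series R n) (Series (Series R n) m) (y.const m) (const-cong m) (const-+ m) (const-* m) (const-0 m) (const-1 m)
  open SetoidReasoning setoid

  points : List ℕ
  points = applyUpTo suc n

  xₐ : ℕ → Carrier
  xₐ k = y.const m (x.var n k)

  g : ℕ → ℕ → Carrier
  g i k = y.geometric m (x.var n k) i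

  V : Rₙ.Carrier
  V = Eₙ.vandermondeOn (x.var n) points

  s : Partition → Carrier
  s ν = y.const m (x.doubleSchur n ν)

  -- Exact division recovers w from `V` times w, whatever the coefficient ring.
  vandermonde-cancel : ∀ w → V Rₙ.* w Rₙ.≈ Rₙ.0# → w Rₙ.≈ Rₙ.0#
  vandermonde-cancel w e = Rₙ.trans (Rₙ.sym (x.divVandermonde-unique n w (Rₙ.*-congʳ (Rₙ.sym xₛ.vandermonde-points))))
    (x.divVandermonde-unique n Rₙ.0# (Rₙ.trans e (Rₙ.sym (Rₙ.zeroʳ _))))

  module Truncated (D N : ℕ) where

    open Kernel xₐ g (λ i k → y.geometric-inverse m (x.var n k) i) points n N (Order m (suc D))
      (order-cong m (suc D)) (order-0 m (suc D)) (order-+ m (suc D)) (λ v → order-*ʳ m (suc D) v) public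

    kills : ∀ k j {z} → Order m j z → suc D ≤ j ℕ.+ k → Kills k z
    kills zero    j o l = order-mono m (≡.subst (suc D ≤_) (ℕₚ.+-identityʳ j) l) o
    kills (suc k) j o l = λ i → kills k (suc j) (order-cong m (suc j) (*-comm _ _) (order-var m j i o))
      (≡.subst (suc D ≤_) (ℕₚ.+-suc j k) l)

    alternant-schur : ∀ ν → len ν ≤ n → alternant (firstParts ν n) ≈ y.const m V * s ν
    alternant-schur ν len≤ = begin
      E (rows (newton xₐ (yₛ.h n)) n (firstParts ν n)) points
        ≈⟨ E-cong (φ-rows (x.var n) (xₛ.h n) n (firstParts ν n)) points ⟨
      E (map (y.const m ∘_) (Eₙ.rows (Eₙ.newton (x.var n) (xₛ.h n)) n (firstParts ν n))) points
        ≈⟨ φ-E (Eₙ.rows (Eₙ.newton (x.var n) (xₛ.h n)) n (firstParts ν n)) points ⟨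
      y.const m (Eₙ.E (Eₙ.rows (Eₙ.newton (x.var n) (xₛ.h n)) n (firstParts ν n)) points)
        ≈⟨ const-cong m (xₛ.doubleSchur-alternant ν len≤) ⟨
      y.const m (V Rₙ.* x.doubleSchur n ν)
        ≈⟨ const-* m V (x.doubleSchur n ν) ⟩
      y.const m V * s ν ∎

    -- The numerators are collected by the rows of μ, the denominators by the variables y.
    kernel-value : ∀ μ → C.kernel μ ≈ kernelValue m (firstParts μ n)
    kernel-value μ = begin
      (∏[ n ] λ i → ∏[ m ] λ j → a′ i j * g j i)
        ≈⟨ trans (∏-cong (λ i → ∏-* (a′ i) (λ j → g j i) m) n) (∏-* (λ i → ∏[ m ] a′ i) (λ i → ∏[ m ] λ j → g j i) n) ⟩
      (∏[ n ] λ i → ∏[ m ] a′ i) * (∏[ n ] λ i → ∏[ m ] λ j → g j i)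
        ≈⟨ *-cong (trans (∏-cong (λ i → ∏-cong (λ j → +-congˡ (-‿cong (*-congʳ (reflexive
               (≡.cong (y.const m ∘ x.const n ∘ a) (ℤₚ.m-n≡m⊖n i (part μ i))))))) m) n) (rows-∏ 1 n (λ i → refl)))
             (trans (∏-swap (λ i j → g j i) n m) (∏-cong (λ j → points-∏ n suc (λ i → refl)) m)) ⟩
      Πrows (αs m) 1 (firstParts μ n) * (∏[ m ] λ j → Π[ points ] (g j)) ∎
      where
      a′ : ℕ → ℕ → Carrier
      a′ i j = y.oneMinus m (x.const n (a (+ i ℤ.- + part μ i))) j
      rows-∏ : ∀ k n {f : ℕ → Carrier} → (∀ i → f (suc i) ≈ αs m (k ℕ.+ i) (part μ (k ℕ.+ i))) →
        ∏[ n ] f ≈ Πrows (αs m) k (map (part μ) (countFrom k n))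
      rows-∏ k zero    e = refl
      rows-∏ k (suc n) {f} e = trans (∏-first f n) (*-cong
        (trans (e 0) (reflexive (≡.cong (λ k → αs m k (part μ k)) (ℕₚ.+-identityʳ k))))
        (rows-∏ (suc k) n (λ i → trans (e (suc i)) (reflexive (≡.cong (λ k → αs m k (part μ k)) (ℕₚ.+-suc k i))))))
      points-∏ : ∀ {j} n {f : ℕ → Carrier} (ι : ℕ → ℕ) → (∀ i → f (suc i) ≈ g j (ι i)) →
        ∏[ n ] f ≈ Π[ applyUpTo ι n ] (g j)
      points-∏ zero    ι e = refl
      points-∏ (suc n) {f} ι e = trans (∏-first f n) (*-cong (e 0) (points-∏ n (ι ∘ suc) (λ i → e (suc i))))

  module _ (μ : Partition) (len≤ : len μ ≤ n) where

    summand : Partition → Carrier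
    summand ν = s ν * y.skewDualSchur m ν μ

    module _ (D : ℕ) where

      private
        -- A longer first row has more than D boxes outside μ and so contributes only in order
        -- greater than D.
        N = part μ 1 ℕ.+ D
        μs = firstParts μ n
      open Truncated D N

      μ↓ : Shape N n μs
      μ↓ = Shape-weaken (ℕₚ.m≤m+n (part μ 1) D) (firstParts-shape μ n)

      Good : List ℕ → Set
      Good νs = Shape N n νs × Pointwise _≤_ μs νs

      good? : Decidable Good
      good? νs = shape? N n νs ×-dec Pointwise.decidable ℕₚ._≤?_ μs νs

      goodLists : List (List ℕ)
      goodLists = filter good? (tuples (suc N) n)

      good-⊆ : ∀ {νs} → Good νs → μ ⊆ toPartition νs
      good-⊆ {νs} (νs↓ , μ≤ν) k = ≡.subst₂ _≤_ (nth-firstParts μ n len≤ k) (≡.sym (part-toPartition νs↓ k)) (nth-Pointwise μ≤ν k)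

      good-part : ∀ {νs} → Good νs → part (toPartition νs) 1 ≤ N
      good-part (νs↓ , _) = ≡.subst (_≤ N) (≡.sym (part-toPartition νs↓ 1)) (first νs↓)
        where
        first : ∀ {b n ls} → Shape b n ls → nth 0 ls 1 ≤ b
        first []      = z≤n
        first (l ∷ _) = l

      good-summand : ∀ νs → Good νs → alternant νs * chains runWeight N n m μs νs ≈ y.const m V * summand (toPartition νs)
      good-summand νs good@(νs↓ , _) = begin
        alternant νs * chains runWeight N n m μs νs
          ≡⟨ ≡.cong (λ ls → alternant ls * chains runWeight N n m μs ls) (firstParts-toPartition νs↓) ⟨
        alternant (firstParts ν n) * chains runWeight N n m μs (firstParts ν n)
          ≈⟨ *-cong (alternant-schur ν (len-toPartition νs↓))
               (sym (yₛ.skewDualSchur-chains {ν} {μ} n (good-⊆ good) (len-toPartition νs↓) (good-part good))) ⟩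
        (y.const m V * s ν) * y.skewDualSchur m ν μ
          ≈⟨ *-assoc _ _ _ ⟩
        y.const m V * summand ν ∎
        where ν = toPartition νs

      congruence : C.kernel μ * s μ ~ Σ[ goodLists ] (summand ∘ toPartition)
      congruence = w , o , (begin
        u                ≈⟨ +-identityʳ u ⟨
        u + 0#           ≈⟨ +-congˡ (-‿inverseˡ v) ⟨
        u + (- v + v)    ≈⟨ trans (sym (+-assoc _ _ _)) (+-comm _ _) ⟩
        v + (u - v)      ∎)
        where
        u = C.kernel μ * s μ
        v = Σ[ goodLists ] (summand ∘ toPartition)
        w = u - v
        V′ = y.const m V
        -- The number of missing factors is at least D + 1, and any D + 1 variables y multiply to
        -- order greater than D; so the multiplier can start at 1.
        Kills-1 : Kills (suc N ∸ firstPart μs) 1#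
        Kills-1 = kills (suc N ∸ firstPart μs) 0 (order-zero m 1#)
          (≡.subst (_≤ suc N ∸ firstPart μs) (≡.trans (≡.cong (_∸ part μ 1) (≡.sym (ℕₚ.+-suc (part μ 1) D))) (ℕₚ.m+n∸m≡n (part μ 1) (suc D)))
            (ℕₚ.∸-monoʳ-≤ (suc N) (first≤ n)))
          where
          first≤ : ∀ n → firstPart (firstParts μ n) ≤ part μ 1
          first≤ zero    = z≤n
          first≤ (suc n) = ℕₚ.≤-refl
        multiplied : V′ * u ~ V′ * v
        multiplied = ~-trans (≈⇒~ (begin
          V′ * (C.kernel μ * s μ)
            ≈⟨ *-exchange _ _ _ ⟩
          C.kernel μ * (V′ * s μ)
            ≈⟨ *-cong (kernel-value μ) (sym (alternant-schur μ len≤)) ⟩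
          kernelValue m μs * alternant μs
            ≈⟨ *-identityˡ _ ⟨
          1# * (kernelValue m μs * alternant μs) ∎))
          (~-trans (cauchy m {z = 1#} μ↓ Kills-1) (≈⇒~ (begin
          1# * Σ[ tuples (suc N) n ] (λ νs → alternant νs * chains runWeight N n m μs νs)
            ≈⟨ *-identityˡ _ ⟩
          Σ[ tuples (suc N) n ] (λ νs → alternant νs * chains runWeight N n m μs νs)
            ≈⟨ Σ-filter-support good? (λ νs → alternant νs * chains runWeight N n m μs νs)
                 (All.universal (λ νs ¬good → *-zero _ (chains-support runWeight N n m μ↓ ¬good)) (tuples (suc N) n)) ⟨
          Σ[ goodLists ] (λ νs → alternant νs * chains runWeight N n m μs νs)
            ≈⟨ Σ-cong-All (All.map (λ {νs} → good-summand νs) (AllProperties.all-filter good? (tuples (suc N) n))) ⟩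
          Σ[ goodLists ] (λ νs → V′ * summand (toPartition νs))
            ≈⟨ Σ-*ˡ V′ (summand ∘ toPartition) goodLists ⟨
          V′ * v ∎)))
        -- The congruence is known only after multiplication by the Vandermonde product. That
        -- product is constant in y and can be cancelled, so the difference w has the same order
        -- bound.
        o : Order m (suc D) w
        o with multiplied
        ... | r , i , e = order-cancel m (suc D) V vandermonde-cancel w (order-cong m (suc D) (sym (begin
          V′ * (u - v)       ≈⟨ x[y-z]≈xy-xz V′ u v ⟩
          V′ * u - V′ * v    ≈⟨ +-congʳ (trans e (+-comm _ _)) ⟩
          (r + V′ * v) - V′ * v ≈⟨ trans (+-assoc _ _ _) (trans (+-congˡ (-‿inverseʳ _)) (+-identityʳ _)) ⟩
          r                  ∎)) i)

      ∈-goodLists : ∀ {ν} → μ ⊆ ν → len ν ≤ n → part ν 1 ≤ N → ν ∈ map toPartition goodLists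
      ∈-goodLists {ν} μ⊆ν len≤ part≤ = ≡.subst (_∈ map toPartition goodLists) (toPartition-firstParts ν n len≤)
        (∈-map⁺ toPartition (∈-filter⁺ good? (∈-tuples (Shape-All ℕₚ.≤-refl ν↓) (Shape-length ν↓)) (ν↓ , firstParts-⊆ {μ} {ν} μ⊆ν n)))
        where
        ν↓ : Shape N n (firstParts ν n)
        ν↓ = Shape-weaken part≤ (firstParts-shape ν n)

    -- Every box contributes a factor y, and the first row alone has ν₁ - μ₁ boxes.
    order-skewDualSchur : ∀ ν {d} → d ≤ part ν 1 ∸ part μ 1 → Order m d (y.skewDualSchur m ν μ)
    order-skewDualSchur ν {d} d≤ = go (reverseTableaux m ν μ)
      where
      weight-order : ∀ T bs → Order m (length bs) (Π[ bs ] (λ α →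
        y.X m (entry μ T α) (x.const n (a (ℤ.- content α ℤ.+ ℤ.1ℤ))) (x.const n (a (ℤ.- content α)))))
      weight-order T []       = order-zero m 1#
      weight-order T (α ∷ bs) = order-cong m (suc (length bs))
        (trans (sym (*-assoc _ _ _)) (*-congʳ (sym (*-assoc _ _ _))))
        (order-var m (length bs) (entry μ T α) (order-*ˡ m (length bs) _ (weight-order T bs)))
      boxes≥ : d ≤ length (boxes ν μ)
      boxes≥ with len ν in eq
      ... | zero    = ℕₚ.≤-trans d≤ (ℕₚ.≤-trans (ℕₚ.m∸n≤m (part ν 1) (part μ 1))
        (ℕₚ.≤-reflexive (part-beyond ν (≡.subst (_< 1) (≡.sym eq) (s≤s z≤n)))))
      ... | suc L = ℕₚ.≤-trans d≤ (≡.subst (_≤ length (firstRow ++ rest)) length-firstRow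
        (≡.subst (length firstRow ≤_) (≡.sym (Listₚ.length-++ firstRow)) (ℕₚ.m≤m+n _ _)))
        where
        row : ℕ → List Box
        row k = map (λ l → k , part μ k ℕ.+ l) (oneTo (part ν k ∸ part μ k))
        firstRow rest : List Box
        firstRow = row 1
        rest = concatMap row (map suc (applyUpTo suc L))
        length-firstRow : length firstRow ≡ part ν 1 ∸ part μ 1
        length-firstRow = ≡.trans (Listₚ.length-map _ (oneTo (part ν 1 ∸ part μ 1)))
          (≡.trans (Listₚ.length-map suc (upTo (part ν 1 ∸ part μ 1))) (Listₚ.length-upTo (part ν 1 ∸ part μ 1)))
      go : ∀ Ts → Order m d (Σ[ Ts ] (y.weight m ν μ))
      go []       = order-0 m d
      go (T ∷ Ts) = order-+ m d (order-mono m boxes≥ (weight-order T (boxes ν μ))) (go Ts)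

    isSum : y.IsSum m (μ ⊆_) summand (C.kernel μ * s μ)
    isSum e = L , unique , AllProperties.map⁺ (All.map (good-⊆ D) all-good) , outside , total
      where
      -- The truncation is adapted to the monomial: its total degree is D, so series of order
      -- greater than D do not affect its coefficient.
      D = Vec.sum e
      L = map toPartition (goodLists D)
      all-good : All (Good D) (goodLists D)
      all-good = AllProperties.all-filter (good? D) (tuples (suc (part μ 1 ℕ.+ D)) n)
      unique : Unique L
      unique = map-Unique toPartition (λ ν → firstParts ν n) (λ νs (νs↓ , _) → firstParts-toPartition νs↓) all-good
        (UniqueProperties.filter⁺ (good? D) (tuples-Unique (suc (part μ 1 ℕ.+ D)) n))
      outside : ∀ ν → μ ⊆ ν → ν ∉ L → y.coeff e (summand ν) Rₙ.≈ Rₙ.0#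
      outside ν μ⊆ν ν∉ = by (len ν ℕₚ.≤? n) (part ν 1 ℕₚ.≤? part μ 1 ℕ.+ D)
        where
        by : Dec (len ν ≤ n) → Dec (part ν 1 ≤ part μ 1 ℕ.+ D) → y.coeff e (summand ν) Rₙ.≈ Rₙ.0#
        -- With more than n rows the double Schur function vanishes; with a first row longer than μ₁
        -- + D the skew dual Schur function has order greater than D.
        by (no len≰) _ = Rₙ.trans (coeff-cong e (trans (*-congʳ (trans (const-cong m (xₛ.doubleSchur-zero ν (ℕₚ.≰⇒> len≰))) (const-0 m))) (zeroˡ _))) (coeff-0 e)
        by (yes len≤) (yes part≤) = contradiction (∈-goodLists D μ⊆ν len≤ part≤) ν∉
        by (yes _) (no part≰) = order-coeff {d = suc D} e ℕₚ.≤-refl (order-*ˡ m (suc D) (s ν)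
          (order-skewDualSchur ν (≡.subst (_≤ part ν 1 ∸ part μ 1)
            (≡.trans (≡.cong (_∸ part μ 1) (≡.sym (ℕₚ.+-suc (part μ 1) D))) (ℕₚ.m+n∸m≡n (part μ 1) (suc D)))
            (ℕₚ.∸-monoˡ-≤ (part μ 1) (ℕₚ.≰⇒> part≰)))))
      total : BigOperators.∑ (Series R n) (map (λ ν → y.coeff e (summand ν)) L) Rₙ.≈ y.coeff e (C.kernel μ * s μ)
      total with congruence D
      ... | w , o , eq = Rₙ.trans (coeff-Σ e summand L) (Rₙ.sym (Rₙ.trans (coeff-cong e eq)
        (Rₙ.trans (coeff-+ e _ w) (Rₙ.trans (Rₙ.+-congˡ (order-coeff {d = suc D} e ℕₚ.≤-refl o))
          (Rₙ.trans (Rₙ.+-identityʳ _) (coeff-cong e (sym (Σ-map summand toPartition (goodLists D)))))))))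

theorem3p4 : ((μ : Partition) (n m : ℕ) → len μ ≤ n →
    let open Cauchy ℚ[a] 𝕒 n m in
    y.IsSum m (μ ⊆_)
    (λ ν → y.const m (x.doubleSchur n ν) * y.skewDualSchur m ν μ)
    (kernel μ * y.const m (x.doubleSchur n μ)))
    ×
    ((μ : Partition) (n : ℕ) →
    let open Schur ℚ[a] 𝕒
        open CommutativeRing (Series ℚ[a] n) using (_≈_) in
    dualSchur n μ ≈ skewDualSchur n μ ∅)
theorem3p4 =
  (λ μ n m len≤ → CauchyIdentity.isSum ℚ[a] 𝕒 n m μ len≤) ,
  (λ μ n → SchurBridge.dualSchur-skew ℚ[a] 𝕒 n μ)
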